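{- Let $M=\prod_{i=1}^K p_i^{n_i}$ with distinct primes $p_i$ and $n_i\ge1$, and let $f:\mathbb{Z}_M\to\mathbb{R}$ be a step function with mask polynomial $F(X)=\sum_{z=0}^{M-1}f(z)X^z$. The following are equivalent: (I) $\Phi_M(X)\mid F(X)$; (II) $F[\Delta]=0$ for all $M$-cuboids $\Delta$ having a vertex at $0$; (III) $F[\Delta]=0$ for one $M$-cuboid $\Delta$ having a vertex at $0$.
   Context: $\Phi_M$ is the $M$-th cyclotomic polynomial. For $m\mid M$, $R_m=\{z\in\mathbb{Z}_M:\gcd(z,M)=m\}$; $f$ is a step function if constant on each $R_m$. An $M$-cuboid is determined by $c\in\mathbb{Z}_M$ and $d_i=\rho_iM/p_i$ with $\rho_i\in\{1,\dots,p_i-1\}$ ($i=1,\dots,K$); its vertices are $x_\epsilon=c+\sum_{j=1}^K\epsilon_jd_j\pmod M$, $\epsilon\in\{0,1\}^K$. The $\Delta$-evaluation of $f$ is $F[\Delta]=\sum_{\epsilon\in\{0,1\}^K}(-1)^{\sum_j\epsilon_j}f(x_\epsilon)$. -}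

module Defs where

open import Level using (Level)
open import Algebra.Bundles using (CommutativeRing)
open import Data.Bool using (Bool; true; false; if_then_else_)
open import Data.Empty using (⊥)
open import Data.Fin as Fin using (Fin; toℕ)
open import Data.Integer as ℤ using (ℤ; +_; -[1+_])
open import Data.List as List using (List; []; _∷_; _++_; foldr; map; replicate; reverse; drop; length; upTo; filter; allFin; concatMap)
open import Data.Nat as ℕ using (ℕ; zero; suc; _∸_; _^_)
open import Data.Nat.DivMod using (_/_; _mod_)
open import Data.Nat.Divisibility using (_∣?_)
open import Data.Product using (∃; Σ; _×_)
open import Data.Vec as Vec using (Vec; lookup)
open import Relation.Nullary using (¬_)

prodFin : {K : ℕ} → (Fin K → ℕ) → ℕ
prodFin {K} g = foldr ℕ._*_ 1 (map g (allFin K))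

sumFin : {K : ℕ} → (Fin K → ℕ) → ℕ
sumFin {K} g = foldr ℕ._+_ 0 (map g (allFin K))

modulusOf : {K : ℕ} → (Fin K → ℕ) → (Fin K → ℕ) → ℕ
modulusOf p n = prodFin (λ i → p i ^ n i)

-- total natural division (x / 0 := 0); only used with nonzero divisors
_div_ : ℕ → ℕ → ℕ
x div zero  = 0
x div suc k = x / suc k

-- Integer polynomials (little-endian coefficient lists)

addZ : List ℤ → List ℤ → List ℤ
addZ []       ys       = ys
addZ (x ∷ xs) []       = x ∷ xs
addZ (x ∷ xs) (y ∷ ys) = (x ℤ.+ y) ∷ addZ xs ys

mulZ : List ℤ → List ℤ → List ℤ
mulZ []       q = []
mulZ (a ∷ as) q = addZ (map (a ℤ.*_) q) (+ 0 ∷ mulZ as q)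

xPowMinus1 : ℕ → List ℤ
xPowMinus1 m = addZ (-[1+ 0 ] ∷ []) (replicate m (+ 0) ++ (+ 1 ∷ []))

-- synthetic division, big-endian lists; divisor is 1 ∷ bs
private
  subLead : ℤ → List ℤ → List ℤ → List ℤ
  subLead a []       xs       = xs
  subLead a (b ∷ bs) []       = []
  subLead a (b ∷ bs) (x ∷ xs) = (x ℤ.- a ℤ.* b) ∷ subLead a bs xs

  synth : ℕ → List ℤ → List ℤ → List ℤ
  synth zero    bs as       = []
  synth (suc k) bs []       = []
  synth (suc k) bs (a ∷ as) = a ∷ synth k bs (subLead a bs as)

-- quotient of A by a monic polynomial B (little-endian, B without
-- trailing zeros)
divMonic : List ℤ → List ℤ → List ℤ
divMonic A B =
  reverse (synth (length A ∸ (length B ∸ 1)) (drop 1 (reverse B)) (reverse A))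

properDivisors : ℕ → List ℕ
properDivisors m = filter (_∣? m) (map suc (upTo (m ∸ 1)))

-- cyclotomic polynomials, via  X^m - 1 = ∏_{d ∣ m} Φ_d
-- (the first argument is fuel, ≥ m)
private
  cycloAux : ℕ → ℕ → List ℤ
  cycloAux zero       m = + 1 ∷ []
  cycloAux (suc fuel) m =
    divMonic (xPowMinus1 m) (foldr mulZ (+ 1 ∷ []) (map (cycloAux fuel) (properDivisors m)))

-- Φ_m as an integer coefficient list (meaningful for m ≥ 1)
cyclotomic : ℕ → List ℤ
cyclotomic m = cycloAux m m

allBits : (k : ℕ) → List (Vec Bool k)
allBits zero    = Vec.[] ∷ []
allBits (suc k) = concatMap (λ v → (false Vec.∷ v) ∷ (true Vec.∷ v) ∷ []) (allBits k)

bitToℕ : Bool → ℕ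
bitToℕ true  = 1
bitToℕ false = 0

weight : {k : ℕ} → Vec Bool k → ℕ
weight {k} ε = sumFin (λ j → bitToℕ (lookup ε j))

record Cuboid (K : ℕ) (p : Fin K → ℕ) (M : ℕ) : Set where
  field
    c     : Fin M
    ρ     : Fin K → ℕ
    ρ-pos : ∀ i → 1 ℕ.≤ ρ i
    ρ-lt  : ∀ i → ρ i ℕ.< p i

-- x mod M as an element of ℤ_M = Fin M (the Fin M argument only
-- serves as a witness in the impossible case M = 0)
reduce : (M : ℕ) → Fin M → ℕ → Fin M
reduce zero    z x = z
reduce (suc m) z x = x mod suc m

module _ {K : ℕ} {p : Fin K → ℕ} {M : ℕ} (Δ : Cuboid K p M) where
  open Cuboid Δ

  cuboidStep : Fin K → ℕ
  cuboidStep i = ρ i ℕ.* (M div p i)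

  vertexℕ : Vec Bool K → ℕ
  vertexℕ ε = toℕ c ℕ.+ sumFin (λ j → bitToℕ (lookup ε j) ℕ.* cuboidStep j)

  vertex : Vec Bool K → Fin M
  vertex ε = reduce M c (vertexℕ ε)

  HasVertexAtZero : Set
  HasVertexAtZero = ∃ λ (ε : Vec Bool K) → toℕ (vertex ε) ≡ 0
    where open import Relation.Binary.PropositionalEquality using (_≡_)

module Over {c ℓ : Level} (R : CommutativeRing c ℓ) where
  open CommutativeRing R

  fromℕ : ℕ → Carrier
  fromℕ zero    = 0#
  fromℕ (suc n) = 1# + fromℕ n

  fromℤ : ℤ → Carrier
  fromℤ (+ n)      = fromℕ n
  fromℤ -[1+ n ]   = - fromℕ (suc n)

  IsField : Set (c Level.⊔ ℓ)
  IsField = (¬ (1# ≈ 0#)) × (∀ x → ¬ (x ≈ 0#) → ∃ λ y → x * y ≈ 1#)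

  CharZero : Set ℓ
  CharZero = ∀ n → fromℕ (suc n) ≈ 0# → ⊥

  -- polynomials over R as little-endian coefficient lists
  Poly : Set c
  Poly = List Carrier

  coeff : Poly → ℕ → Carrier
  coeff []       _       = 0#
  coeff (a ∷ as) zero    = a
  coeff (a ∷ as) (suc k) = coeff as k

  _+ₚ_ : Poly → Poly → Poly
  []       +ₚ ys       = ys
  (x ∷ xs) +ₚ []       = x ∷ xs
  (x ∷ xs) +ₚ (y ∷ ys) = (x + y) ∷ (xs +ₚ ys)

  _*ₚ_ : Poly → Poly → Poly
  []       *ₚ q = []
  (a ∷ as) *ₚ q = map (a *_) q +ₚ (0# ∷ (as *ₚ q))

  _∣ₚ_ : Poly → Poly → Set (c Level.⊔ ℓ)
  P ∣ₚ Q = ∃ λ (G : Poly) → ∀ k → coeff (P *ₚ G) k ≈ coeff Q k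

  Φ : ℕ → Poly
  Φ m = map fromℤ (cyclotomic m)

  mask : {M : ℕ} → (Fin M → Carrier) → Poly
  mask {M} f = map f (allFin M)

  IsStepFunction : {M : ℕ} → (Fin M → Carrier) → Set ℓ
  IsStepFunction {M} f = ∀ (x y : Fin M) → gcd (toℕ x) M ≡ gcd (toℕ y) M → f x ≈ f y
    where
      open import Data.Nat.GCD using (gcd)
      open import Relation.Binary.PropositionalEquality using (_≡_)

  negOnePow : ℕ → Carrier
  negOnePow zero    = 1#
  negOnePow (suc k) = - negOnePow k

  cuboidEval : {K : ℕ} {p : Fin K → ℕ} {M : ℕ} →
               (Fin M → Carrier) → Cuboid K p M → Carrier
  cuboidEval {K} f Δ =
    foldr (λ ε acc → negOnePow (weight ε) * f (vertex Δ ε) + acc) 0# (allBits K)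

{-# OPTIONS --safe #-}
-- Write q_j = p_j^{n_j} and h_j = M/p_j, and lift f to ℕ.  For a step function g, the operator
-- D_j g(x) = [q_j ∣ x] (g(x) − g(x + h_j)) splits g into an h_j-periodic part and D_j g, which is again
-- a step function.  Iterating over all j leaves D_1 ⋯ D_K f, which vanishes off the multiples of M and
-- equals λ₀ = ∑_ε (−1)^{|ε|} f(ε·h) on them.  Periodic parts are invisible to both sides: the mask of
-- an h_j-periodic function is a multiple of 1 + X^{h_j} + ⋯ + X^{h_j (p_j − 1)}, which Φ_M divides, and
-- its alternating sum over every cuboid vanishes.  Hence F ≡ λ₀ (mod Φ_M), and F[Δ] = ±λ₀ for every
-- cuboid with a vertex at 0, since exactly one vertex of such a cuboid is a multiple of M.  Finally, if
-- Φ_M divided the constant λ₀ then X^M − 1 would divide λ₀ ∏_j (1 − X^{h_j}), whose coefficients at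
-- exponents divisible by M add up to λ₀; so λ₀ = 0.
--
-- All of this needs the Φ_M of Defs to be the cyclotomic polynomial over the coefficient field.  This
-- follows by strong induction from X^m − 1 = ∏_{d ∣ m} Φ_d, the factors being pairwise coprime because
-- X^m − 1 is squarefree when m is invertible, which characteristic zero guarantees.
module Submission where

open import Defs
open import Algebra.Bundles using (CommutativeRing)
open import Data.Fin using (Fin)
open import Data.Nat using (ℕ; _≤_)
open import Data.Nat.Primality using (Prime)
open import Data.Product using (∃; _×_)
open import Function.Bundles using (_⇔_)
open import Relation.Binary.PropositionalEquality using (_≡_)

module IntegerEmbedding {c ℓ} (R : CommutativeRing c ℓ) where
  open import Data.Nat as ℕ using (ℕ; zero; suc)
  open import Data.Integer as ℤ using (ℤ; +_; -[1+_]; _⊖_; _◃_; sign; ∣_∣)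
  import Data.Integer.Properties as ℤ
  open import Data.Sign as Sign using (Sign)
  open import Relation.Binary.PropositionalEquality as ≡ using (_≡_)

  open CommutativeRing R
  open Over R using (fromℕ; fromℤ)
  open import Algebra.Properties.Ring ring using (-‿involutive; -‿distribˡ-*; -‿distribʳ-*; -0#≈0#; -‿+-comm)
  open import Algebra.Properties.Semiring.Mult semiring using (×-homo-+; ×1-homo-*) renaming (_×_ to _×′_)
  open import Relation.Binary.Reasoning.Setoid setoid

  fromℕ≡×1# : ∀ n → fromℕ n ≡ n ×′ 1#
  fromℕ≡×1# zero    = ≡.refl
  fromℕ≡×1# (suc n) = ≡.cong (_+_ 1#) (fromℕ≡×1# n)

  fromℕ-+ : ∀ m n → fromℕ (m ℕ.+ n) ≈ fromℕ m + fromℕ n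
  fromℕ-+ m n = begin
    fromℕ (m ℕ.+ n)     ≡⟨ fromℕ≡×1# (m ℕ.+ n) ⟩
    (m ℕ.+ n) ×′ 1#      ≈⟨ ×-homo-+ 1# m n ⟩
    m ×′ 1# + n ×′ 1#     ≡⟨ ≡.sym (≡.cong₂ _+_ (fromℕ≡×1# m) (fromℕ≡×1# n)) ⟩
    fromℕ m + fromℕ n   ∎

  fromℕ-* : ∀ m n → fromℕ (m ℕ.* n) ≈ fromℕ m * fromℕ n
  fromℕ-* m n = begin
    fromℕ (m ℕ.* n)     ≡⟨ fromℕ≡×1# (m ℕ.* n) ⟩
    (m ℕ.* n) ×′ 1#      ≈⟨ ×1-homo-* m n ⟩
    m ×′ 1# * n ×′ 1#     ≡⟨ ≡.sym (≡.cong₂ _*_ (fromℕ≡×1# m) (fromℕ≡×1# n)) ⟩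
    fromℕ m * fromℕ n   ∎

  fromℤ-1 : fromℤ (+ 1) ≈ 1#
  fromℤ-1 = +-identityʳ 1#

  fromℤ-‿ : ∀ i → fromℤ (ℤ.- i) ≈ - fromℤ i
  fromℤ-‿ (+ zero)  = sym -0#≈0#
  fromℤ-‿ (+ suc n) = refl
  fromℤ-‿ -[1+ n ]  = sym (-‿involutive _)

  fromℤ-⊖ : ∀ m n → fromℤ (m ⊖ n) ≈ fromℕ m - fromℕ n
  fromℤ-⊖ zero zero       = sym (-‿inverseʳ 0#)
  fromℤ-⊖ zero (suc n)    = sym (+-identityˡ _)
  fromℤ-⊖ (suc m) zero    = sym (trans (+-congˡ -0#≈0#) (+-identityʳ _))
  fromℤ-⊖ (suc m) (suc n) = begin
    fromℤ (suc m ⊖ suc n)                 ≡⟨ ≡.cong fromℤ (ℤ.[1+m]⊖[1+n]≡m⊖n m n) ⟩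
    fromℤ (m ⊖ n)                         ≈⟨ fromℤ-⊖ m n ⟩
    fromℕ m - fromℕ n                     ≈⟨ +-congˡ (sym (+-identityˡ _)) ⟩
    fromℕ m + (0# - fromℕ n)              ≈⟨ +-congˡ (+-congʳ (sym (-‿inverseʳ 1#))) ⟩
    fromℕ m + ((1# - 1#) - fromℕ n)       ≈⟨ +-congˡ (+-assoc _ _ _) ⟩
    fromℕ m + (1# + (- 1# - fromℕ n))     ≈⟨ sym (+-assoc _ _ _) ⟩
    (fromℕ m + 1#) + (- 1# - fromℕ n)     ≈⟨ +-cong (+-comm _ _) (-‿+-comm 1# (fromℕ n)) ⟩
    (1# + fromℕ m) - (1# + fromℕ n)       ∎

  fromℤ-+ : ∀ i j → fromℤ (i ℤ.+ j) ≈ fromℤ i + fromℤ j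
  fromℤ-+ -[1+ m ] -[1+ n ] = begin
    - (1# + fromℕ (suc (m ℕ.+ n)))        ≈⟨ -‿cong (+-congˡ (fromℕ-+ (suc m) n)) ⟩
    - (1# + (fromℕ (suc m) + fromℕ n))    ≈⟨ -‿cong (sym (+-assoc _ _ _)) ⟩
    - ((1# + fromℕ (suc m)) + fromℕ n)    ≈⟨ -‿cong (+-congʳ (+-comm _ _)) ⟩
    - ((fromℕ (suc m) + 1#) + fromℕ n)    ≈⟨ -‿cong (+-assoc _ _ _) ⟩
    - (fromℕ (suc m) + fromℕ (suc n))     ≈⟨ sym (-‿+-comm _ _) ⟩
    - fromℕ (suc m) + - fromℕ (suc n)     ∎
  fromℤ-+ -[1+ m ] (+ n)    = trans (fromℤ-⊖ n (suc m)) (+-comm _ _)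
  fromℤ-+ (+ m)    -[1+ n ] = fromℤ-⊖ m (suc n)
  fromℤ-+ (+ m)    (+ n)    = fromℕ-+ m n

  private
    fromSign : Sign → Carrier
    fromSign Sign.+ = 1#
    fromSign Sign.- = - 1#

    fromSign-* : ∀ s t → fromSign (s Sign.* t) ≈ fromSign s * fromSign t
    fromSign-* Sign.+ t       = sym (*-identityˡ _)
    fromSign-* Sign.- Sign.+ = sym (*-identityʳ _)
    fromSign-* Sign.- Sign.- = begin
      1#               ≈⟨ sym (-‿involutive _) ⟩
      - - 1#           ≈⟨ -‿cong (sym (*-identityʳ _)) ⟩
      - (- 1# * 1#)    ≈⟨ -‿distribʳ-* _ _ ⟩
      - 1# * - 1#      ∎

    fromℤ-◃ : ∀ s n → fromℤ (s ◃ n) ≈ fromSign s * fromℕ n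
    fromℤ-◃ s       zero    = sym (zeroʳ _)
    fromℤ-◃ Sign.+ (suc n) = sym (*-identityˡ _)
    fromℤ-◃ Sign.- (suc n) = trans (-‿cong (sym (*-identityˡ _))) (-‿distribˡ-* _ _)

    fromℤ≈sign*abs : ∀ i → fromℤ i ≈ fromSign (sign i) * fromℕ ∣ i ∣
    fromℤ≈sign*abs i = trans (reflexive (≡.cong fromℤ (≡.sym (ℤ.◃-inverse i)))) (fromℤ-◃ (sign i) ∣ i ∣)

    *-interchange : ∀ a b x y → (a * b) * (x * y) ≈ (a * x) * (b * y)
    *-interchange a b x y = begin
      (a * b) * (x * y)  ≈⟨ *-assoc _ _ _ ⟩
      a * (b * (x * y))  ≈⟨ *-congˡ (sym (*-assoc _ _ _)) ⟩
      a * ((b * x) * y)  ≈⟨ *-congˡ (*-congʳ (*-comm _ _)) ⟩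
      a * ((x * b) * y)  ≈⟨ *-congˡ (*-assoc _ _ _) ⟩
      a * (x * (b * y))  ≈⟨ sym (*-assoc _ _ _) ⟩
      (a * x) * (b * y)  ∎

  fromℤ-* : ∀ i j → fromℤ (i ℤ.* j) ≈ fromℤ i * fromℤ j
  fromℤ-* i j = begin
    fromℤ (sign i Sign.* sign j ◃ ∣ i ∣ ℕ.* ∣ j ∣)
      ≈⟨ fromℤ-◃ (sign i Sign.* sign j) (∣ i ∣ ℕ.* ∣ j ∣) ⟩
    fromSign (sign i Sign.* sign j) * fromℕ (∣ i ∣ ℕ.* ∣ j ∣)
      ≈⟨ *-cong (fromSign-* (sign i) (sign j)) (fromℕ-* ∣ i ∣ ∣ j ∣) ⟩
    (fromSign (sign i) * fromSign (sign j)) * (fromℕ ∣ i ∣ * fromℕ ∣ j ∣)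
      ≈⟨ *-interchange _ _ _ _ ⟩
    (fromSign (sign i) * fromℕ ∣ i ∣) * (fromSign (sign j) * fromℕ ∣ j ∣)
      ≈⟨ sym (*-cong (fromℤ≈sign*abs i) (fromℤ≈sign*abs j)) ⟩
    fromℤ i * fromℤ j ∎

module IntegerSolver {c ℓ} (R : CommutativeRing c ℓ) where
  open import Data.Integer as ℤ using (ℤ)
  import Data.Integer.Properties as ℤ
  open import Algebra.Solver.Ring.AlmostCommutativeRing
    using (fromCommutativeRing; _-Raw-AlmostCommutative⟶_)
  open import Data.Maybe using (Maybe; just; nothing)
  open import Relation.Binary.PropositionalEquality using (refl)
  open import Relation.Nullary using (yes; no)

  open CommutativeRing R using (_≈_)
  open Over R using (fromℤ)
  open IntegerEmbedding R

  private
    fromℤ-morphism : CommutativeRing.rawRing ℤ.+-*-commutativeRing -Raw-AlmostCommutative⟶ fromCommutativeRing R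
    fromℤ-morphism = record
      { ⟦_⟧    = fromℤ
      ; +-homo = fromℤ-+
      ; *-homo = fromℤ-*
      ; -‿homo = fromℤ-‿
      ; 0-homo = CommutativeRing.refl R
      ; 1-homo = fromℤ-1
      }

    fromℤ-≟ : ∀ a b → Maybe (fromℤ a ≈ fromℤ b)
    fromℤ-≟ a b with a ℤ.≟ b
    ... | yes refl = just (CommutativeRing.refl R)
    ... | no _     = nothing

  open import Algebra.Solver.Ring
    (CommutativeRing.rawRing ℤ.+-*-commutativeRing) (fromCommutativeRing R) fromℤ-morphism fromℤ-≟
    public

module Polynomials {c ℓ} (R : CommutativeRing c ℓ) where
  open import Data.Nat using (zero; suc)
  open import Data.List using ([]; _∷_; map)
  open import Data.Product using (_,_)
  open import Algebra.Structures using (IsCommutativeRing)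
  open import Relation.Binary.PropositionalEquality using (_≡_)
  import Relation.Binary.PropositionalEquality as ≡

  open CommutativeRing R hiding (zero)
  open Over R public using (Poly; coeff; _+ₚ_; _*ₚ_)
  open import Algebra.Properties.Ring ring using (-0#≈0#)
  open import Algebra.Properties.CommutativeSemigroup +-commutativeSemigroup using (interchange)
  open import Relation.Binary.Reasoning.Setoid setoid

  infix 4 _≋_
  record _≋_ (P Q : Poly) : Set ℓ where
    constructor mk≋
    field at : ∀ k → coeff P k ≈ coeff Q k
  open _≋_ public

  ≋-refl : ∀ {P} → P ≋ P
  ≋-refl = mk≋ λ k → refl

  ≋-sym : ∀ {P Q} → P ≋ Q → Q ≋ P
  ≋-sym e = mk≋ λ k → sym (at e k)

  ≋-trans : ∀ {P Q S} → P ≋ Q → Q ≋ S → P ≋ S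
  ≋-trans e f = mk≋ λ k → trans (at e k) (at f k)

  ≋-reflexive : ∀ {P Q} → P ≡ Q → P ≋ Q
  ≋-reflexive ≡.refl = ≋-refl

  ∷-cong : ∀ {a b P Q} → a ≈ b → P ≋ Q → (a ∷ P) ≋ (b ∷ Q)
  ∷-cong e f = mk≋ λ { zero → e ; (suc k) → at f k }

  ∷-tail : ∀ {a b P Q} → (a ∷ P) ≋ (b ∷ Q) → P ≋ Q
  ∷-tail e = mk≋ λ k → at e (suc k)

  infix  8 -ₚ_
  infixr 8 _⋆_

  -ₚ_ : Poly → Poly
  -ₚ P = map -_ P

  _⋆_ : Carrier → Poly → Poly
  a ⋆ P = map (a *_) P

  coeff-+ₚ : ∀ P Q k → coeff (P +ₚ Q) k ≈ coeff P k + coeff Q k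
  coeff-+ₚ []      Q       k       = sym (+-identityˡ _)
  coeff-+ₚ (x ∷ P) []      k       = sym (+-identityʳ _)
  coeff-+ₚ (x ∷ P) (y ∷ Q) zero    = refl
  coeff-+ₚ (x ∷ P) (y ∷ Q) (suc k) = coeff-+ₚ P Q k

  coeff-⋆ : ∀ a P k → coeff (a ⋆ P) k ≈ a * coeff P k
  coeff-⋆ a []      k       = sym (zeroʳ _)
  coeff-⋆ a (x ∷ P) zero    = refl
  coeff-⋆ a (x ∷ P) (suc k) = coeff-⋆ a P k

  coeff-‿ : ∀ P k → coeff (-ₚ P) k ≈ - coeff P k
  coeff-‿ []      k       = sym -0#≈0#
  coeff-‿ (x ∷ P) zero    = refl
  coeff-‿ (x ∷ P) (suc k) = coeff-‿ P k

  +ₚ-cong : ∀ {P P' Q Q'} → P ≋ P' → Q ≋ Q' → (P +ₚ Q) ≋ (P' +ₚ Q')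
  +ₚ-cong {P} {P'} {Q} {Q'} e f =
    mk≋ λ k → trans (coeff-+ₚ P Q k) (trans (+-cong (at e k) (at f k)) (sym (coeff-+ₚ P' Q' k)))

  +ₚ-congˡ : ∀ P {Q Q'} → Q ≋ Q' → (P +ₚ Q) ≋ (P +ₚ Q')
  +ₚ-congˡ P = +ₚ-cong (≋-refl {P})

  +ₚ-congʳ : ∀ {P P'} Q → P ≋ P' → (P +ₚ Q) ≋ (P' +ₚ Q)
  +ₚ-congʳ Q e = +ₚ-cong e (≋-refl {Q})

  ⋆-cong : ∀ {a b P Q} → a ≈ b → P ≋ Q → (a ⋆ P) ≋ (b ⋆ Q)
  ⋆-cong {a} {b} {P} {Q} e f =
    mk≋ λ k → trans (coeff-⋆ a P k) (trans (*-cong e (at f k)) (sym (coeff-⋆ b Q k)))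

  -ₚ-cong : ∀ {P Q} → P ≋ Q → (-ₚ P) ≋ (-ₚ Q)
  -ₚ-cong {P} {Q} e = mk≋ λ k → trans (coeff-‿ P k) (trans (-‿cong (at e k)) (sym (coeff-‿ Q k)))

  +ₚ-assoc : ∀ P Q S → ((P +ₚ Q) +ₚ S) ≋ (P +ₚ (Q +ₚ S))
  +ₚ-assoc P Q S = mk≋ λ k → begin
    coeff ((P +ₚ Q) +ₚ S) k              ≈⟨ coeff-+ₚ (P +ₚ Q) S k ⟩
    coeff (P +ₚ Q) k + coeff S k         ≈⟨ +-congʳ (coeff-+ₚ P Q k) ⟩
    (coeff P k + coeff Q k) + coeff S k  ≈⟨ +-assoc _ _ _ ⟩
    coeff P k + (coeff Q k + coeff S k)  ≈⟨ +-congˡ (sym (coeff-+ₚ Q S k)) ⟩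
    coeff P k + coeff (Q +ₚ S) k         ≈⟨ sym (coeff-+ₚ P (Q +ₚ S) k) ⟩
    coeff (P +ₚ (Q +ₚ S)) k              ∎

  +ₚ-comm : ∀ P Q → (P +ₚ Q) ≋ (Q +ₚ P)
  +ₚ-comm P Q = mk≋ λ k → trans (coeff-+ₚ P Q k) (trans (+-comm _ _) (sym (coeff-+ₚ Q P k)))

  +ₚ-identityˡ : ∀ P → ([] +ₚ P) ≋ P
  +ₚ-identityˡ P = ≋-refl

  +ₚ-identityʳ : ∀ P → (P +ₚ []) ≋ P
  +ₚ-identityʳ P = mk≋ λ k → trans (coeff-+ₚ P [] k) (+-identityʳ _)

  -ₚ-inverseˡ : ∀ P → ((-ₚ P) +ₚ P) ≋ []
  -ₚ-inverseˡ P = mk≋ λ k → trans (coeff-+ₚ (-ₚ P) P k) (trans (+-congʳ (coeff-‿ P k)) (-‿inverseˡ _))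

  -ₚ-inverseʳ : ∀ P → (P +ₚ (-ₚ P)) ≋ []
  -ₚ-inverseʳ P = mk≋ λ k → trans (coeff-+ₚ P (-ₚ P) k) (trans (+-congˡ (coeff-‿ P k)) (-‿inverseʳ _))

  +ₚ-interchange : ∀ A B C D → ((A +ₚ B) +ₚ (C +ₚ D)) ≋ ((A +ₚ C) +ₚ (B +ₚ D))
  +ₚ-interchange A B C D = mk≋ λ k → begin
    coeff ((A +ₚ B) +ₚ (C +ₚ D)) k                     ≈⟨ coeff-+ₚ (A +ₚ B) (C +ₚ D) k ⟩
    coeff (A +ₚ B) k + coeff (C +ₚ D) k                ≈⟨ +-cong (coeff-+ₚ A B k) (coeff-+ₚ C D k) ⟩
    (coeff A k + coeff B k) + (coeff C k + coeff D k)  ≈⟨ interchange _ _ _ _ ⟩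
    (coeff A k + coeff C k) + (coeff B k + coeff D k)  ≈⟨ sym (+-cong (coeff-+ₚ A C k) (coeff-+ₚ B D k)) ⟩
    coeff (A +ₚ C) k + coeff (B +ₚ D) k                ≈⟨ sym (coeff-+ₚ (A +ₚ C) (B +ₚ D) k) ⟩
    coeff ((A +ₚ C) +ₚ (B +ₚ D)) k                     ∎

  ⋆-distribˡ-+ₚ : ∀ a P Q → (a ⋆ (P +ₚ Q)) ≋ ((a ⋆ P) +ₚ (a ⋆ Q))
  ⋆-distribˡ-+ₚ a P Q = mk≋ λ k → begin
    coeff (a ⋆ (P +ₚ Q)) k               ≈⟨ coeff-⋆ a (P +ₚ Q) k ⟩
    a * coeff (P +ₚ Q) k                 ≈⟨ *-congˡ (coeff-+ₚ P Q k) ⟩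
    a * (coeff P k + coeff Q k)          ≈⟨ distribˡ _ _ _ ⟩
    a * coeff P k + a * coeff Q k        ≈⟨ sym (+-cong (coeff-⋆ a P k) (coeff-⋆ a Q k)) ⟩
    coeff (a ⋆ P) k + coeff (a ⋆ Q) k    ≈⟨ sym (coeff-+ₚ (a ⋆ P) (a ⋆ Q) k) ⟩
    coeff ((a ⋆ P) +ₚ (a ⋆ Q)) k         ∎

  ⋆-distribʳ-+ : ∀ a b P → ((a + b) ⋆ P) ≋ ((a ⋆ P) +ₚ (b ⋆ P))
  ⋆-distribʳ-+ a b P = mk≋ λ k → begin
    coeff ((a + b) ⋆ P) k                ≈⟨ coeff-⋆ (a + b) P k ⟩
    (a + b) * coeff P k                  ≈⟨ distribʳ _ _ _ ⟩
    a * coeff P k + b * coeff P k        ≈⟨ sym (+-cong (coeff-⋆ a P k) (coeff-⋆ b P k)) ⟩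
    coeff (a ⋆ P) k + coeff (b ⋆ P) k    ≈⟨ sym (coeff-+ₚ (a ⋆ P) (b ⋆ P) k) ⟩
    coeff ((a ⋆ P) +ₚ (b ⋆ P)) k         ∎

  ⋆-assoc : ∀ a b P → (a ⋆ (b ⋆ P)) ≋ ((a * b) ⋆ P)
  ⋆-assoc a b P = mk≋ λ k →
    trans (coeff-⋆ a (b ⋆ P) k)
          (trans (*-congˡ (coeff-⋆ b P k)) (trans (sym (*-assoc _ _ _)) (sym (coeff-⋆ (a * b) P k))))

  ⋆-zeroˡ : ∀ P → (0# ⋆ P) ≋ []
  ⋆-zeroˡ P = mk≋ λ k → trans (coeff-⋆ 0# P k) (zeroˡ _)

  ⋆-identityˡ : ∀ P → (1# ⋆ P) ≋ P
  ⋆-identityˡ P = mk≋ λ k → trans (coeff-⋆ 1# P k) (*-identityˡ _)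

  0∷-+ₚ : ∀ P Q → (0# ∷ (P +ₚ Q)) ≋ ((0# ∷ P) +ₚ (0# ∷ Q))
  0∷-+ₚ P Q = ∷-cong (sym (+-identityˡ _)) ≋-refl

  *ₚ-zeroˡ : ∀ P Q → P ≋ [] → (P *ₚ Q) ≋ []
  *ₚ-zeroˡ []      Q e = ≋-refl
  *ₚ-zeroˡ (a ∷ P) Q e = ≋-trans (+ₚ-cong aQ≋0 (∷-cong refl (*ₚ-zeroˡ P Q (mk≋ λ k → at e (suc k))))) 0∷[]≋[]
    where
    aQ≋0 : (a ⋆ Q) ≋ []
    aQ≋0 = ≋-trans (⋆-cong (at e zero) ≋-refl) (⋆-zeroˡ Q)
    0∷[]≋[] : (0# ∷ []) ≋ []
    0∷[]≋[] = mk≋ λ { zero → refl ; (suc k) → refl }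

  *ₚ-congʳ : ∀ {P P'} Q → P ≋ P' → (P *ₚ Q) ≋ (P' *ₚ Q)
  *ₚ-congʳ {[]}    {P'}     Q e = ≋-sym (*ₚ-zeroˡ P' Q (≋-sym e))
  *ₚ-congʳ {a ∷ P} {[]}     Q e = *ₚ-zeroˡ (a ∷ P) Q e
  *ₚ-congʳ {a ∷ P} {b ∷ P'} Q e = +ₚ-cong (⋆-cong (at e zero) ≋-refl) (∷-cong refl (*ₚ-congʳ Q (∷-tail e)))

  *ₚ-congˡ : ∀ P {Q Q'} → Q ≋ Q' → (P *ₚ Q) ≋ (P *ₚ Q')
  *ₚ-congˡ []      e = ≋-refl
  *ₚ-congˡ (a ∷ P) e = +ₚ-cong (⋆-cong refl e) (∷-cong refl (*ₚ-congˡ P e))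

  *ₚ-cong : ∀ {P P' Q Q'} → P ≋ P' → Q ≋ Q' → (P *ₚ Q) ≋ (P' *ₚ Q')
  *ₚ-cong {P} {P'} {Q} e f = ≋-trans (*ₚ-congʳ Q e) (*ₚ-congˡ P' f)

  *ₚ-zeroʳ : ∀ P → (P *ₚ []) ≋ []
  *ₚ-zeroʳ []      = ≋-refl
  *ₚ-zeroʳ (a ∷ P) = mk≋ λ { zero → refl ; (suc k) → at (*ₚ-zeroʳ P) k }

  *ₚ-distribˡ-+ₚ : ∀ P Q S → (P *ₚ (Q +ₚ S)) ≋ ((P *ₚ Q) +ₚ (P *ₚ S))
  *ₚ-distribˡ-+ₚ []      Q S = ≋-refl
  *ₚ-distribˡ-+ₚ (a ∷ P) Q S = ≋-trans
    (+ₚ-cong (⋆-distribˡ-+ₚ a Q S) (≋-trans (∷-cong refl (*ₚ-distribˡ-+ₚ P Q S)) (0∷-+ₚ (P *ₚ Q) (P *ₚ S))))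
    (+ₚ-interchange (a ⋆ Q) (a ⋆ S) (0# ∷ (P *ₚ Q)) (0# ∷ (P *ₚ S)))

  *ₚ-distribʳ-+ₚ : ∀ P Q S → ((P +ₚ Q) *ₚ S) ≋ ((P *ₚ S) +ₚ (Q *ₚ S))
  *ₚ-distribʳ-+ₚ []      Q       S = ≋-refl
  *ₚ-distribʳ-+ₚ (a ∷ P) []      S = ≋-sym (+ₚ-identityʳ _)
  *ₚ-distribʳ-+ₚ (a ∷ P) (b ∷ Q) S = ≋-trans
    (+ₚ-cong (⋆-distribʳ-+ a b S) (≋-trans (∷-cong refl (*ₚ-distribʳ-+ₚ P Q S)) (0∷-+ₚ (P *ₚ S) (Q *ₚ S))))
    (+ₚ-interchange (a ⋆ S) (b ⋆ S) (0# ∷ (P *ₚ S)) (0# ∷ (Q *ₚ S)))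

  ⋆-*ₚ-assoc : ∀ a P Q → ((a ⋆ P) *ₚ Q) ≋ (a ⋆ (P *ₚ Q))
  ⋆-*ₚ-assoc a []      Q = ≋-refl
  ⋆-*ₚ-assoc a (b ∷ P) Q = ≋-trans
    (+ₚ-cong (≋-sym (⋆-assoc a b Q)) (∷-cong (sym (zeroʳ a)) (⋆-*ₚ-assoc a P Q)))
    (≋-sym (⋆-distribˡ-+ₚ a (b ⋆ Q) (0# ∷ (P *ₚ Q))))

  *ₚ-assoc : ∀ P Q S → ((P *ₚ Q) *ₚ S) ≋ (P *ₚ (Q *ₚ S))
  *ₚ-assoc []      Q S = ≋-refl
  *ₚ-assoc (a ∷ P) Q S = ≋-trans (*ₚ-distribʳ-+ₚ (a ⋆ Q) (0# ∷ (P *ₚ Q)) S)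
    (+ₚ-cong (⋆-*ₚ-assoc a Q S) (≋-trans (+ₚ-cong (⋆-zeroˡ S) ≋-refl) (∷-cong refl (*ₚ-assoc P Q S))))

  *ₚ-∷ʳ : ∀ P b Q → (P *ₚ (b ∷ Q)) ≋ ((b ⋆ P) +ₚ (0# ∷ (P *ₚ Q)))
  *ₚ-∷ʳ []      b Q = mk≋ λ { zero → refl ; (suc k) → refl }
  *ₚ-∷ʳ (a ∷ P) b Q = ∷-cong
    (trans (+-identityʳ _) (trans (*-comm _ _) (sym (+-identityʳ _))))
    (≋-trans (+ₚ-congˡ (a ⋆ Q) (*ₚ-∷ʳ P b Q))
    (≋-trans (≋-sym (+ₚ-assoc (a ⋆ Q) (b ⋆ P) (0# ∷ (P *ₚ Q))))
    (≋-trans (+ₚ-congʳ (0# ∷ (P *ₚ Q)) (+ₚ-comm (a ⋆ Q) (b ⋆ P)))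
             (+ₚ-assoc (b ⋆ P) (a ⋆ Q) (0# ∷ (P *ₚ Q))))))

  *ₚ-comm : ∀ P Q → (P *ₚ Q) ≋ (Q *ₚ P)
  *ₚ-comm []      Q = ≋-sym (*ₚ-zeroʳ Q)
  *ₚ-comm (a ∷ P) Q = ≋-trans (+ₚ-congˡ (a ⋆ Q) (∷-cong refl (*ₚ-comm P Q))) (≋-sym (*ₚ-∷ʳ Q a P))

  *ₚ-identityˡ : ∀ P → ((1# ∷ []) *ₚ P) ≋ P
  *ₚ-identityˡ P = ≋-trans (+ₚ-cong (⋆-identityˡ P) (mk≋ λ { zero → refl ; (suc k) → refl })) (+ₚ-identityʳ P)

  *ₚ-identityʳ : ∀ P → (P *ₚ (1# ∷ [])) ≋ P
  *ₚ-identityʳ P = ≋-trans (*ₚ-comm P _) (*ₚ-identityˡ P)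

  +ₚ-*ₚ-isCommutativeRing : IsCommutativeRing _≋_ _+ₚ_ _*ₚ_ -ₚ_ [] (1# ∷ [])
  +ₚ-*ₚ-isCommutativeRing = record
    { isRing = record
      { +-isAbelianGroup = record
        { isGroup = record
          { isMonoid = record
            { isSemigroup = record
              { isMagma = record
                { isEquivalence = record { refl = ≋-refl ; sym = ≋-sym ; trans = ≋-trans }
                ; ∙-cong = +ₚ-cong
                }
              ; assoc = +ₚ-assoc
              }
            ; identity = +ₚ-identityˡ , +ₚ-identityʳ
            }
          ; inverse = -ₚ-inverseˡ , -ₚ-inverseʳ
          ; ⁻¹-cong = -ₚ-cong
          }
        ; comm = +ₚ-comm
        }
      ; *-cong     = *ₚ-cong
      ; *-assoc    = *ₚ-assoc
      ; *-identity = *ₚ-identityˡ , *ₚ-identityʳ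
      ; distrib    = *ₚ-distribˡ-+ₚ , λ S P Q → *ₚ-distribʳ-+ₚ P Q S
      }
    ; *-comm = *ₚ-comm
    }

  R[X] : CommutativeRing c ℓ
  R[X] = record { isCommutativeRing = +ₚ-*ₚ-isCommutativeRing }

module PolynomialArithmetic {c ℓ} (R : CommutativeRing c ℓ) where
  open import Data.Nat as ℕ using (ℕ; zero; suc; _≤_; s≤s)
  import Data.Nat.Properties as ℕ
  open import Data.List using (List; []; _∷_; replicate; _++_; length)
  import Data.List.Properties as List
  open import Function.Base using (_$_)
  open import Level using (_⊔_)
  open import Relation.Binary.PropositionalEquality using (_≡_)
  import Relation.Binary.PropositionalEquality as ≡
  import Relation.Binary.Reasoning.Setoid as SetoidReasoning

  open CommutativeRing R hiding (zero)
  open Polynomials R public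
  module ≈-Reasoning = SetoidReasoning setoid
  module ≋-Reasoning = SetoidReasoning (CommutativeRing.setoid R[X])
  module PSolver = IntegerSolver R[X]
  open PSolver using (_:+_; _:*_; _:-_; _:=_)

  infixl 6 _−ₚ_
  infix  30 X^_

  _−ₚ_ : Poly → Poly → Poly
  P −ₚ Q = P +ₚ (-ₚ Q)

  const : Carrier → Poly
  const a = a ∷ []

  X : Poly
  X = 0# ∷ 1# ∷ []

  X^_ : ℕ → Poly
  X^ zero  = const 1#
  X^ suc n = X *ₚ X^ n

  Xⁿ−1 : ℕ → Poly
  Xⁿ−1 n = X^ n −ₚ const 1#

  shift : ℕ → Poly → Poly
  shift n P = replicate n 0# ++ P

  0∷≋X*ₚ : ∀ P → (0# ∷ P) ≋ (X *ₚ P)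
  0∷≋X*ₚ P = ≋-sym (+ₚ-cong (⋆-zeroˡ P) (∷-cong refl (*ₚ-identityˡ P)))

  shift≋X^*ₚ : ∀ n P → shift n P ≋ (X^ n *ₚ P)
  shift≋X^*ₚ zero    P = ≋-sym (*ₚ-identityˡ P)
  shift≋X^*ₚ (suc n) P =
    ≋-trans (∷-cong refl (shift≋X^*ₚ n P)) (≋-trans (0∷≋X*ₚ _) (≋-sym (*ₚ-assoc X (X^ n) P)))

  X^-+ : ∀ m n → X^ (m ℕ.+ n) ≋ (X^ m *ₚ X^ n)
  X^-+ zero    n = ≋-sym (*ₚ-identityˡ _)
  X^-+ (suc m) n = ≋-trans (*ₚ-congˡ X (X^-+ m n)) (≋-sym (*ₚ-assoc X (X^ m) (X^ n)))

  X⁰−1≋[] : Xⁿ−1 0 ≋ []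
  X⁰−1≋[] = mk≋ λ { zero → -‿inverseʳ 1# ; (suc k) → refl }

  const-0 : const 0# ≋ []
  const-0 = mk≋ λ { zero → refl ; (suc k) → refl }

  const-cong : ∀ {a b} → a ≈ b → const a ≋ const b
  const-cong e = ∷-cong e ≋-refl

  const-*ₚ : ∀ a P → (const a *ₚ P) ≋ (a ⋆ P)
  const-*ₚ a P = ≋-trans (+ₚ-congˡ (a ⋆ P) const-0) (+ₚ-identityʳ (a ⋆ P))

  const-* : ∀ a b → const (a * b) ≋ (const a *ₚ const b)
  const-* a b = ≋-sym (const-*ₚ a (const b))

  coeff-≥length : ∀ P k → length P ≤ k → coeff P k ≡ 0#
  coeff-≥length []      k       p       = ≡.refl
  coeff-≥length (x ∷ P) (suc k) (s≤s p) = coeff-≥length P k p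

  coeff-last : ∀ P b → coeff (P ++ b ∷ []) (length P) ≡ b
  coeff-last []      b = ≡.refl
  coeff-last (x ∷ P) b = coeff-last P b

  infix 4 _∣ₓ_
  record _∣ₓ_ (A B : Poly) : Set (c ⊔ ℓ) where
    constructor divₓ
    field
      cofactor      : Poly
      factorisation : (A *ₚ cofactor) ≋ B
  open _∣ₓ_ public

  ∣ₓ-refl : ∀ {A} → A ∣ₓ A
  ∣ₓ-refl {A} = divₓ (const 1#) (*ₚ-identityʳ A)

  ∣ₓ-trans : ∀ {A B C} → A ∣ₓ B → B ∣ₓ C → A ∣ₓ C
  ∣ₓ-trans {A} (divₓ G e) (divₓ H f) =
    divₓ (G *ₚ H) $ ≋-trans (≋-sym (*ₚ-assoc A G H)) (≋-trans (*ₚ-congʳ H e) f)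

  ∣ₓ-cong : ∀ {A A' B B'} → A ≋ A' → B ≋ B' → A ∣ₓ B → A' ∣ₓ B'
  ∣ₓ-cong {A} e f (divₓ G g) = divₓ G $ ≋-trans (*ₚ-congʳ G (≋-sym e)) (≋-trans g f)

  A∣ₓA*ₚB : ∀ A B → A ∣ₓ (A *ₚ B)
  A∣ₓA*ₚB A B = divₓ B ≋-refl

  ∣ₓ⇒∣ₓ*ₚ : ∀ {A B} C → A ∣ₓ B → A ∣ₓ (B *ₚ C)
  ∣ₓ⇒∣ₓ*ₚ {A} C (divₓ G e) = divₓ (G *ₚ C) $ ≋-trans (≋-sym (*ₚ-assoc A G C)) (*ₚ-congʳ C e)

  ∣ₓ⇒∣ₓ*ₚ′ : ∀ {A B} C → A ∣ₓ B → A ∣ₓ (C *ₚ B)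
  ∣ₓ⇒∣ₓ*ₚ′ {A} {B} C d = ∣ₓ-cong (≋-refl {A}) (*ₚ-comm B C) (∣ₓ⇒∣ₓ*ₚ C d)

  ∣ₓ-+ₚ : ∀ {A B C} → A ∣ₓ B → A ∣ₓ C → A ∣ₓ (B +ₚ C)
  ∣ₓ-+ₚ {A} (divₓ G e) (divₓ H f) = divₓ (G +ₚ H) $ ≋-trans (*ₚ-distribˡ-+ₚ A G H) (+ₚ-cong e f)

  ∣ₓ-[] : ∀ {A} → A ∣ₓ []
  ∣ₓ-[] {A} = divₓ [] (*ₚ-zeroʳ A)

  *ₚ-mono-∣ₓ : ∀ {A B C D} → A ∣ₓ B → C ∣ₓ D → (A *ₚ C) ∣ₓ (B *ₚ D)
  *ₚ-mono-∣ₓ {A} {B} {C} (divₓ G e) (divₓ H f) = divₓ (G *ₚ H) $ ≋-trans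
    (PSolver.solve 4 (λ a c g h → (a :* c) :* (g :* h) := (a :* g) :* (c :* h)) ≋-refl A C G H)
    (*ₚ-cong e f)

  DegreeBelow : ℕ → Poly → Set ℓ
  DegreeBelow n P = ∀ k → n ≤ k → coeff P k ≈ 0#

  monic-*ₚ-degreeBelow⇒≋[] : ∀ B₀ b → b ≈ 1# → ∀ H P →
    ((B₀ ++ b ∷ []) *ₚ H) ≋ P → DegreeBelow (length B₀) P → H ≋ []
  monic-*ₚ-degreeBelow⇒≋[] B₀ b b≈1 []      P e small = ≋-refl
  monic-*ₚ-degreeBelow⇒≋[] B₀ b b≈1 (h ∷ H) P e small = ≋-trans (∷-cong h≈0 H≋[]) const-0
    where
    open ≈-Reasoning
    B = B₀ ++ b ∷ []
    n = length B₀
    e′ : ((h ⋆ B) +ₚ (0# ∷ (B *ₚ H))) ≋ P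
    e′ = ≋-trans (≋-sym (*ₚ-∷ʳ B h H)) e
    B-small : DegreeBelow (suc n) B
    B-small k p = reflexive (coeff-≥length B k (≡.subst (_≤ k) (≡.sym length-B) p))
      where
      length-B : length B ≡ suc n
      length-B = ≡.trans (List.length-++ B₀) (ℕ.+-comm n 1)
    coeffP : ∀ k → coeff P k ≈ coeff (h ⋆ B) k + coeff (0# ∷ (B *ₚ H)) k
    coeffP k = trans (sym (at e′ k)) (coeff-+ₚ (h ⋆ B) _ k)
    BH-small : DegreeBelow n (B *ₚ H)
    BH-small k p = begin
      coeff (B *ₚ H) k                                          ≈⟨ sym (+-identityˡ _) ⟩
      0# + coeff (B *ₚ H) k                                     ≈⟨ +-congʳ hB≈0 ⟩
      coeff (h ⋆ B) (suc k) + coeff (0# ∷ (B *ₚ H)) (suc k)     ≈⟨ sym (coeffP (suc k)) ⟩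
      coeff P (suc k)                                           ≈⟨ small (suc k) (ℕ.m≤n⇒m≤1+n p) ⟩
      0#                                                        ∎
      where
      hB≈0 : 0# ≈ coeff (h ⋆ B) (suc k)
      hB≈0 = sym (trans (coeff-⋆ h B (suc k)) (trans (*-congˡ (B-small (suc k) (s≤s p))) (zeroʳ h)))
    H≋[] : H ≋ []
    H≋[] = monic-*ₚ-degreeBelow⇒≋[] B₀ b b≈1 H (B *ₚ H) ≋-refl BH-small
    h≈0 : h ≈ 0#
    h≈0 = begin
      h                                                   ≈⟨ sym (*-identityʳ h) ⟩
      h * 1#                                              ≈⟨ *-congˡ (sym b≈1) ⟩
      h * b                                               ≈⟨ *-congˡ (sym (reflexive (coeff-last B₀ b))) ⟩
      h * coeff B n                                       ≈⟨ sym (coeff-⋆ h B n) ⟩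
      coeff (h ⋆ B) n                                     ≈⟨ sym (+-identityʳ _) ⟩
      coeff (h ⋆ B) n + 0#                                ≈⟨ +-congˡ (sym (shifted≈0 n)) ⟩
      coeff (h ⋆ B) n + coeff (0# ∷ (B *ₚ H)) n           ≈⟨ sym (coeffP n) ⟩
      coeff P n                                           ≈⟨ small n ℕ.≤-refl ⟩
      0#                                                  ∎
      where
      BH≋[] : (B *ₚ H) ≋ []
      BH≋[] = ≋-trans (*ₚ-congˡ B H≋[]) (*ₚ-zeroʳ B)
      shifted≈0 : ∀ k → coeff (0# ∷ (B *ₚ H)) k ≈ 0#
      shifted≈0 zero    = refl
      shifted≈0 (suc k) = at BH≋[] k

  monic-cancelˡ : ∀ A₀ a → a ≈ 1# → ∀ G G' → ((A₀ ++ a ∷ []) *ₚ G) ≋ ((A₀ ++ a ∷ []) *ₚ G') → G ≋ G'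
  monic-cancelˡ A₀ a a≈1 G G' e = begin
    G                 ≈⟨ PSolver.solve 2 (λ g g' → g := (g :- g') :+ g') ≋-refl G G' ⟩
    (G −ₚ G') +ₚ G'   ≈⟨ +ₚ-congʳ G' G−G'≋[] ⟩
    G'                ∎
    where
    open ≋-Reasoning
    A = A₀ ++ a ∷ []
    A*[G−G']≋[] : (A *ₚ (G −ₚ G')) ≋ []
    A*[G−G']≋[] = begin
      A *ₚ (G −ₚ G')            ≈⟨ PSolver.solve 3 (λ x g g' → x :* (g :- g') := x :* g :- x :* g') ≋-refl A G G' ⟩
      (A *ₚ G) −ₚ (A *ₚ G')     ≈⟨ +ₚ-congʳ (-ₚ (A *ₚ G')) e ⟩
      (A *ₚ G') −ₚ (A *ₚ G')    ≈⟨ -ₚ-inverseʳ (A *ₚ G') ⟩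
      []                        ∎
    G−G'≋[] : (G −ₚ G') ≋ []
    G−G'≋[] = monic-*ₚ-degreeBelow⇒≋[] A₀ a a≈1 (G −ₚ G') [] A*[G−G']≋[] (λ k _ → refl)

module FormalDerivative {c ℓ} (R : CommutativeRing c ℓ) where
  open import Data.Nat using (zero; suc)
  open import Data.List using ([]; _∷_)
  open import Data.Product using (∃₂; _,_)

  open CommutativeRing R hiding (zero)
  open Over R using (fromℕ)
  open PolynomialArithmetic R
  open import Algebra.Properties.Ring ring using (-‿distribˡ-*)
  open PSolver using (_:+_; _:*_; _:-_; _:=_)
  open ≋-Reasoning

  deriv : Poly → Poly
  deriv []      = []
  deriv (a ∷ P) = P +ₚ (0# ∷ deriv P)

  deriv-≋[] : ∀ P → P ≋ [] → deriv P ≋ []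
  deriv-≋[] []      e = ≋-refl
  deriv-≋[] (a ∷ P) e = ≋-trans (+ₚ-cong P≋[] (∷-cong refl (deriv-≋[] P P≋[]))) const-0
    where
    P≋[] : P ≋ []
    P≋[] = mk≋ λ k → at e (suc k)

  deriv-cong : ∀ {P Q} → P ≋ Q → deriv P ≋ deriv Q
  deriv-cong {[]}    {Q}     e = ≋-sym (deriv-≋[] Q (≋-sym e))
  deriv-cong {a ∷ P} {[]}    e = deriv-≋[] (a ∷ P) e
  deriv-cong {a ∷ P} {b ∷ Q} e = +ₚ-cong (∷-tail e) (∷-cong refl (deriv-cong (∷-tail e)))

  deriv-+ₚ : ∀ P Q → deriv (P +ₚ Q) ≋ (deriv P +ₚ deriv Q)
  deriv-+ₚ []      Q       = ≋-refl
  deriv-+ₚ (a ∷ P) []      = ≋-sym (+ₚ-identityʳ _)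
  deriv-+ₚ (a ∷ P) (b ∷ Q) =
    ≋-trans (+ₚ-congˡ (P +ₚ Q) (≋-trans (∷-cong refl (deriv-+ₚ P Q)) (0∷-+ₚ (deriv P) (deriv Q))))
            (+ₚ-interchange P Q (0# ∷ deriv P) (0# ∷ deriv Q))

  deriv-⋆ : ∀ a P → deriv (a ⋆ P) ≋ (a ⋆ deriv P)
  deriv-⋆ a []      = ≋-refl
  deriv-⋆ a (b ∷ P) =
    ≋-trans (+ₚ-congˡ (a ⋆ P) (∷-cong (sym (zeroʳ a)) (deriv-⋆ a P)))
            (≋-sym (⋆-distribˡ-+ₚ a P (0# ∷ deriv P)))

  -ₚ≋-1⋆ : ∀ P → (-ₚ P) ≋ ((- 1#) ⋆ P)
  -ₚ≋-1⋆ P = mk≋ λ k →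
    trans (coeff-‿ P k) (trans (-‿cong (sym (*-identityˡ _)))
          (trans (-‿distribˡ-* 1# (coeff P k)) (sym (coeff-⋆ (- 1#) P k))))

  deriv-‿ : ∀ P → deriv (-ₚ P) ≋ (-ₚ deriv P)
  deriv-‿ P = ≋-trans (deriv-cong (-ₚ≋-1⋆ P)) (≋-trans (deriv-⋆ (- 1#) P) (≋-sym (-ₚ≋-1⋆ (deriv P))))

  deriv-X : deriv X ≋ const 1#
  deriv-X = mk≋ λ { zero → +-identityʳ _ ; (suc zero) → refl ; (suc (suc k)) → refl }

  deriv-*ₚ : ∀ P Q → deriv (P *ₚ Q) ≋ ((deriv P *ₚ Q) +ₚ (P *ₚ deriv Q))
  deriv-*ₚ []      Q = ≋-refl
  deriv-*ₚ (a ∷ P) Q = begin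
    deriv ((a ⋆ Q) +ₚ (0# ∷ (P *ₚ Q)))
      ≈⟨ deriv-+ₚ (a ⋆ Q) _ ⟩
    deriv (a ⋆ Q) +ₚ ((P *ₚ Q) +ₚ (0# ∷ deriv (P *ₚ Q)))
      ≈⟨ +ₚ-cong (≋-trans (deriv-⋆ a Q) (≋-sym (const-*ₚ a (deriv Q))))
                 (+ₚ-congˡ (P *ₚ Q) (≋-trans (∷-cong refl (deriv-*ₚ P Q)) (0∷≋X*ₚ _))) ⟩
    (const a *ₚ deriv Q) +ₚ ((P *ₚ Q) +ₚ (X *ₚ ((deriv P *ₚ Q) +ₚ (P *ₚ deriv Q))))
      ≈⟨ PSolver.solve 6 (λ ka dq p q x dp →
           ka :* dq :+ (p :* q :+ x :* (dp :* q :+ p :* dq)) := (p :+ x :* dp) :* q :+ (ka :+ x :* p) :* dq)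
           ≋-refl (const a) (deriv Q) P Q X (deriv P) ⟩
    ((P +ₚ (X *ₚ deriv P)) *ₚ Q) +ₚ ((const a +ₚ (X *ₚ P)) *ₚ deriv Q)
      ≈⟨ +ₚ-cong (*ₚ-congʳ Q (+ₚ-congˡ P (≋-sym (0∷≋X*ₚ (deriv P))))) (*ₚ-congʳ (deriv Q) (≋-sym a∷P≋)) ⟩
    ((P +ₚ (0# ∷ deriv P)) *ₚ Q) +ₚ ((a ∷ P) *ₚ deriv Q) ∎
    where
    a∷P≋ : (a ∷ P) ≋ (const a +ₚ (X *ₚ P))
    a∷P≋ = ≋-trans (∷-cong (sym (+-identityʳ a)) ≋-refl) (+ₚ-congˡ (const a) (0∷≋X*ₚ P))

  X*deriv-X^ : ∀ n → (X *ₚ deriv (X^ n)) ≋ (const (fromℕ n) *ₚ X^ n)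
  X*deriv-X^ zero    = ≋-trans (*ₚ-congˡ X const-0) (≋-trans (*ₚ-zeroʳ X) (≋-sym (*ₚ-congʳ (X^ 0) const-0)))
  X*deriv-X^ (suc n) = begin
    X *ₚ deriv (X *ₚ X^ n)
      ≈⟨ *ₚ-congˡ X (≋-trans (deriv-*ₚ X (X^ n)) (+ₚ-congʳ (X *ₚ deriv (X^ n)) (*ₚ-congʳ (X^ n) deriv-X))) ⟩
    X *ₚ ((const 1# *ₚ X^ n) +ₚ (X *ₚ deriv (X^ n)))
      ≈⟨ PSolver.solve 4 (λ x o p d → x :* (o :* p :+ x :* d) := x :* o :* p :+ x :* (x :* d))
           ≋-refl X (const 1#) (X^ n) (deriv (X^ n)) ⟩
    ((X *ₚ const 1#) *ₚ X^ n) +ₚ (X *ₚ (X *ₚ deriv (X^ n)))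
      ≈⟨ +ₚ-congˡ ((X *ₚ const 1#) *ₚ X^ n) (*ₚ-congˡ X (X*deriv-X^ n)) ⟩
    ((X *ₚ const 1#) *ₚ X^ n) +ₚ (X *ₚ (const (fromℕ n) *ₚ X^ n))
      ≈⟨ PSolver.solve 4 (λ x o k p → x :* o :* p :+ x :* (k :* p) := (o :+ k) :* (x :* p))
           ≋-refl X (const 1#) (const (fromℕ n)) (X^ n) ⟩
    const (fromℕ (suc n)) *ₚ X^ suc n ∎

  -- X^n − 1 is squarefree as soon as n is invertible:  X·(X^n − 1)′ − n·(X^n − 1) = n.
  Xⁿ−1-squarefree : ∀ n A B W → Xⁿ−1 n ≋ (A *ₚ (B *ₚ W)) →
                    ∃₂ λ U V → ((A *ₚ U) +ₚ (B *ₚ V)) ≋ const (fromℕ n)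
  Xⁿ−1-squarefree n A B W e = U , V , (begin
    (A *ₚ U) +ₚ (B *ₚ V)
      ≈⟨ PSolver.solve 7 (λ a b w x da dbw n →
           a :* (x :* dbw :- n :* (b :* w)) :+ b :* (x :* da :* w)
             := x :* (da :* (b :* w) :+ a :* dbw) :- n :* (a :* (b :* w)))
           ≋-refl A B W X (deriv A) (deriv (B *ₚ W)) n̂ ⟩
    (X *ₚ ((deriv A *ₚ (B *ₚ W)) +ₚ (A *ₚ deriv (B *ₚ W)))) −ₚ (n̂ *ₚ (A *ₚ (B *ₚ W)))
      ≈⟨ +ₚ-cong (*ₚ-congˡ X (≋-sym (≋-trans (deriv-cong e) (deriv-*ₚ A (B *ₚ W)))))
                 (-ₚ-cong (*ₚ-congˡ n̂ (≋-sym e))) ⟩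
    (X *ₚ deriv (Xⁿ−1 n)) −ₚ (n̂ *ₚ Xⁿ−1 n)
      ≈⟨ +ₚ-congʳ (-ₚ (n̂ *ₚ Xⁿ−1 n)) (≋-trans (*ₚ-congˡ X deriv-Xⁿ−1) (X*deriv-X^ n)) ⟩
    (n̂ *ₚ X^ n) −ₚ (n̂ *ₚ Xⁿ−1 n)
      ≈⟨ PSolver.solve 3 (λ k p o → k :* p :- k :* (p :- o) := k :* o) ≋-refl n̂ (X^ n) (const 1#) ⟩
    n̂ *ₚ const 1#
      ≈⟨ *ₚ-identityʳ n̂ ⟩
    n̂ ∎)
    where
    n̂ = const (fromℕ n)
    U = (X *ₚ deriv (B *ₚ W)) −ₚ (n̂ *ₚ (B *ₚ W))
    V = (X *ₚ deriv A) *ₚ W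
    deriv-Xⁿ−1 : deriv (Xⁿ−1 n) ≋ deriv (X^ n)
    deriv-Xⁿ−1 = ≋-trans (deriv-+ₚ (X^ n) (-ₚ const 1#))
      (≋-trans (+ₚ-congˡ (deriv (X^ n)) (≋-trans (deriv-‿ (const 1#)) (-ₚ-cong const-0))) (+ₚ-identityʳ _))

module PowersMinusOne {c ℓ} (R : CommutativeRing c ℓ) where
  open import Data.Nat as ℕ using (ℕ; zero; suc)
  import Data.Nat.Properties as ℕ
  open import Data.Nat.Divisibility using () renaming (_∣_ to _∣ℕ_; divides to dividesℕ)
  open import Data.Nat.GCD using (gcd; gcd-GCD; module Bézout)
  open import Data.List using ([])
  open import Data.Product using (∃₂; _,_)
  open import Function.Base using (_$_)
  open import Level using (_⊔_)
  open import Relation.Binary.PropositionalEquality using (_≡_)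
  import Relation.Binary.PropositionalEquality as ≡

  open CommutativeRing R hiding (zero)
  open PolynomialArithmetic R
  open PSolver using (_:+_; _:*_; _:-_; _:=_; :-_)
  open ≋-Reasoning

  geometric : ℕ → ℕ → Poly
  geometric h zero    = []
  geometric h (suc t) = const 1# +ₚ (X^ h *ₚ geometric h t)

  Xⁿ−1-+ : ∀ m n → Xⁿ−1 (m ℕ.+ n) ≋ ((X^ m *ₚ (Xⁿ−1 n)) +ₚ Xⁿ−1 m)
  Xⁿ−1-+ m n = begin
    X^ (m ℕ.+ n) −ₚ const 1#                      ≈⟨ +ₚ-congʳ (-ₚ const 1#) (X^-+ m n) ⟩
    (X^ m *ₚ X^ n) −ₚ const 1#
      ≈⟨ PSolver.solve 3 (λ p q o → p :* q :- o := p :* (q :- o) :+ (p :* o :- o)) ≋-refl (X^ m) (X^ n) (const 1#) ⟩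
    (X^ m *ₚ (Xⁿ−1 n)) +ₚ ((X^ m *ₚ const 1#) −ₚ const 1#)
      ≈⟨ +ₚ-congˡ (X^ m *ₚ (Xⁿ−1 n)) (+ₚ-congʳ (-ₚ const 1#) (*ₚ-identityʳ (X^ m))) ⟩
    (X^ m *ₚ (Xⁿ−1 n)) +ₚ Xⁿ−1 m                    ∎

  Xⁿ−1-*-geometric : ∀ h t → Xⁿ−1 (h ℕ.* t) ≋ (Xⁿ−1 h *ₚ geometric h t)
  Xⁿ−1-*-geometric h zero    =
    ≋-trans (≋-reflexive (≡.cong Xⁿ−1 (ℕ.*-zeroʳ h))) (≋-trans X⁰−1≋[] (≋-sym (*ₚ-zeroʳ (Xⁿ−1 h))))
  Xⁿ−1-*-geometric h (suc t) = begin
    Xⁿ−1 (h ℕ.* suc t)                             ≡⟨ ≡.cong Xⁿ−1 (ℕ.*-suc h t) ⟩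
    Xⁿ−1 (h ℕ.+ h ℕ.* t)
      ≈⟨ ≋-trans (Xⁿ−1-+ h (h ℕ.* t)) (+ₚ-comm (X^ h *ₚ (Xⁿ−1 (h ℕ.* t))) (Xⁿ−1 h)) ⟩
    Xⁿ−1 h +ₚ (X^ h *ₚ (Xⁿ−1 (h ℕ.* t)))
      ≈⟨ +ₚ-congˡ (Xⁿ−1 h) (*ₚ-congˡ (X^ h) (Xⁿ−1-*-geometric h t)) ⟩
    Xⁿ−1 h +ₚ (X^ h *ₚ (Xⁿ−1 h *ₚ geometric h t))
      ≈⟨ +ₚ-congʳ _ (≋-sym (*ₚ-identityʳ (Xⁿ−1 h))) ⟩
    (Xⁿ−1 h *ₚ const 1#) +ₚ (X^ h *ₚ (Xⁿ−1 h *ₚ geometric h t))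
      ≈⟨ PSolver.solve 4 (λ e o p g → e :* o :+ p :* (e :* g) := e :* (o :+ p :* g))
           ≋-refl (Xⁿ−1 h) (const 1#) (X^ h) (geometric h t) ⟩
    Xⁿ−1 h *ₚ geometric h (suc t)                  ∎

  Xⁿ−1-∣ₓ : ∀ h m → h ∣ℕ m → Xⁿ−1 h ∣ₓ Xⁿ−1 m
  Xⁿ−1-∣ₓ h m (dividesℕ t ≡.refl) =
    divₓ (geometric h t) $ ≋-sym (≋-trans (≋-reflexive (≡.cong Xⁿ−1 (ℕ.*-comm t h))) (Xⁿ−1-*-geometric h t))

  -- From g + y·b = x·a:  X^g − 1 = (X^(xa) − 1) − X^g (X^(yb) − 1).
  Xⁿ−1-combination : ∀ {g} a b x y → g ℕ.+ y ℕ.* b ≡ x ℕ.* a →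
                     ∃₂ λ U V → ((Xⁿ−1 a *ₚ U) +ₚ (Xⁿ−1 b *ₚ V)) ≋ Xⁿ−1 g
  Xⁿ−1-combination {g} a b x y eq = geometric a x , -ₚ (X^ g *ₚ geometric b y) , (begin
    (Xⁿ−1 a *ₚ geometric a x) +ₚ (Xⁿ−1 b *ₚ (-ₚ (X^ g *ₚ geometric b y)))
      ≈⟨ PSolver.solve 5 (λ ea ga eb p gb → ea :* ga :+ eb :* (:- (p :* gb)) := ea :* ga :- p :* (eb :* gb))
           ≋-refl (Xⁿ−1 a) (geometric a x) (Xⁿ−1 b) (X^ g) (geometric b y) ⟩
    (Xⁿ−1 a *ₚ geometric a x) −ₚ (X^ g *ₚ (Xⁿ−1 b *ₚ geometric b y))
      ≈⟨ ≋-sym (+ₚ-cong (Xⁿ−1-*-geometric a x) (-ₚ-cong (*ₚ-congˡ (X^ g) (Xⁿ−1-*-geometric b y)))) ⟩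
    Xⁿ−1 (a ℕ.* x) −ₚ (X^ g *ₚ (Xⁿ−1 (b ℕ.* y)))
      ≡⟨ ≡.cong₂ (λ s t → Xⁿ−1 s −ₚ (X^ g *ₚ (Xⁿ−1 t)))
           (≡.trans (ℕ.*-comm a x) (≡.sym eq)) (ℕ.*-comm b y) ⟩
    Xⁿ−1 (g ℕ.+ y ℕ.* b) −ₚ (X^ g *ₚ (Xⁿ−1 (y ℕ.* b)))
      ≈⟨ +ₚ-congʳ _ (Xⁿ−1-+ g (y ℕ.* b)) ⟩
    ((X^ g *ₚ (Xⁿ−1 (y ℕ.* b))) +ₚ Xⁿ−1 g) −ₚ (X^ g *ₚ (Xⁿ−1 (y ℕ.* b)))
      ≈⟨ PSolver.solve 2 (λ s e → (s :+ e) :- s := e) ≋-refl (X^ g *ₚ (Xⁿ−1 (y ℕ.* b))) (Xⁿ−1 g) ⟩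
    Xⁿ−1 g ∎)

  Xⁿ−1-identity : ∀ {g a b} → Bézout.Identity g a b → ∃₂ λ U V → ((Xⁿ−1 a *ₚ U) +ₚ (Xⁿ−1 b *ₚ V)) ≋ Xⁿ−1 g
  Xⁿ−1-identity {a = a} {b} (Bézout.+- x y eq) = Xⁿ−1-combination a b x y eq
  Xⁿ−1-identity {a = a} {b} (Bézout.-+ x y eq) =
    let U , V , e = Xⁿ−1-combination b a y x eq in V , U , ≋-trans (+ₚ-comm (Xⁿ−1 a *ₚ V) (Xⁿ−1 b *ₚ U)) e

  Xⁿ−1-bezout : ∀ a b → ∃₂ λ U V → ((Xⁿ−1 a *ₚ U) +ₚ (Xⁿ−1 b *ₚ V)) ≋ Xⁿ−1 (gcd a b)
  Xⁿ−1-bezout a b = Xⁿ−1-identity (Bézout.identity (gcd-GCD a b))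

  Coprime : Poly → Poly → Set (c ⊔ ℓ)
  Coprime A B = ∃₂ λ U V → ∃₂ λ a a⁻¹ → ((A *ₚ U) +ₚ (B *ₚ V)) ≋ const a × a * a⁻¹ ≈ 1#

  Coprime-sym : ∀ {A B} → Coprime A B → Coprime B A
  Coprime-sym {A} {B} (U , V , a , a⁻¹ , e , i) = V , U , a , a⁻¹ , ≋-trans (+ₚ-comm (B *ₚ V) (A *ₚ U)) e , i

  Coprime-1 : ∀ A → Coprime A (const 1#)
  Coprime-1 A = [] , const 1# , 1# , 1# ,
    ≋-trans (+ₚ-congʳ (const 1# *ₚ const 1#) (*ₚ-zeroʳ A)) (*ₚ-identityʳ (const 1#)) , *-identityʳ 1#

  Coprime-cong : ∀ {A A' B B'} → A ≋ A' → B ≋ B' → Coprime A B → Coprime A' B'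
  Coprime-cong {A} {A'} {B} {B'} x y (U , V , a , a⁻¹ , e , i) =
    U , V , a , a⁻¹ , ≋-trans (+ₚ-cong (*ₚ-congʳ U (≋-sym x)) (*ₚ-congʳ V (≋-sym y))) e , i

  Coprime-*ₚ : ∀ {A B C} → Coprime A B → Coprime A C → Coprime A (B *ₚ C)
  Coprime-*ₚ {A} {B} {C} (U , V , a , a⁻¹ , e , i) (U₂ , V₂ , b , b⁻¹ , f , j) =
    (U *ₚ ((A *ₚ U₂) +ₚ (C *ₚ V₂))) +ₚ ((B *ₚ V) *ₚ U₂) , V *ₚ V₂ , a * b , a⁻¹ * b⁻¹ , (begin
      (A *ₚ ((U *ₚ ((A *ₚ U₂) +ₚ (C *ₚ V₂))) +ₚ ((B *ₚ V) *ₚ U₂))) +ₚ ((B *ₚ C) *ₚ (V *ₚ V₂))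
        ≈⟨ PSolver.solve 7 (λ a u u₂ c v₂ b v →
             a :* (u :* (a :* u₂ :+ c :* v₂) :+ (b :* v) :* u₂) :+ (b :* c) :* (v :* v₂)
               := (a :* u :+ b :* v) :* (a :* u₂ :+ c :* v₂))
             ≋-refl A U U₂ C V₂ B V ⟩
      ((A *ₚ U) +ₚ (B *ₚ V)) *ₚ ((A *ₚ U₂) +ₚ (C *ₚ V₂))  ≈⟨ *ₚ-cong e f ⟩
      const a *ₚ const b                                  ≈⟨ ≋-sym (const-* a b) ⟩
      const (a * b)                                       ∎) ,
    trans (*-interchange a b a⁻¹ b⁻¹) (trans (*-cong i j) (*-identityʳ 1#))
    where open import Algebra.Properties.CommutativeSemigroup *-commutativeSemigroup
            using () renaming (interchange to *-interchange)

  Coprime⇒*ₚ-∣ₓ : ∀ {A B C} → A ∣ₓ C → B ∣ₓ C → Coprime A B → (A *ₚ B) ∣ₓ C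
  Coprime⇒*ₚ-∣ₓ {A} {B} {C} (divₓ x ex) (divₓ y ey) (U , V , a , a⁻¹ , e , i) = divₓ G (begin
    (A *ₚ B) *ₚ G
      ≈⟨ PSolver.solve 7 (λ a b k y u x v →
           (a :* b) :* (k :* (y :* u :+ x :* v)) := k :* ((b :* y) :* (a :* u) :+ (a :* x) :* (b :* v)))
           ≋-refl A B (const a⁻¹) y U x V ⟩
    const a⁻¹ *ₚ (((B *ₚ y) *ₚ (A *ₚ U)) +ₚ ((A *ₚ x) *ₚ (B *ₚ V)))
      ≈⟨ *ₚ-congˡ (const a⁻¹) (+ₚ-cong (*ₚ-congʳ (A *ₚ U) ey) (*ₚ-congʳ (B *ₚ V) ex)) ⟩
    const a⁻¹ *ₚ ((C *ₚ (A *ₚ U)) +ₚ (C *ₚ (B *ₚ V)))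
      ≈⟨ *ₚ-congˡ (const a⁻¹) (≋-trans (≋-sym (*ₚ-distribˡ-+ₚ C (A *ₚ U) (B *ₚ V))) (*ₚ-congˡ C e)) ⟩
    const a⁻¹ *ₚ (C *ₚ const a)
      ≈⟨ PSolver.solve 3 (λ k c a → k :* (c :* a) := c :* (a :* k)) ≋-refl (const a⁻¹) C (const a) ⟩
    C *ₚ (const a *ₚ const a⁻¹)
      ≈⟨ *ₚ-congˡ C (≋-trans (≋-sym (const-* a a⁻¹)) (const-cong i)) ⟩
    C *ₚ const 1#
      ≈⟨ *ₚ-identityʳ C ⟩
    C ∎)
    where
    G = const a⁻¹ *ₚ ((y *ₚ U) +ₚ (x *ₚ V))

module RangeProducts {c ℓ} (R : CommutativeRing c ℓ) where
  open import Data.Nat as ℕ using (ℕ; zero; suc; _≤_; _<_; z≤n; s≤s)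
  import Data.Nat.Properties as ℕ
  open import Data.Bool using (Bool; true; false; if_then_else_; _∧_; not)
  open import Data.List using (List; []; _∷_; map; foldr; filter; upTo; _∷ʳ_)
  import Data.List.Properties as List
  open import Data.Sum using (inj₁; inj₂)
  open import Relation.Binary.PropositionalEquality using (_≡_)
  import Relation.Binary.PropositionalEquality as ≡
  open import Relation.Nullary using (does)
  open import Relation.Unary using (Decidable)

  open CommutativeRing R hiding (zero)
  open PolynomialArithmetic R
  open ≋-Reasoning

  prodₚ : List Poly → Poly
  prodₚ = foldr _*ₚ_ (const 1#)

  factorIf : (ℕ → Bool) → (ℕ → Poly) → ℕ → Poly
  factorIf p g d = if p d then g d else const 1#

  prodIf : List ℕ → (ℕ → Bool) → (ℕ → Poly) → Poly
  prodIf []      p g = const 1#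
  prodIf (x ∷ L) p g = factorIf p g x *ₚ prodIf L p g

  prodₚ-filter : ∀ {P : ℕ → Set} (P? : Decidable P) g L →
                 prodₚ (map g (filter P? L)) ≋ prodIf L (λ d → does (P? d)) g
  prodₚ-filter P? g []      = ≋-refl
  prodₚ-filter P? g (x ∷ L) with does (P? x)
  ... | true  = *ₚ-congˡ (g x) (prodₚ-filter P? g L)
  ... | false = ≋-trans (prodₚ-filter P? g L) (≋-sym (*ₚ-identityˡ _))

  prodIf-∷ʳ : ∀ L y (p : ℕ → Bool) (g : ℕ → Poly) → prodIf (L ∷ʳ y) p g ≋ (prodIf L p g *ₚ factorIf p g y)
  prodIf-∷ʳ []      y p g = ≋-trans (*ₚ-identityʳ _) (≋-sym (*ₚ-identityˡ _))
  prodIf-∷ʳ (x ∷ L) y p g =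
    ≋-trans (*ₚ-congˡ (factorIf p g x) (prodIf-∷ʳ L y p g))
            (≋-sym (*ₚ-assoc (factorIf p g x) (prodIf L p g) (factorIf p g y)))

  prodRange : ℕ → (ℕ → Bool) → (ℕ → Poly) → Poly
  prodRange N = prodIf (map suc (upTo N))

  prodRange-suc : ∀ N (p : ℕ → Bool) (g : ℕ → Poly) → prodRange (suc N) p g ≋ (prodRange N p g *ₚ factorIf p g (suc N))
  prodRange-suc N p g = ≋-trans (≋-reflexive (≡.cong (λ L → prodIf L p g) range-∷ʳ)) (prodIf-∷ʳ (map suc (upTo N)) (suc N) p g)
    where
    range-∷ʳ : map suc (upTo (suc N)) ≡ map suc (upTo N) ∷ʳ suc N
    range-∷ʳ = ≡.trans (≡.cong (map suc) (≡.sym (List.upTo-∷ʳ N))) (List.map-++ suc (upTo N) (N ∷ []))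

  prodRange-cong : ∀ N {p q g h} → (∀ d → 1 ≤ d → d ≤ N → p d ≡ q d) →
                   (∀ d → 1 ≤ d → d ≤ N → p d ≡ true → g d ≋ h d) → prodRange N p g ≋ prodRange N q h
  prodRange-cong zero    p≡q g≋h = ≋-refl
  prodRange-cong (suc N) {p} {q} {g} {h} p≡q g≋h = begin
    prodRange (suc N) p g                 ≈⟨ prodRange-suc N p g ⟩
    prodRange N p g *ₚ factorIf p g (suc N)
      ≈⟨ *ₚ-cong (prodRange-cong N (λ d a b → p≡q d a (ℕ.m≤n⇒m≤1+n b)) (λ d a b → g≋h d a (ℕ.m≤n⇒m≤1+n b)))
                 top ⟩
    prodRange N q h *ₚ factorIf q h (suc N) ≈⟨ ≋-sym (prodRange-suc N q h) ⟩
    prodRange (suc N) q h                 ∎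
    where
    top : factorIf p g (suc N) ≋ factorIf q h (suc N)
    top with p (suc N) | q (suc N) | p≡q (suc N) (s≤s z≤n) ℕ.≤-refl | g≋h (suc N) (s≤s z≤n) ℕ.≤-refl
    ... | true  | true  | ≡.refl | g≋h′ = g≋h′ ≡.refl
    ... | false | false | ≡.refl | _    = ≋-refl

  prodRange-split : ∀ N (p q : ℕ → Bool) (g : ℕ → Poly) →
    prodRange N p g ≋ (prodRange N (λ x → p x ∧ q x) g *ₚ prodRange N (λ x → p x ∧ not (q x)) g)
  prodRange-split zero    p q g = ≋-sym (*ₚ-identityˡ _)
  prodRange-split (suc N) p q g = begin
    prodRange (suc N) p g              ≈⟨ prodRange-suc N p g ⟩
    prodRange N p g *ₚ factorIf p g (suc N)
      ≈⟨ *ₚ-cong (prodRange-split N p q g) (factor-split (suc N)) ⟩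
    (A *ₚ B) *ₚ (a *ₚ b)
      ≈⟨ PSolver.solve 4 (λ A B a b → (A :* B) :* (a :* b) := (A :* a) :* (B :* b)) ≋-refl A B a b ⟩
    (A *ₚ a) *ₚ (B *ₚ b)
      ≈⟨ ≋-sym (*ₚ-cong (prodRange-suc N p∧q g) (prodRange-suc N p∧¬q g)) ⟩
    prodRange (suc N) p∧q g *ₚ prodRange (suc N) p∧¬q g ∎
    where
    open PSolver using (_:*_; _:=_)
    p∧q p∧¬q : ℕ → Bool
    p∧q  x = p x ∧ q x
    p∧¬q x = p x ∧ not (q x)
    A = prodRange N p∧q g
    B = prodRange N p∧¬q g
    a = factorIf p∧q g (suc N)
    b = factorIf p∧¬q g (suc N)
    factor-split : ∀ d → factorIf p g d ≋ (factorIf p∧q g d *ₚ factorIf p∧¬q g d)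
    factor-split d with p d | q d
    ... | true  | true  = ≋-sym (*ₚ-identityʳ _)
    ... | true  | false = ≋-sym (*ₚ-identityˡ _)
    ... | false | _     = ≋-sym (*ₚ-identityˡ _)

  prodRange-extend : ∀ N N′ (p : ℕ → Bool) (g : ℕ → Poly) → N ≤ N′ → (∀ d → N < d → p d ≡ false) →
                     prodRange N p g ≋ prodRange N′ p g
  prodRange-extend N N′ p g N≤N′ vanish =
    ≋-trans (extend (N′ ℕ.∸ N)) (≋-reflexive (≡.cong (λ x → prodRange x p g) (ℕ.m∸n+n≡m N≤N′)))
    where
    extend : ∀ k → prodRange N p g ≋ prodRange (k ℕ.+ N) p g
    extend zero    = ≋-refl
    extend (suc k) = ≋-trans (extend k) (≋-sym (≋-trans (prodRange-suc (k ℕ.+ N) p g)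
                       (≋-trans (*ₚ-congˡ (prodRange (k ℕ.+ N) p g) top≋1) (*ₚ-identityʳ _))))
      where
      top≋1 : factorIf p g (suc (k ℕ.+ N)) ≋ const 1#
      top≋1 rewrite vanish (suc (k ℕ.+ N)) (s≤s (ℕ.m≤n+m N k)) = ≋-refl

  factor∣ₓprodRange : ∀ N (p : ℕ → Bool) (g : ℕ → Poly) d → 1 ≤ d → d ≤ N → p d ≡ true → g d ∣ₓ prodRange N p g
  factor∣ₓprodRange zero    p g (suc d) _ () _
  factor∣ₓprodRange (suc N) p g d 1≤d d≤N pd with ℕ.m≤n⇒m<n∨m≡n d≤N
  ... | inj₁ d<N   = ∣ₓ-cong (≋-refl {g d}) (≋-sym (prodRange-suc N p g))
                       (∣ₓ⇒∣ₓ*ₚ (factorIf p g (suc N)) (factor∣ₓprodRange N p g d 1≤d (ℕ.≤-pred d<N) pd))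
  ... | inj₂ ≡.refl = ∣ₓ-cong (≋-refl {g d}) (≋-sym (prodRange-suc N p g))
                       (∣ₓ⇒∣ₓ*ₚ′ (prodRange N p g) (∣ₓ-cong (≋-refl {g d}) g≋factor ∣ₓ-refl))
    where
    g≋factor : g d ≋ factorIf p g d
    g≋factor = ≋-reflexive (≡.cong (λ b → if b then g d else const 1#) (≡.sym pd))

-- Defs keeps the helpers of divMonic and cyclotomic private; they are recovered here by
-- unification against their defining equations (the with-abstraction and the conjunct S ≡ S
-- are what let Agda solve for S).
module DefsInternals where
  open import Data.List using (List; []; _∷_; reverse; length; drop; foldr; map)
  open import Data.Nat using (ℕ; suc; _∸_)
  open import Data.Integer using (ℤ; +_)
  open import Data.Product using (_×_; _,_)
  open import Relation.Binary.PropositionalEquality using (_≡_; refl)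

  private
    solution : ∀ {A : Set} (P : A → Set) {a : A} → P a → A
    solution P {a} _ = a

    SynthSpec : (ℕ → List ℤ → List ℤ → List ℤ) → Set
    SynthSpec S = ∀ A B → (S ≡ S) × divMonic A B ≡ reverse (S (length A ∸ (length B ∸ 1)) (drop 1 (reverse B)) (reverse A))

    synthSpec : SynthSpec _
    synthSpec A B with reverse {A = ℤ}
    ... | rev with length A ∸ (length B ∸ 1) | drop 1 (rev B) | rev A
    ...   | k | bs | as = refl , refl

  synth : ℕ → List ℤ → List ℤ → List ℤ
  synth = solution SynthSpec synthSpec

  private
    SubLeadSpec : (ℤ → List ℤ → List ℤ → List ℤ) → Set
    SubLeadSpec T = ∀ k bs a as → synth (suc k) bs (a ∷ as) ≡ a ∷ synth k bs (T a bs as)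

    subLeadSpec : SubLeadSpec _
    subLeadSpec k bs a as = refl

  subLead : ℤ → List ℤ → List ℤ → List ℤ
  subLead = solution SubLeadSpec subLeadSpec

  private
    CycloSpec : (ℕ → ℕ → List ℤ) → Set
    CycloSpec G = ∀ n → cyclotomic (suc n) ≡
      divMonic (xPowMinus1 (suc n)) (foldr mulZ (+ 1 ∷ []) (map (G n) (properDivisors (suc n))))

    cycloSpec : CycloSpec _
    cycloSpec n = refl

  cycloAux : ℕ → ℕ → List ℤ
  cycloAux = solution CycloSpec cycloSpec

module IntegerPolynomials {c ℓ} (R : CommutativeRing c ℓ) where
  open import Data.Nat as ℕ using (ℕ; zero; suc; _≤_; s≤s; _∸_)
  import Data.Nat.Properties as ℕ
  open import Data.Integer as ℤ using (ℤ; +_; -[1+_])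
  import Data.Integer.Properties as ℤ
  open import Data.List using (List; []; _∷_; map; replicate; _++_; length; reverse; drop; foldr)
  import Data.List.Properties as List
  open import Data.List.Relation.Unary.All using (All; []; _∷_)
  open import Data.Product using (∃; _,_; proj₁; proj₂; _×_)
  open import Data.Empty using (⊥-elim)
  open import Relation.Nullary using (¬_; yes; no)
  open import Relation.Binary.PropositionalEquality using (_≡_)
  import Relation.Binary.PropositionalEquality as ≡

  open CommutativeRing R hiding (zero)
  open Over R using (fromℤ)
  open IntegerEmbedding R using (fromℤ-+; fromℤ-*; fromℤ-‿; fromℤ-1)
  open PolynomialArithmetic R
  open RangeProducts R using (prodₚ)
  open DefsInternals
  open PSolver using (_:+_; _:*_; _:-_; _:=_)
  open ≋-Reasoning

  ⟦_⟧ : List ℤ → Poly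
  ⟦ P ⟧ = map fromℤ P

  ⟦addZ⟧ : ∀ P Q → ⟦ addZ P Q ⟧ ≋ (⟦ P ⟧ +ₚ ⟦ Q ⟧)
  ⟦addZ⟧ []      Q       = ≋-refl
  ⟦addZ⟧ (x ∷ P) []      = ≋-refl
  ⟦addZ⟧ (x ∷ P) (y ∷ Q) = ∷-cong (fromℤ-+ x y) (⟦addZ⟧ P Q)

  ⟦map-*⟧ : ∀ a P → ⟦ map (a ℤ.*_) P ⟧ ≋ (fromℤ a ⋆ ⟦ P ⟧)
  ⟦map-*⟧ a []      = ≋-refl
  ⟦map-*⟧ a (x ∷ P) = ∷-cong (fromℤ-* a x) (⟦map-*⟧ a P)

  ⟦mulZ⟧ : ∀ P Q → ⟦ mulZ P Q ⟧ ≋ (⟦ P ⟧ *ₚ ⟦ Q ⟧)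
  ⟦mulZ⟧ []      Q = ≋-refl
  ⟦mulZ⟧ (a ∷ P) Q = ≋-trans (⟦addZ⟧ (map (a ℤ.*_) Q) (+ 0 ∷ mulZ P Q))
                             (+ₚ-cong (⟦map-*⟧ a Q) (∷-cong refl (⟦mulZ⟧ P Q)))

  ⟦foldr-mulZ⟧ : ∀ Ps → ⟦ foldr mulZ (+ 1 ∷ []) Ps ⟧ ≋ prodₚ (map ⟦_⟧ Ps)
  ⟦foldr-mulZ⟧ []       = const-cong fromℤ-1
  ⟦foldr-mulZ⟧ (P ∷ Ps) = ≋-trans (⟦mulZ⟧ P _) (*ₚ-congˡ ⟦ P ⟧ (⟦foldr-mulZ⟧ Ps))

  ⟦X^⟧ : ∀ n → ⟦ replicate n (+ 0) ++ (+ 1 ∷ []) ⟧ ≋ X^ n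
  ⟦X^⟧ zero    = const-cong fromℤ-1
  ⟦X^⟧ (suc n) = ≋-trans (∷-cong refl (⟦X^⟧ n)) (0∷≋X*ₚ (X^ n))

  ⟦xPowMinus1⟧ : ∀ n → ⟦ xPowMinus1 n ⟧ ≋ Xⁿ−1 n
  ⟦xPowMinus1⟧ n = ≋-trans (⟦addZ⟧ (-[1+ 0 ] ∷ []) (replicate n (+ 0) ++ (+ 1 ∷ [])))
    (≋-trans (+ₚ-cong (const-cong (-‿cong fromℤ-1)) (⟦X^⟧ n)) (+ₚ-comm (const (- 1#)) (X^ n)))

  ++≋+ₚshift : ∀ P Q → (P ++ Q) ≋ (P +ₚ shift (length P) Q)
  ++≋+ₚshift []      Q = ≋-refl
  ++≋+ₚshift (x ∷ P) Q = ∷-cong (sym (+-identityʳ x)) (++≋+ₚshift P Q)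

  ⟦_⟧ʳ : List ℤ → Poly
  ⟦ P ⟧ʳ = ⟦ reverse P ⟧

  ⟦∷⟧ʳ : ∀ a P → ⟦ a ∷ P ⟧ʳ ≋ (⟦ P ⟧ʳ +ₚ (X^ length P *ₚ const (fromℤ a)))
  ⟦∷⟧ʳ a P = begin
    ⟦ reverse (a ∷ P) ⟧                               ≡⟨ ≡.cong ⟦_⟧ (List.unfold-reverse a P) ⟩
    ⟦ reverse P ++ a ∷ [] ⟧                           ≡⟨ List.map-++ fromℤ (reverse P) (a ∷ []) ⟩
    ⟦ reverse P ⟧ ++ const (fromℤ a)                  ≈⟨ ++≋+ₚshift ⟦ reverse P ⟧ (const (fromℤ a)) ⟩
    ⟦ P ⟧ʳ +ₚ shift (length ⟦ reverse P ⟧) (const (fromℤ a))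
      ≈⟨ +ₚ-congˡ ⟦ P ⟧ʳ (≋-trans (≋-reflexive (≡.cong (λ n → shift n (const (fromℤ a))) length-⟦rev⟧))
                                   (shift≋X^*ₚ (length P) (const (fromℤ a)))) ⟩
    ⟦ P ⟧ʳ +ₚ (X^ length P *ₚ const (fromℤ a))       ∎
    where
    length-⟦rev⟧ : length ⟦ reverse P ⟧ ≡ length P
    length-⟦rev⟧ = ≡.trans (List.length-map fromℤ (reverse P)) (List.length-reverse P)

  subLead-correct : ∀ a bs xs → length bs ≤ length xs →
    length (subLead a bs xs) ≡ length xs ×
    ⟦ subLead a bs xs ⟧ʳ ≋ (⟦ xs ⟧ʳ −ₚ ((const (fromℤ a) *ₚ X^ (length xs ∸ length bs)) *ₚ ⟦ bs ⟧ʳ))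
  subLead-correct a [] xs _ = ≡.refl ,
    ≋-sym (≋-trans (+ₚ-congˡ ⟦ xs ⟧ʳ (-ₚ-cong (*ₚ-zeroʳ (const (fromℤ a) *ₚ X^ length xs)))) (+ₚ-identityʳ ⟦ xs ⟧ʳ))
  subLead-correct a (b ∷ bs) (x ∷ xs) (s≤s bs≤xs) = ≡.cong suc length-s , (begin
    ⟦ (x ℤ.- a ℤ.* b) ∷ s ⟧ʳ
      ≈⟨ ⟦∷⟧ʳ _ s ⟩
    ⟦ s ⟧ʳ +ₚ (X^ length s *ₚ const (fromℤ (x ℤ.- a ℤ.* b)))
      ≈⟨ +ₚ-cong ⟦s⟧ʳ (*ₚ-cong (≋-trans (≋-reflexive (≡.cong X^_ length-s)) X^xs≋) ⟦x−ab⟧) ⟩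
    (⟦ xs ⟧ʳ −ₚ ((â *ₚ X^d) *ₚ ⟦ bs ⟧ʳ)) +ₚ ((X^d *ₚ X^bs) *ₚ (x̂ −ₚ (â *ₚ b̂)))
      ≈⟨ PSolver.solve 7 (λ r ka pd rb pb kx kb →
           (r :- (ka :* pd) :* rb) :+ (pd :* pb) :* (kx :- ka :* kb)
             := (r :+ (pd :* pb) :* kx) :- (ka :* pd) :* (rb :+ pb :* kb))
           ≋-refl ⟦ xs ⟧ʳ â X^d ⟦ bs ⟧ʳ X^bs x̂ b̂ ⟩
    (⟦ xs ⟧ʳ +ₚ ((X^d *ₚ X^bs) *ₚ x̂)) −ₚ ((â *ₚ X^d) *ₚ (⟦ bs ⟧ʳ +ₚ (X^bs *ₚ b̂)))
      ≈⟨ ≋-sym (+ₚ-cong (≋-trans (⟦∷⟧ʳ x xs) (+ₚ-congˡ ⟦ xs ⟧ʳ (*ₚ-congʳ x̂ X^xs≋)))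
                        (-ₚ-cong (*ₚ-congˡ (â *ₚ X^d) (⟦∷⟧ʳ b bs)))) ⟩
    ⟦ x ∷ xs ⟧ʳ −ₚ ((â *ₚ X^d) *ₚ ⟦ b ∷ bs ⟧ʳ) ∎)
    where
    s = subLead a bs xs
    IH = subLead-correct a bs xs bs≤xs
    length-s = proj₁ IH
    ⟦s⟧ʳ = proj₂ IH
    â = const (fromℤ a)
    x̂ = const (fromℤ x)
    b̂ = const (fromℤ b)
    X^d = X^ (length xs ∸ length bs)
    X^bs = X^ length bs
    X^xs≋ : X^ length xs ≋ (X^d *ₚ X^bs)
    X^xs≋ = ≋-trans (≋-reflexive (≡.cong X^_ (≡.sym (ℕ.m∸n+n≡m bs≤xs)))) (X^-+ (length xs ∸ length bs) (length bs))
    ⟦x−ab⟧ : const (fromℤ (x ℤ.- a ℤ.* b)) ≋ (x̂ −ₚ (â *ₚ b̂))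
    ⟦x−ab⟧ = ≋-trans
      (const-cong (trans (fromℤ-+ x (ℤ.- (a ℤ.* b))) (+-congˡ (trans (fromℤ-‿ (a ℤ.* b)) (-‿cong (fromℤ-* a b))))))
      (+ₚ-congˡ x̂ (-ₚ-cong (const-* (fromℤ a) (fromℤ b))))

  synth-correct : ∀ k bs as → length as ≡ k ℕ.+ length bs →
    length (synth k bs as) ≡ k ×
    ∃ λ r → length r ≡ length bs × ⟦ as ⟧ʳ ≋ ((⟦ synth k bs as ⟧ʳ *ₚ (⟦ bs ⟧ʳ +ₚ X^ length bs)) +ₚ ⟦ r ⟧ʳ)
  synth-correct zero    bs as       e = ≡.refl , as , e , ≋-refl
  synth-correct (suc k) bs (a ∷ as) e with subLead-correct a bs as bs≤as
    where
    length-as : length as ≡ k ℕ.+ length bs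
    length-as = ℕ.suc-injective e
    bs≤as : length bs ≤ length as
    bs≤as = ≡.subst (length bs ≤_) (≡.sym length-as) (ℕ.m≤n+m (length bs) k)
  ... | length-s , ⟦s⟧ʳ with synth-correct k bs (subLead a bs as) (≡.trans length-s (ℕ.suc-injective e))
  ...   | length-q , r , length-r , ⟦s⟧ʳ≋ = ≡.cong suc length-q , r , length-r , (begin
    ⟦ a ∷ as ⟧ʳ
      ≈⟨ ⟦∷⟧ʳ a as ⟩
    ⟦ as ⟧ʳ +ₚ (X^ length as *ₚ â)
      ≈⟨ +ₚ-cong ⟦as⟧ʳ (*ₚ-congʳ â X^as≋) ⟩
    (⟦ s ⟧ʳ +ₚ ((â *ₚ X^ k) *ₚ ⟦ bs ⟧ʳ)) +ₚ ((X^ k *ₚ X^bs) *ₚ â)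
      ≈⟨ +ₚ-congʳ _ (+ₚ-congʳ _ ⟦s⟧ʳ≋) ⟩
    (((⟦ q ⟧ʳ *ₚ B) +ₚ ⟦ r ⟧ʳ) +ₚ ((â *ₚ X^ k) *ₚ ⟦ bs ⟧ʳ)) +ₚ ((X^ k *ₚ X^bs) *ₚ â)
      ≈⟨ PSolver.solve 6 (λ q rb pb r ka pk →
           ((q :* (rb :+ pb) :+ r) :+ (ka :* pk) :* rb) :+ (pk :* pb) :* ka := (q :+ pk :* ka) :* (rb :+ pb) :+ r)
           ≋-refl ⟦ q ⟧ʳ ⟦ bs ⟧ʳ X^bs ⟦ r ⟧ʳ â (X^ k) ⟩
    ((⟦ q ⟧ʳ +ₚ (X^ k *ₚ â)) *ₚ B) +ₚ ⟦ r ⟧ʳ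
      ≈⟨ +ₚ-congʳ ⟦ r ⟧ʳ (*ₚ-congʳ B (≋-sym (≋-trans (⟦∷⟧ʳ a q)
           (+ₚ-congˡ ⟦ q ⟧ʳ (*ₚ-congʳ â (≋-reflexive (≡.cong X^_ length-q))))))) ⟩
    (⟦ a ∷ q ⟧ʳ *ₚ B) +ₚ ⟦ r ⟧ʳ ∎)
    where
    length-as : length as ≡ k ℕ.+ length bs
    length-as = ℕ.suc-injective e
    s = subLead a bs as
    q = synth k bs s
    â = const (fromℤ a)
    X^bs = X^ length bs
    B = ⟦ bs ⟧ʳ +ₚ X^bs
    X^as≋ : X^ length as ≋ (X^ k *ₚ X^bs)
    X^as≋ = ≋-trans (≋-reflexive (≡.cong X^_ length-as)) (X^-+ k (length bs))
    ⟦as⟧ʳ : ⟦ as ⟧ʳ ≋ (⟦ s ⟧ʳ +ₚ ((â *ₚ X^ k) *ₚ ⟦ bs ⟧ʳ))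
    ⟦as⟧ʳ = begin
      ⟦ as ⟧ʳ                   ≈⟨ PSolver.solve 2 (λ x y → x := (x :- y) :+ y) ≋-refl ⟦ as ⟧ʳ T ⟩
      (⟦ as ⟧ʳ −ₚ T) +ₚ T
        ≈⟨ +ₚ-cong (≋-sym ⟦s⟧ʳ) (*ₚ-congʳ ⟦ bs ⟧ʳ (*ₚ-congˡ â (≋-reflexive (≡.cong X^_ d≡k)))) ⟩
      ⟦ s ⟧ʳ +ₚ ((â *ₚ X^ k) *ₚ ⟦ bs ⟧ʳ) ∎
      where
      T = (â *ₚ X^ (length as ∸ length bs)) *ₚ ⟦ bs ⟧ʳ
      d≡k : length as ∸ length bs ≡ k
      d≡k = ≡.trans (≡.cong (_∸ length bs) length-as) (ℕ.m+n∸n≡m k (length bs))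

  MonicZ : List ℤ → Set
  MonicZ P = ∃ λ P₀ → P ≡ P₀ ++ (+ 1 ∷ [])

  private
    addZ-identityʳ : ∀ P → addZ P [] ≡ P
    addZ-identityʳ []      = ≡.refl
    addZ-identityʳ (x ∷ P) = ≡.refl

    map-1* : ∀ P → map (+ 1 ℤ.*_) P ≡ P
    map-1* []      = ≡.refl
    map-1* (x ∷ P) = ≡.cong₂ _∷_ (ℤ.*-identityˡ x) (map-1* P)

    length-addZ : ∀ P Q → length P ≤ length Q → length (addZ P Q) ≡ length Q
    length-addZ []      Q       _         = ≡.refl
    length-addZ (x ∷ P) (y ∷ Q) (s≤s P≤Q) = ≡.cong suc (length-addZ P Q P≤Q)

    addZ-++ : ∀ P Q₀ → length P ≤ length Q₀ → addZ P (Q₀ ++ (+ 1 ∷ [])) ≡ addZ P Q₀ ++ (+ 1 ∷ [])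
    addZ-++ []      Q₀       _         = ≡.refl
    addZ-++ (x ∷ P) (y ∷ Q₀) (s≤s P≤Q) = ≡.cong ((x ℤ.+ y) ∷_) (addZ-++ P Q₀ P≤Q)

    mulZ-monic : ∀ P₀ Q₀ → ∃ λ W₀ → length W₀ ≡ length P₀ ℕ.+ length Q₀ ×
                 mulZ (P₀ ++ (+ 1 ∷ [])) (Q₀ ++ (+ 1 ∷ [])) ≡ W₀ ++ (+ 1 ∷ [])
    mulZ-monic []       []       = [] , ≡.refl , ≡.refl
    mulZ-monic []       (q ∷ Q₀) = q ∷ Q₀ , ≡.refl ,
      ≡.cong₂ _∷_ (≡.trans (ℤ.+-identityʳ _) (ℤ.*-identityˡ q))
                  (≡.trans (addZ-identityʳ _) (map-1* (Q₀ ++ (+ 1 ∷ []))))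
    mulZ-monic (p ∷ P₀) Q₀ with mulZ-monic P₀ Q₀
    ... | W₀ , length-W₀ , eq =
      addZ pQ (+ 0 ∷ W₀) , ≡.trans (length-addZ pQ (+ 0 ∷ W₀) pQ≤) (≡.cong suc length-W₀) ,
      ≡.trans (≡.cong (λ z → addZ pQ (+ 0 ∷ z)) eq) (addZ-++ pQ (+ 0 ∷ W₀) pQ≤)
      where
      Q = Q₀ ++ (+ 1 ∷ [])
      pQ = map (p ℤ.*_) Q
      length-pQ : length pQ ≡ suc (length Q₀)
      length-pQ = ≡.trans (List.length-map _ Q) (≡.trans (List.length-++ Q₀) (ℕ.+-comm (length Q₀) 1))
      pQ≤ : length pQ ≤ length (+ 0 ∷ W₀)
      pQ≤ = ≡.subst₂ _≤_ (≡.sym length-pQ) (≡.cong suc (≡.sym length-W₀)) (s≤s (ℕ.m≤n+m (length Q₀) (length P₀)))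

  MonicZ-mulZ : ∀ {P Q} → MonicZ P → MonicZ Q → MonicZ (mulZ P Q)
  MonicZ-mulZ (P₀ , ≡.refl) (Q₀ , ≡.refl) with mulZ-monic P₀ Q₀
  ... | W₀ , _ , eq = W₀ , eq

  MonicZ-product : ∀ Ps → All MonicZ Ps → MonicZ (foldr mulZ (+ 1 ∷ []) Ps)
  MonicZ-product []       []       = [] , ≡.refl
  MonicZ-product (P ∷ Ps) (m ∷ ms) = MonicZ-mulZ m (MonicZ-product Ps ms)

  divMonic-monic : ∀ A B₀ → divMonic A (B₀ ++ (+ 1 ∷ [])) ≡ reverse (synth (length A ∸ length B₀) (reverse B₀) (reverse A))
  divMonic-monic A B₀ = ≡.cong₂ (λ k bs → reverse (synth k bs (reverse A)))
    (≡.cong (length A ∸_) (≡.trans (≡.cong (_∸ 1) (List.length-++ B₀)) (ℕ.m+n∸n≡m (length B₀) 1)))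
    (≡.cong (drop 1) (List.reverse-++ B₀ (+ 1 ∷ [])))

  ⟦monic⟧ : ∀ B₀ → ⟦ B₀ ++ (+ 1 ∷ []) ⟧ ≋ (⟦ B₀ ⟧ +ₚ X^ length B₀)
  ⟦monic⟧ B₀ = begin
    ⟦ B₀ ++ (+ 1 ∷ []) ⟧                           ≡⟨ List.map-++ fromℤ B₀ (+ 1 ∷ []) ⟩
    ⟦ B₀ ⟧ ++ const (fromℤ (+ 1))                  ≈⟨ ++≋+ₚshift ⟦ B₀ ⟧ _ ⟩
    ⟦ B₀ ⟧ +ₚ shift (length ⟦ B₀ ⟧) (const (fromℤ (+ 1)))
      ≈⟨ +ₚ-congˡ ⟦ B₀ ⟧ (≋-trans (≋-reflexive (≡.cong (λ n → shift n _) (List.length-map fromℤ B₀)))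
           (≋-trans (shift≋X^*ₚ (length B₀) _)
             (≋-trans (*ₚ-congˡ (X^ length B₀) (const-cong fromℤ-1)) (*ₚ-identityʳ _)))) ⟩
    ⟦ B₀ ⟧ +ₚ X^ length B₀                         ∎

  divMonic-remainder : ∀ A B₀ → length B₀ ≤ length A → ∃ λ r → length r ≡ length B₀ ×
    ⟦ A ⟧ ≋ ((⟦ divMonic A (B₀ ++ (+ 1 ∷ [])) ⟧ *ₚ ⟦ B₀ ++ (+ 1 ∷ []) ⟧) +ₚ ⟦ r ⟧)
  divMonic-remainder A B₀ B₀≤A with synth-correct k (reverse B₀) (reverse A) length-revA
    where
    k = length A ∸ length B₀
    length-revA : length (reverse A) ≡ k ℕ.+ length (reverse B₀)
    length-revA = ≡.trans (List.length-reverse A)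
      (≡.trans (≡.sym (ℕ.m∸n+n≡m B₀≤A)) (≡.cong (k ℕ.+_) (≡.sym (List.length-reverse B₀))))
  ... | _ , r , length-r , ⟦A⟧ʳ = reverse r ,
    ≡.trans (List.length-reverse r) (≡.trans length-r (List.length-reverse B₀)) , (begin
    ⟦ A ⟧                                  ≡⟨ ≡.cong ⟦_⟧ (≡.sym (List.reverse-involutive A)) ⟩
    ⟦ reverse A ⟧ʳ                         ≈⟨ ⟦A⟧ʳ ⟩
    (⟦ q ⟧ʳ *ₚ (⟦ reverse B₀ ⟧ʳ +ₚ X^ length (reverse B₀))) +ₚ ⟦ r ⟧ʳ
      ≈⟨ +ₚ-congʳ ⟦ r ⟧ʳ (*ₚ-cong (≋-reflexive (≡.cong ⟦_⟧ (≡.sym (divMonic-monic A B₀))))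
           (≋-trans (+ₚ-cong (≋-reflexive (≡.cong ⟦_⟧ (List.reverse-involutive B₀)))
                             (≋-reflexive (≡.cong X^_ (List.length-reverse B₀))))
                    (≋-sym (⟦monic⟧ B₀)))) ⟩
    (⟦ divMonic A (B₀ ++ (+ 1 ∷ [])) ⟧ *ₚ ⟦ B₀ ++ (+ 1 ∷ []) ⟧) +ₚ ⟦ reverse r ⟧ ∎)
    where
    q = synth (length A ∸ length B₀) (reverse B₀) (reverse A)

  divMonic-exact : ∀ A B₀ → length B₀ ≤ length A → ⟦ B₀ ++ (+ 1 ∷ []) ⟧ ∣ₓ ⟦ A ⟧ →
                   ⟦ A ⟧ ≋ (⟦ B₀ ++ (+ 1 ∷ []) ⟧ *ₚ ⟦ divMonic A (B₀ ++ (+ 1 ∷ [])) ⟧)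
  divMonic-exact A B₀ B₀≤A (divₓ G BG≋A) with divMonic-remainder A B₀ B₀≤A
  ... | r , length-r , A≋QB+r = begin
    ⟦ A ⟧                 ≈⟨ A≋QB+r ⟩
    (Q *ₚ B) +ₚ ⟦ r ⟧     ≈⟨ +ₚ-congˡ (Q *ₚ B) r≋[] ⟩
    (Q *ₚ B) +ₚ []        ≈⟨ +ₚ-identityʳ _ ⟩
    Q *ₚ B                ≈⟨ *ₚ-comm Q B ⟩
    B *ₚ Q                ∎
    where
    B = ⟦ B₀ ++ (+ 1 ∷ []) ⟧
    Q = ⟦ divMonic A (B₀ ++ (+ 1 ∷ [])) ⟧
    B*[G−Q]≋r : (B *ₚ (G −ₚ Q)) ≋ ⟦ r ⟧
    B*[G−Q]≋r = begin
      B *ₚ (G −ₚ Q)                ≈⟨ PSolver.solve 3 (λ b g q → b :* (g :- q) := b :* g :- q :* b) ≋-refl B G Q ⟩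
      (B *ₚ G) −ₚ (Q *ₚ B)         ≈⟨ +ₚ-congʳ (-ₚ (Q *ₚ B)) (≋-trans BG≋A A≋QB+r) ⟩
      ((Q *ₚ B) +ₚ ⟦ r ⟧) −ₚ (Q *ₚ B) ≈⟨ PSolver.solve 2 (λ x y → (x :+ y) :- x := y) ≋-refl (Q *ₚ B) ⟦ r ⟧ ⟩
      ⟦ r ⟧                        ∎
    r-small : DegreeBelow (length ⟦ B₀ ⟧) ⟦ r ⟧
    r-small k p = reflexive (coeff-≥length ⟦ r ⟧ k (≡.subst (_≤ k) length-eq p))
      where
      length-eq : length ⟦ B₀ ⟧ ≡ length ⟦ r ⟧
      length-eq = ≡.trans (List.length-map fromℤ B₀)
                          (≡.trans (≡.sym length-r) (≡.sym (List.length-map fromℤ r)))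
    G−Q≋[] : (G −ₚ Q) ≋ []
    G−Q≋[] = monic-*ₚ-degreeBelow⇒≋[] ⟦ B₀ ⟧ (fromℤ (+ 1)) fromℤ-1 (G −ₚ Q) ⟦ r ⟧
      (≡.subst (λ P → (P *ₚ (G −ₚ Q)) ≋ ⟦ r ⟧) (List.map-++ fromℤ B₀ (+ 1 ∷ [])) B*[G−Q]≋r) r-small
    r≋[] : ⟦ r ⟧ ≋ []
    r≋[] = ≋-trans (≋-sym B*[G−Q]≋r) (≋-trans (*ₚ-congˡ B G−Q≋[]) (*ₚ-zeroʳ B))

  length-xPowMinus1 : ∀ m → length (xPowMinus1 (suc m)) ≡ suc (suc m)
  length-xPowMinus1 m = ≡.cong suc (≡.trans (List.length-++ (replicate m (+ 0)))
    (≡.trans (≡.cong (ℕ._+ 1) (List.length-replicate m)) (ℕ.+-comm m 1)))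

  monic∣ₓxPowMinus1⇒length≤ : ¬ (1# ≈ 0#) → ∀ m B₀ → ⟦ B₀ ++ (+ 1 ∷ []) ⟧ ∣ₓ ⟦ xPowMinus1 (suc m) ⟧ →
                               length B₀ ≤ suc m
  monic∣ₓxPowMinus1⇒length≤ 1≉0 m B₀ (divₓ G BG≋A) with length B₀ ℕ.≤? suc m
  ... | yes B₀≤ = B₀≤
  ... | no  B₀≰ = ⊥-elim (1≉0 (trans (sym leading)
                     (trans (sym (at BG≋A (suc m))) (at (≋-trans (*ₚ-congˡ B G≋[]) (*ₚ-zeroʳ B)) (suc m)))))
    where
    B = ⟦ B₀ ++ (+ 1 ∷ []) ⟧
    A = xPowMinus1 (suc m)
    leading : coeff ⟦ A ⟧ (suc m) ≈ 1#
    leading = trans (reflexive (≡.trans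
      (≡.cong (λ P → coeff P (suc m)) (List.map-++ fromℤ ((-[1+ 0 ] ℤ.+ + 0) ∷ replicate m (+ 0)) (+ 1 ∷ [])))
      (≡.trans (≡.cong (coeff (⟦ replicate m (+ 0) ⟧ ++ fromℤ (+ 1) ∷ []))
                       (≡.sym (≡.trans (List.length-map fromℤ (replicate m (+ 0))) (List.length-replicate m))))
               (coeff-last ⟦ replicate m (+ 0) ⟧ (fromℤ (+ 1)))))) fromℤ-1
    A-small : DegreeBelow (length ⟦ B₀ ⟧) ⟦ A ⟧
    A-small k p = reflexive (coeff-≥length ⟦ A ⟧ k (ℕ.≤-trans (ℕ.≤-reflexive length-⟦A⟧)
      (ℕ.≤-trans (ℕ.≰⇒> B₀≰) (ℕ.≤-trans (ℕ.≤-reflexive (≡.sym (List.length-map fromℤ B₀))) p))))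
      where
      length-⟦A⟧ : length ⟦ A ⟧ ≡ suc (suc m)
      length-⟦A⟧ = ≡.trans (List.length-map fromℤ A) (length-xPowMinus1 m)
    G≋[] : G ≋ []
    G≋[] = monic-*ₚ-degreeBelow⇒≋[] ⟦ B₀ ⟧ (fromℤ (+ 1)) fromℤ-1 G ⟦ A ⟧
      (≡.subst (λ P → (P *ₚ G) ≋ ⟦ A ⟧) (List.map-++ fromℤ B₀ (+ 1 ∷ [])) BG≋A) A-small

  MonicZ-divMonic-xPowMinus1 : ∀ m B₀ → length B₀ ≤ suc m → MonicZ (divMonic (xPowMinus1 (suc m)) (B₀ ++ (+ 1 ∷ [])))
  MonicZ-divMonic-xPowMinus1 m B₀ B₀≤ = reverse Z ,
    ≡.trans (divMonic-monic A B₀)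
      (≡.trans (≡.cong₂ (λ k as → reverse (synth k (reverse B₀) as)) fuel (List.reverse-++ L (+ 1 ∷ [])))
               (List.unfold-reverse (+ 1) Z))
    where
    L = (-[1+ 0 ] ℤ.+ + 0) ∷ replicate m (+ 0)
    A = xPowMinus1 (suc m)
    k = suc m ∸ length B₀
    fuel : length A ∸ length B₀ ≡ suc k
    fuel = ≡.trans (≡.cong (_∸ length B₀) (length-xPowMinus1 m)) (ℕ.+-∸-assoc 1 B₀≤)
    Z = synth k (reverse B₀) (subLead (+ 1) (reverse B₀) (reverse L))

module Cyclotomic {c ℓ} (R : CommutativeRing c ℓ) (isField : Over.IsField R) (charZero : Over.CharZero R) where
  open import Data.Nat as ℕ using (ℕ; zero; suc; _≤_; _<_; z≤n; s≤s; _∸_; NonZero)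
  import Data.Nat.Properties as ℕ
  open import Data.Nat.Induction using (<-rec)
  open import Data.Nat.Divisibility as ℕ∣ using (_∣?_) renaming (_∣_ to _∣ℕ_)
  open import Data.Nat.GCD using (gcd; gcd[m,n]∣m; gcd[m,n]∣n)
  open import Data.Integer as ℤ using (+_; -[1+_])
  open import Data.Bool using (Bool; true; false; _∧_; not; if_then_else_)
  import Data.Bool.Properties as Bool
  open import Data.List using (List; []; _∷_; map; foldr; upTo; length; _++_; replicate)
  import Data.List.Properties as List
  open import Data.List.Relation.Unary.All as All using (All; []; _∷_)
  import Data.List.Relation.Unary.All.Properties as All
  open import Data.Product using (∃; ∃₂; _,_; proj₁; proj₂; _×_)
  open import Data.Sum using (inj₁; inj₂)
  open import Data.Empty using (⊥-elim)
  open import Function.Base using (_$_; id)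
  open import Relation.Nullary using (¬_; yes; no; does)
  open import Relation.Nullary.Decidable using (dec-true; dec-false)
  open import Relation.Binary.PropositionalEquality using (_≡_; _≢_)
  import Relation.Binary.PropositionalEquality as ≡

  open CommutativeRing R hiding (zero)
  open Over R using (fromℕ; fromℤ)
  open PolynomialArithmetic R
  open FormalDerivative R using (Xⁿ−1-squarefree)
  open PowersMinusOne R
  open RangeProducts R
  open IntegerPolynomials R
  open DefsInternals using (cycloAux)
  open PSolver using (_:+_; _:*_; _:=_)
  open ≋-Reasoning

  Φ : ℕ → Poly
  Φ d = ⟦ cyclotomic d ⟧

  divisorOf : ℕ → ℕ → Bool
  divisorOf m d = does (d ∣? m)

  -- The invariant of the strong induction showing that Defs computes the cyclotomic polynomials.
  Correct : ℕ → Set ℓ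
  Correct m = MonicZ (cyclotomic m) × Xⁿ−1 m ≋ prodRange m (divisorOf m) Φ

  CorrectBelow : ℕ → Set ℓ
  CorrectBelow m = ∀ d → 1 ≤ d → d < m → Correct d

  private
    nonZero : ∀ {n} → 1 ≤ n → NonZero n
    nonZero {suc n} _ = _

  fromℕ-invertible : ∀ n → 1 ≤ n → ∃ λ y → fromℕ n * y ≈ 1#
  fromℕ-invertible (suc n) _ = proj₂ isField (fromℕ (suc n)) (charZero n)

  properDivisors-bounds : ∀ m → All (λ d → (1 ≤ d × d ≤ m ∸ 1) × d ∣ℕ m) (properDivisors m)
  properDivisors-bounds m = All.zip (All.filter⁺ (_∣? m) range-bounds , All.all-filter (_∣? m) (map suc (upTo (m ∸ 1))))
    where
    range-bounds : All (λ d → 1 ≤ d × d ≤ m ∸ 1) (map suc (upTo (m ∸ 1)))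
    range-bounds = All.map⁺ (All.applyUpTo⁺₁ id (m ∸ 1) (λ i<m → s≤s z≤n , i<m))

  cycloAux-fuel-irrelevant : ∀ f g d → 1 ≤ d → d ≤ f → d ≤ g → cycloAux f d ≡ cycloAux g d
  cycloAux-fuel-irrelevant zero    g       zero () z≤n _
  cycloAux-fuel-irrelevant (suc f) zero    zero () _   z≤n
  cycloAux-fuel-irrelevant (suc f) (suc g) d  _  d≤f d≤g =
    ≡.cong (λ L → divMonic (xPowMinus1 d) (foldr mulZ (+ 1 ∷ []) L))
      (List.map-cong-local (All.map (λ { ((1≤e , e≤d∸1) , _) →
        cycloAux-fuel-irrelevant f g _ 1≤e (ℕ.≤-trans e≤d∸1 (pred≤ d≤f)) (ℕ.≤-trans e≤d∸1 (pred≤ d≤g)) })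
        (properDivisors-bounds d)))
    where
    pred≤ : ∀ {d f} → d ≤ suc f → d ∸ 1 ≤ f
    pred≤ {zero}  _       = z≤n
    pred≤ {suc d} (s≤s p) = p

  cyclotomic-unfold : ∀ m → cyclotomic (suc m) ≡
    divMonic (xPowMinus1 (suc m)) (foldr mulZ (+ 1 ∷ []) (map cyclotomic (properDivisors (suc m))))
  cyclotomic-unfold m = ≡.cong (λ L → divMonic (xPowMinus1 (suc m)) (foldr mulZ (+ 1 ∷ []) L))
    (List.map-cong-local (All.map (λ { ((1≤e , e≤m) , _) → cycloAux-fuel-irrelevant m _ _ 1≤e e≤m ℕ.≤-refl })
      (properDivisors-bounds (suc m))))

  divisorOf-refl : ∀ d → divisorOf d d ≡ true
  divisorOf-refl d = dec-true (d ∣? d) ℕ∣.∣-refl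

  divisorOf⇒∣ : ∀ m d → divisorOf m d ≡ true → d ∣ℕ m
  divisorOf⇒∣ m d e with d ∣? m
  ... | yes d∣m = d∣m

  divisorOf-∧ : ∀ {d g} x → g ∣ℕ d → (divisorOf d x ∧ divisorOf g x) ≡ divisorOf g x
  divisorOf-∧ {d} {g} x g∣d with x ∣? g
  ... | yes x∣g = ≡.cong (_∧ true) (dec-true (x ∣? d) (ℕ∣.∣-trans x∣g g∣d))
  ... | no  _   = Bool.∧-zeroʳ (divisorOf d x)

  Φ-at : ∀ m → divisorOf m m ≡ true → Φ m ≋ factorIf (divisorOf m) Φ m
  Φ-at m e = ≋-reflexive (≡.cong (λ b → if b then Φ m else const 1#) (≡.sym e))

  Φ∣ₓXⁿ−1 : ∀ d → 1 ≤ d → Correct d → Φ d ∣ₓ Xⁿ−1 d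
  Φ∣ₓXⁿ−1 d 1≤d (_ , factorisation) =
    ∣ₓ-cong (≋-refl {Φ d}) (≋-sym factorisation) (factor∣ₓprodRange d (divisorOf d) Φ d 1≤d ℕ.≤-refl (divisorOf-refl d))

  prodRange-common-divisors : ∀ {d g} N → 1 ≤ g → g ≤ N → g ∣ℕ d → Correct g →
    prodRange N (λ x → divisorOf d x ∧ divisorOf g x) Φ ≋ Xⁿ−1 g
  prodRange-common-divisors {d} {g} N 1≤g g≤N g∣d (_ , factorisation) = begin
    prodRange N (λ x → divisorOf d x ∧ divisorOf g x) Φ
      ≈⟨ prodRange-cong N (λ x _ _ → divisorOf-∧ x g∣d) (λ _ _ _ _ → ≋-refl) ⟩
    prodRange N (divisorOf g) Φ
      ≈⟨ ≋-sym (prodRange-extend g N (divisorOf g) Φ g≤N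
           (λ x g<x → dec-false (x ∣? g) (λ x∣g → ℕ.<⇒≱ g<x (ℕ∣.∣⇒≤ ⦃ nonZero 1≤g ⦄ x∣g)))) ⟩
    prodRange g (divisorOf g) Φ
      ≈⟨ ≋-sym factorisation ⟩
    Xⁿ−1 g ∎

  Xⁿ−1-split : ∀ d g → 1 ≤ g → g < d → g ∣ℕ d → Correct d → Correct g →
               ∃ λ W → Xⁿ−1 d ≋ (Φ d *ₚ (Xⁿ−1 g *ₚ W))
  Xⁿ−1-split (suc d′) g 1≤g g<d g∣d (_ , factorisation) correct-g = W , (begin
    Xⁿ−1 d                                                    ≈⟨ factorisation ⟩
    prodRange d (divisorOf d) Φ                               ≈⟨ prodRange-suc d′ (divisorOf d) Φ ⟩
    prodRange d′ (divisorOf d) Φ *ₚ factorIf (divisorOf d) Φ d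
      ≈⟨ *ₚ-cong (prodRange-split d′ (divisorOf d) (divisorOf g) Φ) (≋-sym (Φ-at d (divisorOf-refl d))) ⟩
    (prodRange d′ (λ x → divisorOf d x ∧ divisorOf g x) Φ *ₚ W) *ₚ Φ d
      ≈⟨ *ₚ-congʳ (Φ d) (*ₚ-congʳ W (prodRange-common-divisors d′ 1≤g (ℕ.≤-pred g<d) g∣d correct-g)) ⟩
    (Xⁿ−1 g *ₚ W) *ₚ Φ d                                      ≈⟨ *ₚ-comm (Xⁿ−1 g *ₚ W) (Φ d) ⟩
    Φ d *ₚ (Xⁿ−1 g *ₚ W)                                      ∎)
    where
    d = suc d′
    W = prodRange d′ (λ x → divisorOf d x ∧ not (divisorOf g x)) Φ

  -- If g < d divides d, the squarefree identity for X^d − 1 = Φ_d (X^g − 1) W and a combination of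
  -- X^g − 1 from X^d − 1 and X^e − 1 combine into a combination of Φ_d and Φ_e equal to the unit d.
  Φ-coprime-via : ∀ d e g → 1 ≤ d → 1 ≤ e → 1 ≤ g → g < d → g ∣ℕ d → Correct d → Correct e → Correct g →
                  ∃₂ (λ U V → ((Xⁿ−1 d *ₚ U) +ₚ (Xⁿ−1 e *ₚ V)) ≋ Xⁿ−1 g) → Coprime (Φ d) (Φ e)
  Φ-coprime-via d e g 1≤d 1≤e 1≤g g<d g∣d correct-d correct-e correct-g (U₁ , V₁ , bezout) =
    U₂ +ₚ ((X′ *ₚ U₁) *ₚ V₂) , (Y *ₚ V₁) *ₚ V₂ , fromℕ d , proj₁ d-invertible , (begin
      (Φ d *ₚ (U₂ +ₚ ((X′ *ₚ U₁) *ₚ V₂))) +ₚ (Φ e *ₚ ((Y *ₚ V₁) *ₚ V₂))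
        ≈⟨ PSolver.solve 8 (λ pd u₂ x u₁ v₂ pe y v₁ →
             pd :* (u₂ :+ (x :* u₁) :* v₂) :+ pe :* ((y :* v₁) :* v₂)
               := pd :* u₂ :+ ((pd :* x) :* u₁ :+ (pe :* y) :* v₁) :* v₂)
             ≋-refl (Φ d) U₂ X′ U₁ V₂ (Φ e) Y V₁ ⟩
      (Φ d *ₚ U₂) +ₚ ((((Φ d *ₚ X′) *ₚ U₁) +ₚ ((Φ e *ₚ Y) *ₚ V₁)) *ₚ V₂)
        ≈⟨ +ₚ-congˡ (Φ d *ₚ U₂) (*ₚ-congʳ V₂ (≋-trans (+ₚ-cong (*ₚ-congʳ U₁ (factorisation Φd∣))
                                                               (*ₚ-congʳ V₁ (factorisation Φe∣))) bezout)) ⟩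
      (Φ d *ₚ U₂) +ₚ (Xⁿ−1 g *ₚ V₂)
        ≈⟨ squarefree ⟩
      const (fromℕ d) ∎) ,
    proj₂ d-invertible
    where
    d-invertible = fromℕ-invertible d 1≤d
    split = Xⁿ−1-split d g 1≤g g<d g∣d correct-d correct-g
    combination = Xⁿ−1-squarefree d (Φ d) (Xⁿ−1 g) (proj₁ split) (proj₂ split)
    U₂ = proj₁ combination
    V₂ = proj₁ (proj₂ combination)
    squarefree = proj₂ (proj₂ combination)
    Φd∣ = Φ∣ₓXⁿ−1 d 1≤d correct-d
    Φe∣ = Φ∣ₓXⁿ−1 e 1≤e correct-e
    X′ = cofactor Φd∣
    Y = cofactor Φe∣

  Φ-coprime : ∀ d e → 1 ≤ d → 1 ≤ e → Correct d → Correct e → CorrectBelow d → ¬ (d ∣ℕ e) → Coprime (Φ d) (Φ e)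
  Φ-coprime d e 1≤d 1≤e correct-d correct-e correct-below d∤e =
    Φ-coprime-via d e g 1≤d 1≤e 1≤g g<d g∣d correct-d correct-e (correct-below g 1≤g g<d) (Xⁿ−1-bezout d e)
    where
    g = gcd d e
    g∣d = gcd[m,n]∣m d e
    1≤g : 1 ≤ g
    1≤g = ℕ.n≢0⇒n>0 (λ g≡0 → ℕ.<⇒≢ 1≤d (≡.sym (ℕ∣.0∣⇒≡0 (≡.subst (_∣ℕ d) g≡0 g∣d))))
    g<d : g < d
    g<d with ℕ.m≤n⇒m<n∨m≡n (ℕ∣.∣⇒≤ ⦃ nonZero 1≤d ⦄ g∣d)
    ... | inj₁ g<d = g<d
    ... | inj₂ g≡d = ⊥-elim (d∤e (≡.subst (_∣ℕ e) g≡d (gcd[m,n]∣n d e)))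

  Φ-coprime-≢ : ∀ m → CorrectBelow m → ∀ d e → 1 ≤ d → 1 ≤ e → d < m → e < m → d ≢ e → Coprime (Φ d) (Φ e)
  Φ-coprime-≢ m correct d e 1≤d 1≤e d<m e<m d≢e with d ∣? e
  ... | no  d∤e = Φ-coprime d e 1≤d 1≤e (correct d 1≤d d<m) (correct e 1≤e e<m)
                    (λ x 1≤x x<d → correct x 1≤x (ℕ.<-trans x<d d<m)) d∤e
  ... | yes d∣e = Coprime-sym {Φ e} {Φ d} (Φ-coprime e d 1≤e 1≤d (correct e 1≤e e<m) (correct d 1≤d d<m)
                    (λ x 1≤x x<e → correct x 1≤x (ℕ.<-trans x<e e<m)) (λ e∣d → d≢e (ℕ∣.∣-antisym d∣e e∣d)))

  Φ-coprime-prodRange : ∀ m → CorrectBelow m → ∀ N e → 1 ≤ e → e < m → N < e →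
                        Coprime (Φ e) (prodRange N (divisorOf m) Φ)
  Φ-coprime-prodRange m correct zero    e 1≤e e<m N<e = Coprime-1 (Φ e)
  Φ-coprime-prodRange m correct (suc N) e 1≤e e<m N<e =
    Coprime-cong (≋-refl {Φ e}) (≋-sym (prodRange-suc N (divisorOf m) Φ)) (Coprime-*ₚ {Φ e} {prodRange N (divisorOf m) Φ} IH top)
    where
    IH = Φ-coprime-prodRange m correct N e 1≤e e<m (ℕ.<-trans (ℕ.n<1+n N) N<e)
    top : Coprime (Φ e) (factorIf (divisorOf m) Φ (suc N))
    top with divisorOf m (suc N)
    ... | true  = Φ-coprime-≢ m correct e (suc N) 1≤e (s≤s z≤n) e<m (ℕ.<-trans N<e e<m)
                    (λ e≡ → ℕ.<-irrefl (≡.sym e≡) N<e)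
    ... | false = Coprime-1 (Φ e)

  prodRange-Φ-∣ₓ : ∀ m → CorrectBelow m → ∀ C → (∀ d → 1 ≤ d → d < m → d ∣ℕ m → Φ d ∣ₓ C) →
                   ∀ N → N < m → prodRange N (divisorOf m) Φ ∣ₓ C
  prodRange-Φ-∣ₓ m correct C Φ∣C zero    _   = divₓ C (*ₚ-identityˡ C)
  prodRange-Φ-∣ₓ m correct C Φ∣C (suc N) N<m =
    ∣ₓ-cong (≋-sym (prodRange-suc N (divisorOf m) Φ)) (≋-refl {C}) (step (divisorOf m (suc N)) ≡.refl)
    where
    IH = prodRange-Φ-∣ₓ m correct C Φ∣C N (ℕ.<-trans (ℕ.n<1+n N) N<m)
    P = prodRange N (divisorOf m) Φ
    step : ∀ b → divisorOf m (suc N) ≡ b → (P *ₚ factorIf (divisorOf m) Φ (suc N)) ∣ₓ C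
    step true  e = ∣ₓ-cong (*ₚ-congˡ P (Φ-at′ e)) (≋-refl {C})
      (Coprime⇒*ₚ-∣ₓ IH (Φ∣C (suc N) (s≤s z≤n) N<m (divisorOf⇒∣ m (suc N) e))
        (Coprime-sym {Φ (suc N)} {P} (Φ-coprime-prodRange m correct N (suc N) (s≤s z≤n) N<m (ℕ.n<1+n N))))
      where
      Φ-at′ : divisorOf m (suc N) ≡ true → Φ (suc N) ≋ factorIf (divisorOf m) Φ (suc N)
      Φ-at′ e = ≋-reflexive (≡.cong (λ b → if b then Φ (suc N) else const 1#) (≡.sym e))
    step false e = ∣ₓ-cong (≋-trans (≋-sym (*ₚ-identityʳ P)) (*ₚ-congˡ P (≋-reflexive
      (≡.cong (λ b → if b then Φ (suc N) else const 1#) (≡.sym e))))) (≋-refl {C}) IH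

  correct-step : ∀ m → CorrectBelow (suc m) → Correct (suc m)
  correct-step m correct = ≡.subst MonicZ (≡.sym cyclotomic≡) (MonicZ-divMonic-xPowMinus1 m B₀ length≤) , (begin
    Xⁿ−1 (suc m)                                     ≈⟨ ≋-sym (⟦xPowMinus1⟧ (suc m)) ⟩
    ⟦ A ⟧                                            ≈⟨ divMonic-exact A B₀ length≤′ B∣A ⟩
    ⟦ B₀ ++ (+ 1 ∷ []) ⟧ *ₚ ⟦ divMonic A (B₀ ++ (+ 1 ∷ [])) ⟧
      ≈⟨ *ₚ-cong (≋-trans (≋-reflexive (≡.cong ⟦_⟧ (≡.sym B≡))) ⟦B⟧)
                 (≋-reflexive (≡.cong ⟦_⟧ (≡.sym cyclotomic≡))) ⟩
    prodRange m (divisorOf (suc m)) Φ *ₚ Φ (suc m)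
      ≈⟨ *ₚ-congˡ (prodRange m (divisorOf (suc m)) Φ) (Φ-at (suc m) (divisorOf-refl (suc m))) ⟩
    prodRange m (divisorOf (suc m)) Φ *ₚ factorIf (divisorOf (suc m)) Φ (suc m)
      ≈⟨ ≋-sym (prodRange-suc m (divisorOf (suc m)) Φ) ⟩
    prodRange (suc m) (divisorOf (suc m)) Φ ∎)
    where
    A = xPowMinus1 (suc m)
    L = properDivisors (suc m)
    B = foldr mulZ (+ 1 ∷ []) (map cyclotomic L)
    B-monic : MonicZ B
    B-monic = MonicZ-product (map cyclotomic L)
      (All.map⁺ (All.map (λ { ((1≤d , d≤m) , _) → proj₁ (correct _ 1≤d (s≤s d≤m)) }) (properDivisors-bounds (suc m))))
    B₀ = proj₁ B-monic
    B≡ : B ≡ B₀ ++ (+ 1 ∷ [])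
    B≡ = proj₂ B-monic
    ⟦B⟧ : ⟦ B ⟧ ≋ prodRange m (divisorOf (suc m)) Φ
    ⟦B⟧ = ≋-trans (⟦foldr-mulZ⟧ (map cyclotomic L))
      (≋-trans (≋-reflexive (≡.cong prodₚ (≡.sym (List.map-∘ L)))) (prodₚ-filter (_∣? suc m) Φ (map suc (upTo m))))
    B∣A : ⟦ B₀ ++ (+ 1 ∷ []) ⟧ ∣ₓ ⟦ A ⟧
    B∣A = ∣ₓ-cong (≋-trans (≋-sym ⟦B⟧) (≋-reflexive (≡.cong ⟦_⟧ B≡))) (≋-sym (⟦xPowMinus1⟧ (suc m)))
      (prodRange-Φ-∣ₓ (suc m) correct (Xⁿ−1 (suc m))
        (λ d 1≤d d<m d∣m → ∣ₓ-trans (Φ∣ₓXⁿ−1 d 1≤d (correct d 1≤d d<m)) (Xⁿ−1-∣ₓ d (suc m) d∣m))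
        m ℕ.≤-refl)
    length≤ : length B₀ ≤ suc m
    length≤ = monic∣ₓxPowMinus1⇒length≤ (proj₁ isField) m B₀ B∣A
    length≤′ : length B₀ ≤ length A
    length≤′ = ℕ.≤-trans length≤ (ℕ.≤-trans (ℕ.n≤1+n (suc m)) (ℕ.≤-reflexive (≡.sym (length-xPowMinus1 m))))
    cyclotomic≡ : cyclotomic (suc m) ≡ divMonic A (B₀ ++ (+ 1 ∷ []))
    cyclotomic≡ = ≡.trans (cyclotomic-unfold m) (≡.cong (divMonic A) B≡)

  correct : ∀ m → 1 ≤ m → Correct m
  correct = <-rec (λ m → 1 ≤ m → Correct m) λ where
    zero    rec ()
    (suc m) rec _ → correct-step m (λ d 1≤d d<m → rec d<m 1≤d)

  Xⁿ−1-cancelˡ : ∀ h → 1 ≤ h → ∀ P Q → (Xⁿ−1 h *ₚ P) ≋ (Xⁿ−1 h *ₚ Q) → P ≋ Q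
  Xⁿ−1-cancelˡ (suc h) _ P Q e =
    monic-cancelˡ ⟦ L ⟧ (fromℤ (+ 1)) (IntegerEmbedding.fromℤ-1 R) P Q
      (≡.subst (λ Z → (Z *ₚ P) ≋ (Z *ₚ Q)) (List.map-++ fromℤ L (+ 1 ∷ []))
        (≋-trans (*ₚ-congʳ P (⟦xPowMinus1⟧ (suc h))) (≋-trans e (*ₚ-congʳ Q (≋-sym (⟦xPowMinus1⟧ (suc h)))))))
    where
    L = (-[1+ 0 ] ℤ.+ + 0) ∷ replicate h (+ 0)

  Φ∣ₓgeometric : ∀ M h p → 1 ≤ h → h < M → M ≡ h ℕ.* p → Φ M ∣ₓ geometric h p
  Φ∣ₓgeometric M h p 1≤h h<M M≡hp = divₓ (cofactor Φ∣rest) $ ≋-sym (Xⁿ−1-cancelˡ h 1≤h _ _ (begin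
    Xⁿ−1 h *ₚ geometric h p                         ≈⟨ ≋-sym (Xⁿ−1-*-geometric h p) ⟩
    Xⁿ−1 (h ℕ.* p)                                  ≡⟨ ≡.cong Xⁿ−1 (≡.sym M≡hp) ⟩
    Xⁿ−1 M                                          ≈⟨ proj₂ (correct M 1≤M) ⟩
    prodRange M (divisorOf M) Φ                     ≈⟨ prodRange-split M (divisorOf M) (divisorOf h) Φ ⟩
    prodRange M (λ x → divisorOf M x ∧ divisorOf h x) Φ *ₚ rest
      ≈⟨ *ₚ-cong (prodRange-common-divisors M 1≤h (ℕ.<⇒≤ h<M) h∣M (correct h 1≤h)) (≋-sym (factorisation Φ∣rest)) ⟩
    Xⁿ−1 h *ₚ (Φ M *ₚ cofactor Φ∣rest)              ∎))
    where
    1≤M : 1 ≤ M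
    1≤M = ℕ.≤-trans 1≤h (ℕ.<⇒≤ h<M)
    h∣M : h ∣ℕ M
    h∣M = ℕ∣.divides p (≡.trans M≡hp (ℕ.*-comm h p))
    rest = prodRange M (λ x → divisorOf M x ∧ not (divisorOf h x)) Φ
    Φ∣rest : Φ M ∣ₓ rest
    Φ∣rest = factor∣ₓprodRange M _ Φ M 1≤M ℕ.≤-refl (≡.cong₂ _∧_ (divisorOf-refl M)
      (≡.cong not (dec-false (M ∣? h) (λ M∣h → ℕ.<⇒≱ h<M (ℕ∣.∣⇒≤ ⦃ nonZero 1≤h ⦄ M∣h)))))

  Xⁿ−1∣ₓ*ₚΦ : ∀ M → 1 ≤ M → ∀ C → (∀ d → 1 ≤ d → d < M → d ∣ℕ M → Φ d ∣ₓ C) →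
              Xⁿ−1 M ∣ₓ (C *ₚ Φ M)
  Xⁿ−1∣ₓ*ₚΦ (suc M) 1≤M C Φ∣C = ∣ₓ-cong (≋-sym Xⁿ−1≋) (≋-refl {C *ₚ Φ (suc M)})
    (*ₚ-mono-∣ₓ (prodRange-Φ-∣ₓ (suc M) (λ d 1≤d _ → correct d 1≤d) C Φ∣C M ℕ.≤-refl) ∣ₓ-refl)
    where
    Xⁿ−1≋ : Xⁿ−1 (suc M) ≋ (prodRange M (divisorOf (suc M)) Φ *ₚ Φ (suc M))
    Xⁿ−1≋ = ≋-trans (proj₂ (correct (suc M) 1≤M)) (≋-trans (prodRange-suc M (divisorOf (suc M)) Φ)
      (*ₚ-congˡ (prodRange M (divisorOf (suc M)) Φ) (≋-sym (Φ-at (suc M) (divisorOf-refl (suc M))))))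

module PrimePowerProducts where
  open import Data.Nat as ℕ using (ℕ; zero; suc; _≤_; _<_; z≤n; s≤s; _^_; _*_; _+_)
  import Data.Nat.Properties as ℕ
  open import Data.Nat.Divisibility as ℕ∣ using (_∣_; divides)
  open import Data.Nat.Primality using (Prime; euclidsLemma; prime⇒irreducible; prime⇒nonZero; prime⇒nonTrivial)
  open import Data.Nat.Coprimality using (Coprime; coprime-divisor)
  open import Data.Fin using (Fin; zero; suc)
  import Data.Fin.Properties as Fin
  open import Data.List using (foldr; map)
  import Data.List.Properties as List
  open import Data.Product using (∃; _,_; _×_)
  open import Data.Sum using (inj₁; inj₂)
  open import Data.Empty using (⊥-elim)
  open import Function.Base using (_∘_)
  open import Relation.Nullary using (¬_)
  open import Relation.Binary.PropositionalEquality using (_≡_)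
  import Relation.Binary.PropositionalEquality as ≡

  prodFin-suc : ∀ {K} (g : Fin (suc K) → ℕ) → prodFin g ≡ g zero * prodFin (g ∘ suc)
  prodFin-suc g = ≡.cong (λ L → g zero * foldr _*_ 1 L)
    (≡.trans (List.map-tabulate suc g) (≡.sym (List.map-tabulate (λ x → x) (g ∘ suc))))

  sumFin-suc : ∀ {K} (g : Fin (suc K) → ℕ) → sumFin g ≡ g zero + sumFin (g ∘ suc)
  sumFin-suc g = ≡.cong (λ L → g zero + foldr _+_ 0 L)
    (≡.trans (List.map-tabulate suc g) (≡.sym (List.map-tabulate (λ x → x) (g ∘ suc))))

  prime⇒1<p : ∀ {r} → Prime r → 1 < r
  prime⇒1<p {r} pr = ℕ.nonTrivial⇒n>1 r ⦃ prime⇒nonTrivial pr ⦄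

  prime∣prime⇒≡ : ∀ {r s} → Prime r → Prime s → r ∣ s → r ≡ s
  prime∣prime⇒≡ pr ps r∣s with prime⇒irreducible ps r∣s
  ... | inj₁ r≡1 = ⊥-elim (ℕ.<⇒≢ (prime⇒1<p pr) (≡.sym r≡1))
  ... | inj₂ r≡s = r≡s

  prime∣^⇒≡ : ∀ {r s} k → Prime r → Prime s → r ∣ s ^ k → r ≡ s
  prime∣^⇒≡ zero    pr ps r∣1 = ⊥-elim (ℕ.<⇒≢ (prime⇒1<p pr) (≡.sym (ℕ∣.∣1⇒≡1 r∣1)))
  prime∣^⇒≡ {s = s} (suc k) pr ps r∣s^k+1 with euclidsLemma s (s ^ k) pr r∣s^k+1
  ... | inj₁ r∣s   = prime∣prime⇒≡ pr ps r∣s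
  ... | inj₂ r∣s^k = prime∣^⇒≡ k pr ps r∣s^k

  prime^∣*⇒∣ : ∀ {p} → Prime p → ∀ n d k → p ^ n ∣ d * k → ¬ (p ∣ k) → p ^ n ∣ d
  prime^∣*⇒∣ pr zero    d k _ _ = ℕ∣.1∣ d
  prime^∣*⇒∣ {p} pr (suc n) d k p^n+1∣dk p∤k with euclidsLemma d k pr (ℕ∣.∣-trans (ℕ∣.m∣m*n (p ^ n)) p^n+1∣dk)
  ... | inj₂ p∣k                 = ⊥-elim (p∤k p∣k)
  ... | inj₁ (divides d′ ≡.refl) = ≡.subst (_∣ d′ * p) (ℕ.*-comm (p ^ n) p) (ℕ∣.*-monoˡ-∣ p IH)
    where
    IH : p ^ n ∣ d′
    IH = prime^∣*⇒∣ pr n d′ k (ℕ∣.*-cancelˡ-∣ p ⦃ prime⇒nonZero pr ⦄ (≡.subst (p * p ^ n ∣_) reassoc p^n+1∣dk)) p∤k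
      where
      reassoc : d′ * p * k ≡ p * (d′ * k)
      reassoc = ≡.trans (≡.cong (_* k) (ℕ.*-comm d′ p)) (ℕ.*-assoc p d′ k)

  coprime-∣*^⇒∣ : ∀ {m p} → Coprime m p → ∀ a k → m ∣ a * p ^ k → m ∣ a
  coprime-∣*^⇒∣ c a zero    m∣a = ≡.subst (_ ∣_) (ℕ.*-identityʳ a) m∣a
  coprime-∣*^⇒∣ {m} {p} c a (suc k) m∣ = coprime-∣*^⇒∣ c a k (coprime-divisor c (≡.subst (m ∣_) reassoc m∣))
    where
    reassoc : a * (p * p ^ k) ≡ p * (a * p ^ k)
    reassoc = ≡.trans (≡.sym (ℕ.*-assoc a p (p ^ k))) (≡.trans (≡.cong (_* p ^ k) (ℕ.*-comm a p)) (ℕ.*-assoc p a (p ^ k)))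

  Distinct : ∀ {K} → (Fin K → ℕ) → Set
  Distinct p = ∀ i j → p i ≡ p j → i ≡ j

  private
    Distinct-suc : ∀ {K} {p : Fin (suc K) → ℕ} → Distinct p → Distinct (p ∘ suc)
    Distinct-suc distinct i j e = Fin.suc-injective (distinct (suc i) (suc j) e)

  modulusOf-suc : ∀ {K} (p n : Fin (suc K) → ℕ) → modulusOf p n ≡ p zero ^ n zero * modulusOf (p ∘ suc) (n ∘ suc)
  modulusOf-suc p n = prodFin-suc (λ i → p i ^ n i)

  1≤modulusOf : ∀ {K} (p n : Fin K → ℕ) → (∀ i → Prime (p i)) → 1 ≤ modulusOf p n
  1≤modulusOf {zero}  p n pr = s≤s z≤n
  1≤modulusOf {suc K} p n pr = ≡.subst (1 ≤_) (≡.sym (modulusOf-suc p n))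
    (ℕ.*-mono-≤ (ℕ.m^n>0 (p zero) ⦃ prime⇒nonZero (pr zero) ⦄ (n zero)) (1≤modulusOf (p ∘ suc) (n ∘ suc) (pr ∘ suc)))

  prime∣modulusOf⇒≡ : ∀ {K} (p n : Fin K → ℕ) → (∀ i → Prime (p i)) → ∀ {r} → Prime r → r ∣ modulusOf p n →
                      ∃ λ i → r ≡ p i
  prime∣modulusOf⇒≡ {zero}  p n pr pr′ r∣1 = ⊥-elim (ℕ.<⇒≢ (prime⇒1<p pr′) (≡.sym (ℕ∣.∣1⇒≡1 r∣1)))
  prime∣modulusOf⇒≡ {suc K} p n pr {r} pr′ r∣M
    with euclidsLemma (p zero ^ n zero) (modulusOf (p ∘ suc) (n ∘ suc)) pr′ (≡.subst (r ∣_) (modulusOf-suc p n) r∣M)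
  ... | inj₁ r∣q = zero , prime∣^⇒≡ (n zero) pr′ (pr zero) r∣q
  ... | inj₂ r∣M′ with prime∣modulusOf⇒≡ (p ∘ suc) (n ∘ suc) (pr ∘ suc) pr′ r∣M′
  ...   | i , r≡pi = suc i , r≡pi

  modulusOf-split : ∀ {K} (p n : Fin K → ℕ) → (∀ i → Prime (p i)) → Distinct p → ∀ j →
                    ∃ λ M′ → modulusOf p n ≡ p j ^ n j * M′ × ¬ (p j ∣ M′)
  modulusOf-split {suc K} p n pr distinct zero = modulusOf (p ∘ suc) (n ∘ suc) , modulusOf-suc p n , p₀∤M′
    where
    p₀∤M′ : ¬ (p zero ∣ modulusOf (p ∘ suc) (n ∘ suc))
    p₀∤M′ p₀∣ with prime∣modulusOf⇒≡ (p ∘ suc) (n ∘ suc) (pr ∘ suc) (pr zero) p₀∣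
    ... | i , e with distinct zero (suc i) e
    ...   | ()
  modulusOf-split {suc K} p n pr distinct (suc j)
    with modulusOf-split (p ∘ suc) (n ∘ suc) (pr ∘ suc) (Distinct-suc distinct) j
  ... | M″ , M≡ , pj∤M″ = q₀ * M″ ,
    ≡.trans (modulusOf-suc p n) (≡.trans (≡.cong (q₀ *_) M≡) (≡.trans (≡.sym (ℕ.*-assoc q₀ qⱼ M″))
      (≡.trans (≡.cong (_* M″) (ℕ.*-comm q₀ qⱼ)) (ℕ.*-assoc qⱼ q₀ M″)))) , pⱼ∤
    where
    q₀ = p zero ^ n zero
    qⱼ = p (suc j) ^ n (suc j)
    pⱼ∤ : ¬ (p (suc j) ∣ q₀ * M″)
    pⱼ∤ pⱼ∣ with euclidsLemma q₀ M″ (pr (suc j)) pⱼ∣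
    ... | inj₂ pⱼ∣M″ = pj∤M″ pⱼ∣M″
    ... | inj₁ pⱼ∣q₀ with distinct (suc j) zero (prime∣^⇒≡ (n zero) (pr (suc j)) (pr zero) pⱼ∣q₀)
    ...   | ()

  prime-powers-∣⇒modulusOf-∣ : ∀ {K} (p n : Fin K → ℕ) → (∀ i → Prime (p i)) → Distinct p →
                               ∀ z → (∀ j → p j ^ n j ∣ z) → modulusOf p n ∣ z
  prime-powers-∣⇒modulusOf-∣ {zero}  p n pr distinct z _ = ℕ∣.1∣ z
  prime-powers-∣⇒modulusOf-∣ {suc K} p n pr distinct z q∣z with q∣z zero
  ... | divides a ≡.refl = ≡.subst (_∣ a * q₀) (≡.sym (modulusOf-suc p n))
          (≡.subst (q₀ * M′ ∣_) (ℕ.*-comm q₀ a) (ℕ∣.*-monoʳ-∣ q₀ M′∣a))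
    where
    q₀ = p zero ^ n zero
    M′ = modulusOf (p ∘ suc) (n ∘ suc)
    M′∣aq₀ : M′ ∣ a * q₀
    M′∣aq₀ = prime-powers-∣⇒modulusOf-∣ (p ∘ suc) (n ∘ suc) (pr ∘ suc) (Distinct-suc distinct) (a * q₀) (q∣z ∘ suc)
    coprime : Coprime M′ (p zero)
    coprime (d∣M′ , d∣p₀) with prime⇒irreducible (pr zero) d∣p₀
    ... | inj₁ d≡1    = d≡1
    ... | inj₂ ≡.refl with prime∣modulusOf⇒≡ (p ∘ suc) (n ∘ suc) (pr ∘ suc) (pr zero) d∣M′
    ...   | i , e with distinct zero (suc i) e
    ...     | ()
    M′∣a : M′ ∣ a
    M′∣a = coprime-∣*^⇒∣ coprime a (n zero) M′∣aq₀

module Modulus (K : ℕ) (p n : Fin K → ℕ) (pr : ∀ i → Prime (p i))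
               (distinct : PrimePowerProducts.Distinct p) (1≤n : ∀ i → 1 ≤ n i) where
  open import Data.Nat as ℕ using (zero; suc; _<_; z≤n; s≤s; _^_; _*_; NonZero)
  import Data.Nat.Properties as ℕ
  open import Data.Nat.Divisibility as ℕ∣ using (_∣_; divides)
  open import Data.Nat.DivMod using (_/_; m/n*n≡m)
  open import Data.Nat.Primality using (prime⇒nonZero)
  open import Data.Nat.Primality.Factorisation using (factorise; PrimeFactorisation)
  open import Data.Nat.ListAction using (product)
  open import Data.List using ([]; _∷_)
  open import Data.List.Relation.Unary.All using (_∷_)
  open import Data.Product using (∃; _,_; proj₁; proj₂; _×_)
  open import Data.Empty using (⊥-elim)
  open import Relation.Nullary using (¬_)
  open import Relation.Binary.PropositionalEquality using (_≡_; _≢_)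
  import Relation.Binary.PropositionalEquality as ≡
  open PrimePowerProducts

  M : ℕ
  M = modulusOf p n

  q : Fin K → ℕ
  q j = p j ^ n j

  h : Fin K → ℕ
  h j = M div p j

  1≤M : 1 ≤ M
  1≤M = 1≤modulusOf p n pr

  instance
    p-nonZero : ∀ {j} → NonZero (p j)
    p-nonZero {j} = prime⇒nonZero (pr j)

    q-nonZero : ∀ {j} → NonZero (q j)
    q-nonZero {j} = ℕ.>-nonZero (ℕ.m^n>0 (p j) (n j))

  M′ : Fin K → ℕ
  M′ j = proj₁ (modulusOf-split p n pr distinct j)

  M≡q*M′ : ∀ j → M ≡ q j * M′ j
  M≡q*M′ j = proj₁ (proj₂ (modulusOf-split p n pr distinct j))

  p∤M′ : ∀ j → ¬ (p j ∣ M′ j)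
  p∤M′ j = proj₂ (proj₂ (modulusOf-split p n pr distinct j))

  q∣M : ∀ j → q j ∣ M
  q∣M j = divides (M′ j) (≡.trans (M≡q*M′ j) (ℕ.*-comm (q j) (M′ j)))

  p∣q : ∀ j → p j ∣ q j
  p∣q j with n j | 1≤n j
  ... | suc k | _ = ℕ∣.m∣m*n (p j ^ k)

  h*p≡M : ∀ j → h j * p j ≡ M
  h*p≡M j = ≡.trans (≡.cong (_* p j) (div≡/ M (p j))) (m/n*n≡m (ℕ∣.∣-trans (p∣q j) (q∣M j)))
    where
    div≡/ : ∀ x y → .⦃ _ : NonZero y ⦄ → x div y ≡ x / y
    div≡/ x (suc y) = ≡.refl

  q∤h : ∀ j → ¬ (q j ∣ h j)
  q∤h j q∣h = p∤M′ j (ℕ∣.*-cancelˡ-∣ (q j) (≡.subst (q j * p j ∣_) hp≡qM′ (ℕ∣.*-monoˡ-∣ (p j) q∣h)))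
    where
    hp≡qM′ : h j * p j ≡ q j * M′ j
    hp≡qM′ = ≡.trans (h*p≡M j) (M≡q*M′ j)

  p∣cofactor⇒∣h : ∀ j {d k} → M ≡ k * d → p j ∣ k → d ∣ h j
  p∣cofactor⇒∣h j {d} M≡kd (divides k′ ≡.refl) =
    divides k′ (ℕ.*-cancelʳ-≡ (h j) (k′ * d) (p j) (≡.trans (h*p≡M j) (≡.trans M≡kd swap)))
    where
    swap : k′ * p j * d ≡ k′ * d * p j
    swap = ≡.trans (ℕ.*-assoc k′ (p j) d) (≡.trans (≡.cong (k′ *_) (ℕ.*-comm (p j) d)) (≡.sym (ℕ.*-assoc k′ d (p j))))

  ∤h⇒q∣ : ∀ j d → d ∣ M → ¬ (d ∣ h j) → q j ∣ d
  ∤h⇒q∣ j d (divides k M≡kd) d∤h = prime^∣*⇒∣ (pr j) (n j) d k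
    (≡.subst (q j ∣_) (≡.trans M≡kd (ℕ.*-comm k d)) (q∣M j)) (λ p∣k → d∤h (p∣cofactor⇒∣h j M≡kd p∣k))

  q∣h : ∀ i j → i ≢ j → q i ∣ h j
  q∣h i j i≢j = prime^∣*⇒∣ (pr i) (n i) (h j) (p j) (≡.subst (q i ∣_) (≡.sym (h*p≡M j)) (q∣M i))
    (λ pᵢ∣pⱼ → i≢j (distinct i j (prime∣prime⇒≡ (pr i) (pr j) pᵢ∣pⱼ)))

  q∣⇒M∣ : ∀ z → (∀ j → q j ∣ z) → M ∣ z
  q∣⇒M∣ = prime-powers-∣⇒modulusOf-∣ p n pr distinct

  1≤h : ∀ j → 1 ≤ h j
  1≤h j with h j | h*p≡M j
  ... | zero  | 0≡M = ⊥-elim (ℕ.<⇒≢ 1≤M 0≡M)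
  ... | suc _ | _   = s≤s z≤n

  h<M : ∀ j → h j < M
  h<M j = ≡.subst (h j <_) (h*p≡M j) (ℕ.m<m*n (h j) (p j) ⦃ ℕ.>-nonZero (1≤h j) ⦄ (prime⇒1<p (pr j)))

  -- A proper divisor d = M / k of M misses the prime factor p_j of k, so d ∣ h_j.
  proper-divisor∣h : ∀ d → d ∣ M → d < M → ∃ λ j → d ∣ h j
  proper-divisor∣h d (divides k M≡kd) d<M = j , p∣cofactor⇒∣h j M≡kd pⱼ∣k
    where
    k≢0 : k ≢ 0
    k≢0 ≡.refl = ℕ.<⇒≢ 1≤M (≡.sym M≡kd)
    factorisation = factorise k ⦃ ℕ.≢-nonZero k≢0 ⦄
    prime-factor : ∃ λ r → Prime r × r ∣ k
    prime-factor with PrimeFactorisation.factors factorisation | PrimeFactorisation.isFactorisation factorisation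
                    | PrimeFactorisation.factorsPrime factorisation
    ... | []     | k≡1 | _ = ⊥-elim (ℕ.<-irrefl (≡.sym (≡.trans M≡kd (≡.trans (≡.cong (_* d) k≡1) (ℕ.*-identityˡ d)))) d<M)
    ... | r ∷ rs | k≡  | r-prime ∷ _ = r , r-prime , divides (product rs) (≡.trans k≡ (ℕ.*-comm r (product rs)))
    r = proj₁ prime-factor
    r-prime = proj₁ (proj₂ prime-factor)
    r∣k = proj₂ (proj₂ prime-factor)
    r≡p = prime∣modulusOf⇒≡ p n pr r-prime (ℕ∣.∣-trans r∣k (divides d (≡.trans M≡kd (ℕ.*-comm k d))))
    j = proj₁ r≡p
    pⱼ∣k : p j ∣ k
    pⱼ∣k = ≡.subst (_∣ k) (proj₂ r≡p) r∣k

module BitVectors where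
  open import Data.Nat as ℕ using (ℕ; zero; suc; _+_; _*_)
  import Data.Nat.Properties as ℕ
  open import Data.Nat.Divisibility as ℕ∣ using (_∣_)
  open import Data.Fin using (Fin; zero; suc)
  import Data.Fin.Properties as Fin
  open import Data.Bool using (Bool; true; false)
  open import Data.Vec using (Vec; []; _∷_; lookup; replicate)
  open import Data.Empty using (⊥; ⊥-elim)
  open import Function.Base using (_∘_)
  open import Relation.Nullary using (¬_)
  open import Relation.Binary.PropositionalEquality using (_≡_; _≢_)
  import Relation.Binary.PropositionalEquality as ≡
  open PrimePowerProducts using (sumFin-suc)

  dot : ∀ {k} → Vec Bool k → (Fin k → ℕ) → ℕ
  dot ε a = sumFin (λ j → bitToℕ (lookup ε j) * a j)

  dot-∷ : ∀ {k} b (ε : Vec Bool k) a → dot (b ∷ ε) a ≡ bitToℕ b * a zero + dot ε (a ∘ suc)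
  dot-∷ b ε a = sumFin-suc (λ j → bitToℕ (lookup (b ∷ ε) j) * a j)

  weight-∷ : ∀ {k} b (ε : Vec Bool k) → weight (b ∷ ε) ≡ bitToℕ b + weight ε
  weight-∷ b ε = sumFin-suc (λ j → bitToℕ (lookup (b ∷ ε) j))

  𝟎 : ∀ {k} → Vec Bool k
  𝟎 {k} = replicate k false

  weight-𝟎 : ∀ k → weight (𝟎 {k}) ≡ 0
  weight-𝟎 zero    = ≡.refl
  weight-𝟎 (suc k) = ≡.trans (weight-∷ false (𝟎 {k})) (weight-𝟎 k)

  dot-𝟎 : ∀ k (a : Fin k → ℕ) → dot (𝟎 {k}) a ≡ 0
  dot-𝟎 zero    a = ≡.refl
  dot-𝟎 (suc k) a = ≡.trans (dot-∷ false (𝟎 {k}) a) (dot-𝟎 k (a ∘ suc))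

  ∣-dot : ∀ {k} d (ε : Vec Bool k) a → (∀ j → d ∣ a j) → d ∣ dot ε a
  ∣-dot d []      a d∣a = d ℕ∣.∣0
  ∣-dot d (b ∷ ε) a d∣a = ≡.subst (d ∣_) (≡.sym (dot-∷ b ε a))
    (ℕ∣.∣m∣n⇒∣m+n (ℕ∣.∣n⇒∣m*n (bitToℕ b) (d∣a zero)) (∣-dot d ε (a ∘ suc) (d∣a ∘ suc)))

  -- Reducing c + ε·a modulo q_i recovers the bit ε_i.
  dot-injective : ∀ M k (a qs : Fin k → ℕ) → (∀ i → qs i ∣ M) → (∀ i → ¬ (qs i ∣ a i)) →
                  (∀ i j → i ≢ j → qs i ∣ a j) →
                  ∀ c (ε ε′ : Vec Bool k) → M ∣ c + dot ε a → M ∣ c + dot ε′ a → ε ≡ ε′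
  dot-injective M zero    a qs q∣M q∤a q∣a c [] [] _ _ = ≡.refl
  dot-injective M (suc k) a qs q∣M q∤a q∣a c (b ∷ ε) (b′ ∷ ε′) M∣ M∣′ =
    bits b b′ (≡.subst (λ z → M ∣ c + z) (dot-∷ b ε a) M∣) (≡.subst (λ z → M ∣ c + z) (dot-∷ b′ ε′ a) M∣′)
    where
    a′ = a ∘ suc
    q₀ = qs zero
    reassoc : ∀ x y → c + (x + y) ≡ (c + x) + y
    reassoc x y = ≡.sym (ℕ.+-assoc c x y)
    q₀∣c+ : ∀ x ε → M ∣ c + (x + dot ε a′) → q₀ ∣ c + x
    q₀∣c+ x ε M∣ = ℕ∣.∣m+n∣m⇒∣n
      (ℕ∣.∣-trans (q∣M zero) (≡.subst (M ∣_) (≡.trans (reassoc x (dot ε a′)) (ℕ.+-comm (c + x) (dot ε a′))) M∣))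
      (∣-dot q₀ ε a′ (λ j → q∣a zero (suc j) (λ ())))
    contradiction : q₀ ∣ c + (a zero + 0) → q₀ ∣ c + 0 → ⊥
    contradiction d₁ d₀ = q∤a zero (≡.subst (q₀ ∣_) (ℕ.+-identityʳ (a zero))
      (ℕ∣.∣m+n∣m⇒∣n d₁ (≡.subst (q₀ ∣_) (ℕ.+-identityʳ c) d₀)))
    IH : ∀ c′ → M ∣ c′ + dot ε a′ → M ∣ c′ + dot ε′ a′ → ε ≡ ε′
    IH c′ = dot-injective M k a′ (qs ∘ suc) (q∣M ∘ suc) (q∤a ∘ suc)
              (λ i j i≢j → q∣a (suc i) (suc j) (i≢j ∘ Fin.suc-injective)) c′ ε ε′
    bits : ∀ b b′ → M ∣ c + (bitToℕ b * a zero + dot ε a′) → M ∣ c + (bitToℕ b′ * a zero + dot ε′ a′) →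
           b ∷ ε ≡ b′ ∷ ε′
    bits false false x y = ≡.cong (false ∷_) (IH (c + 0) (≡.subst (M ∣_) (reassoc _ _) x) (≡.subst (M ∣_) (reassoc _ _) y))
    bits true  true  x y = ≡.cong (true ∷_) (IH (c + (a zero + 0)) (≡.subst (M ∣_) (reassoc _ _) x) (≡.subst (M ∣_) (reassoc _ _) y))
    bits true  false x y = ⊥-elim (contradiction (q₀∣c+ _ ε x) (q₀∣c+ 0 ε′ y))
    bits false true  x y = ⊥-elim (contradiction (q₀∣c+ _ ε′ y) (q₀∣c+ 0 ε x))

module SumOverBits {c ℓ} (S : CommutativeRing c ℓ) where
  open import Data.Nat using (zero; suc)
  open import Data.Bool using (Bool; true; false)
  open import Data.Vec using (Vec; []; _∷_)
  open import Data.Vec.Properties using (∷-injectiveʳ)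
  open import Data.List using (List; []; _∷_; foldr; concatMap)
  open import Function.Base using (_∘_)
  open import Relation.Binary.PropositionalEquality using (_≡_; _≢_)

  open CommutativeRing S hiding (zero)
  open import Algebra.Properties.Ring ring using (-0#≈0#; -‿+-comm)
  open import Algebra.Properties.CommutativeSemigroup +-commutativeSemigroup using (interchange)

  sumList : ∀ {k} → List (Vec Bool k) → (Vec Bool k → Carrier) → Carrier
  sumList L T = foldr (λ ε acc → T ε + acc) 0# L

  sumBits : ∀ k → (Vec Bool k → Carrier) → Carrier
  sumBits k = sumList (allBits k)

  private
    sumList-concatMap : ∀ {k} (L : List (Vec Bool k)) (T : Vec Bool (suc k) → Carrier) →
      sumList (concatMap (λ v → (false ∷ v) ∷ (true ∷ v) ∷ []) L) T ≈ sumList L (λ v → T (false ∷ v) + T (true ∷ v))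
    sumList-concatMap []      T = refl
    sumList-concatMap (x ∷ L) T = trans (+-congˡ (+-congˡ (sumList-concatMap L T))) (sym (+-assoc _ _ _))

  sumBits-suc : ∀ k T → sumBits (suc k) T ≈ sumBits k (λ v → T (false ∷ v) + T (true ∷ v))
  sumBits-suc k T = sumList-concatMap (allBits k) T

  sumBits-cong : ∀ k {T T′} → (∀ ε → T ε ≈ T′ ε) → sumBits k T ≈ sumBits k T′
  sumBits-cong k {T} {T′} T≈T′ = go (allBits k)
    where
    go : ∀ L → sumList L T ≈ sumList L T′
    go []      = refl
    go (x ∷ L) = +-cong (T≈T′ x) (go L)

  sumBits-+ : ∀ k T T′ → sumBits k (λ ε → T ε + T′ ε) ≈ sumBits k T + sumBits k T′
  sumBits-+ k T T′ = go (allBits k)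
    where
    go : ∀ L → sumList L (λ ε → T ε + T′ ε) ≈ sumList L T + sumList L T′
    go []      = sym (+-identityˡ _)
    go (x ∷ L) = trans (+-congˡ (go L)) (interchange _ _ _ _)

  sumBits-*ˡ : ∀ k a T → sumBits k (λ ε → a * T ε) ≈ a * sumBits k T
  sumBits-*ˡ k a T = go (allBits k)
    where
    go : ∀ L → sumList L (λ ε → a * T ε) ≈ a * sumList L T
    go []      = sym (zeroʳ a)
    go (x ∷ L) = trans (+-congˡ (go L)) (sym (distribˡ _ _ _))

  sumBits-0 : ∀ k → sumBits k (λ _ → 0#) ≈ 0#
  sumBits-0 k = go (allBits k)
    where
    go : ∀ L → sumList L (λ _ → 0#) ≈ 0#
    go []      = refl
    go (x ∷ L) = trans (+-identityˡ _) (go L)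

  sumBits-‿ : ∀ k T → sumBits k (λ ε → - T ε) ≈ - sumBits k T
  sumBits-‿ k T = go (allBits k)
    where
    go : ∀ L → sumList L (λ ε → - T ε) ≈ - sumList L T
    go []      = sym -0#≈0#
    go (x ∷ L) = trans (+-congˡ (go L)) (-‿+-comm _ _)

  sumBits-single : ∀ k T (ε₀ : Vec Bool k) → (∀ ε → ε ≢ ε₀ → T ε ≈ 0#) → sumBits k T ≈ T ε₀
  sumBits-single zero    T []       vanish = +-identityʳ _
  sumBits-single (suc k) T (b ∷ ε₀) vanish = trans (sumBits-suc k T) (trans (sumBits-single k _ ε₀ vanish′) (top b vanish))
    where
    vanish′ : ∀ v → v ≢ ε₀ → T (false ∷ v) + T (true ∷ v) ≈ 0#
    vanish′ v v≢ε₀ = trans (+-cong (vanish (false ∷ v) (v≢ε₀ ∘ ∷-injectiveʳ))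
                                   (vanish (true ∷ v) (v≢ε₀ ∘ ∷-injectiveʳ)))
                           (+-identityˡ _)
    top : ∀ b → (∀ ε → ε ≢ b ∷ ε₀ → T ε ≈ 0#) → T (false ∷ ε₀) + T (true ∷ ε₀) ≈ T (b ∷ ε₀)
    top false vanish = trans (+-congˡ (vanish (true ∷ ε₀) (λ ()))) (+-identityʳ _)
    top true  vanish = trans (+-congʳ (vanish (false ∷ ε₀) (λ ()))) (+-identityˡ _)

sumBits-homomorphic : ∀ {c ℓ c′ ℓ′} (S : CommutativeRing c ℓ) (S′ : CommutativeRing c′ ℓ′) →
  let module S = CommutativeRing S; module S′ = CommutativeRing S′ in
  (φ : S.Carrier → S′.Carrier) → φ S.0# S′.≈ S′.0# → (∀ a b → φ (a S.+ b) S′.≈ φ a S′.+ φ b) →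
  ∀ k T → φ (SumOverBits.sumBits S k T) S′.≈ SumOverBits.sumBits S′ k (λ ε → φ (T ε))
sumBits-homomorphic S S′ φ φ0 φ+ k T = go (allBits k)
  where
  open import Data.List using ([]; _∷_)
  module S′ = CommutativeRing S′
  go : ∀ L → φ (SumOverBits.sumList S L T) S′.≈ SumOverBits.sumList S′ L (λ ε → φ (T ε))
  go []      = φ0
  go (x ∷ L) = S′.trans (φ+ _ _) (S′.+-congˡ (go L))

module CoefficientsAtMultiples {c ℓ} (R : CommutativeRing c ℓ) (M : ℕ) where
  open import Data.Nat as ℕ using (zero; suc)
  import Data.Nat.Properties as ℕ
  open import Data.Nat.Divisibility as ℕ∣ using (_∣_; _∣?_)
  open import Data.Bool using (true; false; if_then_else_)
  open import Data.List using ([]; _∷_)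
  open import Relation.Nullary using (yes; no; does)
  open import Data.Empty using (⊥-elim)
  import Relation.Binary.PropositionalEquality as ≡

  open CommutativeRing R hiding (zero)
  open PolynomialArithmetic R
  open import Algebra.Properties.Ring ring using (-0#≈0#; -‿+-comm)
  open import Algebra.Properties.CommutativeSemigroup +-commutativeSemigroup using (interchange)

  atMultiple : ℕ → Carrier → Carrier
  atMultiple i a = if does (M ∣? i) then a else 0#

  -- σ i P = ∑_k [M ∣ i + k] P_k, the sum of the coefficients of X^i·P at exponents divisible by M.
  σ : ℕ → Poly → Carrier
  σ i []      = 0#
  σ i (a ∷ P) = atMultiple i a + σ (suc i) P

  atMultiple-+ : ∀ i a b → atMultiple i (a + b) ≈ atMultiple i a + atMultiple i b
  atMultiple-+ i a b with does (M ∣? i)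
  ... | true  = refl
  ... | false = sym (+-identityʳ 0#)

  atMultiple-‿ : ∀ i a → atMultiple i (- a) ≈ - atMultiple i a
  atMultiple-‿ i a with does (M ∣? i)
  ... | true  = refl
  ... | false = sym -0#≈0#

  atMultiple-* : ∀ i a b → atMultiple i (a * b) ≈ a * atMultiple i b
  atMultiple-* i a b with does (M ∣? i)
  ... | true  = refl
  ... | false = sym (zeroʳ a)

  atMultiple-0 : ∀ i {a} → a ≈ 0# → atMultiple i a ≈ 0#
  atMultiple-0 i a≈0 with does (M ∣? i)
  ... | true  = a≈0
  ... | false = refl

  σ-+ₚ : ∀ i P Q → σ i (P +ₚ Q) ≈ σ i P + σ i Q
  σ-+ₚ i []      Q       = sym (+-identityˡ _)
  σ-+ₚ i (a ∷ P) []      = sym (+-identityʳ _)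
  σ-+ₚ i (a ∷ P) (b ∷ Q) = trans (+-cong (atMultiple-+ i a b) (σ-+ₚ (suc i) P Q)) (interchange _ _ _ _)

  σ-‿ : ∀ i P → σ i (-ₚ P) ≈ - σ i P
  σ-‿ i []      = sym -0#≈0#
  σ-‿ i (a ∷ P) = trans (+-cong (atMultiple-‿ i a) (σ-‿ (suc i) P)) (-‿+-comm _ _)

  σ-⋆ : ∀ i a P → σ i (a ⋆ P) ≈ a * σ i P
  σ-⋆ i a []      = sym (zeroʳ a)
  σ-⋆ i a (b ∷ P) = trans (+-cong (atMultiple-* i a b) (σ-⋆ (suc i) a P)) (sym (distribˡ _ _ _))

  σ-≋[] : ∀ i P → P ≋ [] → σ i P ≈ 0#
  σ-≋[] i []      _    = refl
  σ-≋[] i (a ∷ P) P≋[] =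
    trans (+-cong (atMultiple-0 i (at P≋[] 0)) (σ-≋[] (suc i) P (mk≋ λ k → at P≋[] (suc k)))) (+-identityʳ 0#)

  σ-cong : ∀ i {P Q} → P ≋ Q → σ i P ≈ σ i Q
  σ-cong i {P} {Q} P≋Q = begin
    σ i P                        ≈⟨ RSolver.solve 2 (λ a b → a RSolver.:= (a RSolver.:- b) RSolver.:+ b) refl (σ i P) (σ i Q) ⟩
    (σ i P - σ i Q) + σ i Q      ≈⟨ +-congʳ (trans (+-congˡ (sym (σ-‿ i Q))) (trans (sym (σ-+ₚ i P (-ₚ Q))) P−Q≈0)) ⟩
    0# + σ i Q                   ≈⟨ +-identityˡ _ ⟩
    σ i Q                        ∎
    where
    open ≈-Reasoning
    module RSolver = IntegerSolver R
    P−Q≈0 : σ i (P −ₚ Q) ≈ 0#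
    P−Q≈0 = σ-≋[] i _ (≋-trans (+ₚ-congʳ (-ₚ Q) P≋Q) (-ₚ-inverseʳ Q))

  σ-shift : ∀ i t P → σ i (shift t P) ≈ σ (i ℕ.+ t) P
  σ-shift i zero    P = reflexive (≡.cong (λ z → σ z P) (≡.sym (ℕ.+-identityʳ i)))
  σ-shift i (suc t) P = trans (+-cong (atMultiple-0 i refl) (σ-shift (suc i) t P))
    (trans (+-identityˡ _) (reflexive (≡.cong (λ z → σ z P) (≡.sym (ℕ.+-suc i t)))))

  σ-+M : ∀ i P → σ (i ℕ.+ M) P ≈ σ i P
  σ-+M i []      = refl
  σ-+M i (a ∷ P) = +-cong (reflexive (≡.cong (λ b → if b then a else 0#) (does-+M i))) (σ-+M (suc i) P)
    where
    does-+M : ∀ i → does (M ∣? (i ℕ.+ M)) ≡.≡ does (M ∣? i)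
    does-+M i with M ∣? (i ℕ.+ M) | M ∣? i
    ... | yes _   | yes _   = ≡.refl
    ... | no  _   | no  _   = ≡.refl
    ... | yes M∣  | no  M∤i = ⊥-elim (M∤i (ℕ∣.∣m+n∣m⇒∣n (≡.subst (M ∣_) (ℕ.+-comm i M) M∣) ℕ∣.∣-refl))
    ... | no  M∤  | yes M∣i = ⊥-elim (M∤ (ℕ∣.∣m∣n⇒∣m+n M∣i ℕ∣.∣-refl))

  σ-Xⁿ−1*ₚ : ∀ H → σ 0 (Xⁿ−1 M *ₚ H) ≈ 0#
  σ-Xⁿ−1*ₚ H = begin
    σ 0 (Xⁿ−1 M *ₚ H)                 ≈⟨ σ-cong 0 shifted ⟩
    σ 0 (shift M H −ₚ H)               ≈⟨ σ-+ₚ 0 (shift M H) (-ₚ H) ⟩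
    σ 0 (shift M H) + σ 0 (-ₚ H)       ≈⟨ +-cong (trans (σ-shift 0 M H) (σ-+M 0 H)) (σ-‿ 0 H) ⟩
    σ 0 H - σ 0 H                      ≈⟨ -‿inverseʳ _ ⟩
    0#                                 ∎
    where
    open ≈-Reasoning
    shifted : (Xⁿ−1 M *ₚ H) ≋ (shift M H −ₚ H)
    shifted = ≋-trans (PSolver.solve 3 (λ a o x → (a PSolver.:- o) PSolver.:* x PSolver.:= a PSolver.:* x PSolver.:- o PSolver.:* x)
                                       ≋-refl (X^ M) (const 1#) H)
                      (+ₚ-cong (≋-sym (shift≋X^*ₚ M H)) (-ₚ-cong (*ₚ-identityˡ H)))

  σ-∣ₓ : ∀ {P} → Xⁿ−1 M ∣ₓ P → σ 0 P ≈ 0#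
  σ-∣ₓ (divₓ G e) = trans (σ-cong 0 (≋-sym e)) (σ-Xⁿ−1*ₚ G)

  σ-X^ : ∀ s → σ 0 (X^ s) ≈ atMultiple s 1#
  σ-X^ s = trans (σ-cong 0 (≋-trans (≋-sym (*ₚ-identityʳ (X^ s))) (≋-sym (shift≋X^*ₚ s (const 1#)))))
                 (trans (σ-shift 0 s (const 1#)) (+-identityʳ _))

module ProductExpansion {c ℓ} (R : CommutativeRing c ℓ) where
  open import Data.Nat as ℕ using (ℕ; zero; suc)
  import Data.Nat.Properties as ℕ
  open import Data.Fin using (Fin; zero; suc)
  open import Data.Bool using (Bool; true; false)
  open import Data.Vec using (Vec; _∷_)
  open import Function.Base using (_∘_)
  import Relation.Binary.PropositionalEquality as ≡

  open CommutativeRing R hiding (zero)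
  open Over R using (negOnePow)
  open PolynomialArithmetic R
  open BitVectors using (dot; dot-∷; weight-∷)
  open SumOverBits R[X] using (sumBits; sumBits-suc; sumBits-cong; sumBits-+; sumBits-*ˡ; sumBits-‿)
  open PSolver using (_:+_; _:*_; _:-_; :-_; _:=_)
  open ≋-Reasoning

  prodFinₚ : ∀ k → (Fin k → Poly) → Poly
  prodFinₚ zero    g = const 1#
  prodFinₚ (suc k) g = g zero *ₚ prodFinₚ k (g ∘ suc)

  factor∣ₓprodFinₚ : ∀ k g j → g j ∣ₓ prodFinₚ k g
  factor∣ₓprodFinₚ (suc k) g zero    = A∣ₓA*ₚB (g zero) (prodFinₚ k (g ∘ suc))
  factor∣ₓprodFinₚ (suc k) g (suc j) = ∣ₓ⇒∣ₓ*ₚ′ (g zero) (factor∣ₓprodFinₚ k (g ∘ suc) j)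

  prodFinₚ-*ₚ : ∀ k g g′ → prodFinₚ k (λ j → g j *ₚ g′ j) ≋ (prodFinₚ k g *ₚ prodFinₚ k g′)
  prodFinₚ-*ₚ zero    g g′ = ≋-sym (*ₚ-identityʳ (const 1#))
  prodFinₚ-*ₚ (suc k) g g′ = ≋-trans (*ₚ-congˡ (g zero *ₚ g′ zero) (prodFinₚ-*ₚ k (g ∘ suc) (g′ ∘ suc)))
    (PSolver.solve 4 (λ a b A B → (a :* b) :* (A :* B) := (a :* A) :* (b :* B))
      ≋-refl (g zero) (g′ zero) (prodFinₚ k (g ∘ suc)) (prodFinₚ k (g′ ∘ suc)))

  prodFinₚ-cong : ∀ k {g g′} → (∀ j → g j ≋ g′ j) → prodFinₚ k g ≋ prodFinₚ k g′
  prodFinₚ-cong zero    g≋g′ = ≋-refl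
  prodFinₚ-cong (suc k) g≋g′ = *ₚ-cong (g≋g′ zero) (prodFinₚ-cong k (g≋g′ ∘ suc))

  prodFinₚ-expand : ∀ k (a : Fin k → ℕ) →
    prodFinₚ k (λ j → const 1# −ₚ X^ a j) ≋ sumBits k (λ ε → const (negOnePow (weight ε)) *ₚ X^ dot ε a)
  prodFinₚ-expand zero    a = ≋-trans (≋-sym (*ₚ-identityʳ (const 1#))) (≋-sym (+ₚ-identityʳ _))
  prodFinₚ-expand (suc k) a = begin
    (const 1# −ₚ X^ a₀) *ₚ prodFinₚ k (λ j → const 1# −ₚ X^ a′ j)
      ≈⟨ *ₚ-congˡ (const 1# −ₚ X^ a₀) (prodFinₚ-expand k a′) ⟩
    (const 1# −ₚ X^ a₀) *ₚ sumBits k T′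
      ≈⟨ PSolver.solve 3 (λ o x s → (o :- x) :* s := o :* s :+ (:- (x :* s))) ≋-refl (const 1#) (X^ a₀) (sumBits k T′) ⟩
    (const 1# *ₚ sumBits k T′) +ₚ (-ₚ (X^ a₀ *ₚ sumBits k T′))
      ≈⟨ +ₚ-cong (*ₚ-identityˡ _) (≋-trans (-ₚ-cong (≋-sym (sumBits-*ˡ k (X^ a₀) T′))) (≋-sym (sumBits-‿ k _))) ⟩
    sumBits k T′ +ₚ sumBits k (λ ε → -ₚ (X^ a₀ *ₚ T′ ε))
      ≈⟨ ≋-sym (sumBits-+ k _ _) ⟩
    sumBits k (λ ε → T′ ε +ₚ (-ₚ (X^ a₀ *ₚ T′ ε)))
      ≈⟨ sumBits-cong k (λ ε → +ₚ-cong (≋-sym (T-false ε)) (≋-sym (T-true ε))) ⟩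
    sumBits k (λ ε → T (false ∷ ε) +ₚ T (true ∷ ε))
      ≈⟨ ≋-sym (sumBits-suc k T) ⟩
    sumBits (suc k) T ∎
    where
    a₀ = a zero
    a′ = a ∘ suc
    T : Vec Bool (suc k) → Poly
    T ε = const (negOnePow (weight ε)) *ₚ X^ dot ε a
    T′ : Vec Bool k → Poly
    T′ ε = const (negOnePow (weight ε)) *ₚ X^ dot ε a′
    T-false : ∀ ε → T (false ∷ ε) ≋ T′ ε
    T-false ε = ≋-reflexive (≡.cong₂ (λ w s → const (negOnePow w) *ₚ X^ s) (weight-∷ false ε) (dot-∷ false ε a))
    T-true : ∀ ε → T (true ∷ ε) ≋ (-ₚ (X^ a₀ *ₚ T′ ε))
    T-true ε = begin
      T (true ∷ ε)
        ≡⟨ ≡.cong₂ (λ w s → const (negOnePow w) *ₚ X^ s) (weight-∷ true ε)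
             (≡.trans (dot-∷ true ε a) (≡.cong (ℕ._+ dot ε a′) (ℕ.+-identityʳ a₀))) ⟩
      (-ₚ const (negOnePow (weight ε))) *ₚ X^ (a₀ ℕ.+ dot ε a′)
        ≈⟨ *ₚ-congˡ (-ₚ const (negOnePow (weight ε))) (X^-+ a₀ (dot ε a′)) ⟩
      (-ₚ const (negOnePow (weight ε))) *ₚ (X^ a₀ *ₚ X^ dot ε a′)
        ≈⟨ PSolver.solve 3 (λ s x b → (:- s) :* (x :* b) := :- (x :* (s :* b))) ≋-refl
             (const (negOnePow (weight ε))) (X^ a₀) (X^ dot ε a′) ⟩
      -ₚ (X^ a₀ *ₚ T′ ε) ∎

module StepDecomposition {c ℓ} (R : CommutativeRing c ℓ) (isField : Over.IsField R) (charZero : Over.CharZero R)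
  (K : ℕ) (p n : Fin K → ℕ) (pr : ∀ i → Prime (p i)) (distinct : PrimePowerProducts.Distinct p)
  (1≤n : ∀ i → 1 ≤ n i) where
  open import Data.Nat as ℕ using (zero; suc)
  import Data.Nat.Properties as ℕ
  open import Data.Nat.Divisibility as ℕ∣ using (_∣_; _∣?_)
  open import Data.Fin as Fin using (Fin; zero; suc; toℕ)
  import Data.Fin.Properties as Fin
  open import Data.Bool using (Bool; true; false; if_then_else_)
  open import Data.Vec using (Vec; []; _∷_)
  open import Data.List using (List; []; _∷_; map; upTo; applyUpTo; _++_; length)
  import Data.List.Properties as List
  open import Data.Product using (_,_; proj₁; proj₂; _×_)
  open import Data.Empty using (⊥-elim)
  open import Function.Base using (_∘_)
  open import Level using (_⊔_)
  open import Relation.Nullary using (¬_; yes; no; does)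
  open import Relation.Binary.PropositionalEquality using (_≡_)
  import Relation.Binary.PropositionalEquality as ≡

  open CommutativeRing R hiding (zero)
  open Over R using (negOnePow)
  open import Algebra.Properties.Ring ring using (-‿distribˡ-*; -0#≈0#)
  open Modulus K p n pr distinct 1≤n
  open PolynomialArithmetic R
  open PowersMinusOne R using (geometric)
  open IntegerPolynomials R using (++≋+ₚshift)
  open Cyclotomic R isField charZero using (Φ; Φ∣ₓgeometric)
  open BitVectors
  open SumOverBits R
  module RSolver = IntegerSolver R

  Fn : Set c
  Fn = ℕ → Carrier

  -- x ~ y iff gcd(x, M) = gcd(y, M); the step functions of the paper are those constant on ~-classes.
  infix 4 _~_
  _~_ : ℕ → ℕ → Set
  x ~ y = ∀ d → d ∣ M → (d ∣ x → d ∣ y) × (d ∣ y → d ∣ x)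

  IsStep : Fn → Set ℓ
  IsStep G = ∀ x y → x ~ y → G x ≈ G y

  ~-sym : ∀ {x y} → x ~ y → y ~ x
  ~-sym x~y d d∣M = proj₂ (x~y d d∣M) , proj₁ (x~y d d∣M)

  ~-trans : ∀ {x y z} → x ~ y → y ~ z → x ~ z
  ~-trans x~y y~z d d∣M = proj₁ (y~z d d∣M) ∘ proj₁ (x~y d d∣M) , proj₂ (x~y d d∣M) ∘ proj₂ (y~z d d∣M)

  ∣⇒∣+ : ∀ {d a} x → d ∣ a → d ∣ x → d ∣ x ℕ.+ a
  ∣⇒∣+ x d∣a d∣x = ℕ∣.∣m∣n⇒∣m+n d∣x d∣a

  ∣+⇒∣ : ∀ {d a} x → d ∣ a → d ∣ x ℕ.+ a → d ∣ x
  ∣+⇒∣ {d} {a} x d∣a d∣x+a = ℕ∣.∣m+n∣m⇒∣n (≡.subst (d ∣_) (ℕ.+-comm x a) d∣x+a) d∣a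

  +*M~ : ∀ x t → x ℕ.+ t ℕ.* M ~ x
  +*M~ x t d d∣M = ∣+⇒∣ x (ℕ∣.∣n⇒∣m*n t d∣M) , ∣⇒∣+ x (ℕ∣.∣n⇒∣m*n t d∣M)

  periodicPart : Fin K → Fn → Fn
  periodicPart j G x = if does (q j ∣? x) then G (x ℕ.+ h j) else G x

  differencePart : Fin K → Fn → Fn
  differencePart j G x = if does (q j ∣? x) then G x - G (x ℕ.+ h j) else 0#

  periodicPart+differencePart : ∀ j G x → G x ≈ periodicPart j G x + differencePart j G x
  periodicPart+differencePart j G x with q j ∣? x
  ... | yes _ = RSolver.solve 2 (λ a b → a RSolver.:= b RSolver.:+ (a RSolver.:- b)) refl (G x) (G (x ℕ.+ h j))
  ... | no  _ = sym (+-identityʳ _)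

  private
    ~-if-q∤ : ∀ j {x y} → ¬ (q j ∣ x) → ¬ (q j ∣ y) →
              (∀ d → d ∣ h j → (d ∣ x → d ∣ y) × (d ∣ y → d ∣ x)) → x ~ y
    ~-if-q∤ j q∤x q∤y same d d∣M with d ∣? h j
    ... | yes d∣h = same d d∣h
    ... | no  d∤h = (λ d∣x → ⊥-elim (q∤x (ℕ∣.∣-trans (∤h⇒q∣ j d d∣M d∤h) d∣x)))
                  , (λ d∣y → ⊥-elim (q∤y (ℕ∣.∣-trans (∤h⇒q∣ j d d∣M d∤h) d∣y)))

    q∣⇒q∤+h : ∀ j x → q j ∣ x → ¬ (q j ∣ x ℕ.+ h j)
    q∣⇒q∤+h j x q∣x q∣x+h = q∤h j (∣+⇒∣ (h j) q∣x (≡.subst (q j ∣_) (ℕ.+-comm x (h j)) q∣x+h))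

  periodicPart-periodic : ∀ j G → IsStep G → ∀ x → periodicPart j G (x ℕ.+ h j) ≈ periodicPart j G x
  periodicPart-periodic j G step x with q j ∣? x | q j ∣? (x ℕ.+ h j)
  ... | yes q∣x | yes q∣x+h = ⊥-elim (q∣⇒q∤+h j x q∣x q∣x+h)
  ... | yes _   | no  _     = refl
  ... | no  q∤x | yes q∣x+h = step (x ℕ.+ h j ℕ.+ h j) x (~-if-q∤ j (q∣⇒q∤+h j (x ℕ.+ h j) q∣x+h) q∤x
        (λ d d∣h → (λ d∣ → ∣+⇒∣ x d∣h (∣+⇒∣ (x ℕ.+ h j) d∣h d∣))
                 , (λ d∣x → ∣⇒∣+ (x ℕ.+ h j) d∣h (∣⇒∣+ x d∣h d∣x))))
  ... | no  q∤x | no  q∤x+h = step (x ℕ.+ h j) x (~-if-q∤ j q∤x+h q∤x (λ d d∣h → ∣+⇒∣ x d∣h , ∣⇒∣+ x d∣h))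

  differencePart-isStep : ∀ j G → IsStep G → IsStep (differencePart j G)
  differencePart-isStep j G step x y x~y with q j ∣? x | q j ∣? y
  ... | yes q∣x | yes q∣y = +-cong (step x y x~y) (-‿cong (step (x ℕ.+ h j) (y ℕ.+ h j) x+h~y+h))
    where
    x+h~y+h : x ℕ.+ h j ~ y ℕ.+ h j
    x+h~y+h d d∣M with d ∣? h j
    ... | yes d∣h = (λ d∣ → ∣⇒∣+ y d∣h (proj₁ (x~y d d∣M) (∣+⇒∣ x d∣h d∣)))
                  , (λ d∣ → ∣⇒∣+ x d∣h (proj₂ (x~y d d∣M) (∣+⇒∣ y d∣h d∣)))
    ... | no  d∤h = (λ d∣ → ⊥-elim (q∣⇒q∤+h j x q∣x (ℕ∣.∣-trans (∤h⇒q∣ j d d∣M d∤h) d∣)))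
                  , (λ d∣ → ⊥-elim (q∣⇒q∤+h j y q∣y (ℕ∣.∣-trans (∤h⇒q∣ j d d∣M d∤h) d∣)))
  ... | yes q∣x | no  q∤y = ⊥-elim (q∤y (proj₁ (x~y (q j) (q∣M j)) q∣x))
  ... | no  q∤x | yes q∣y = ⊥-elim (q∤x (proj₂ (x~y (q j) (q∣M j)) q∣y))
  ... | no  _   | no  _   = refl

  altSum : ∀ k → (Fin k → ℕ) → Fn → ℕ → Carrier
  altSum k a H b = sumBits k (λ ε → negOnePow (weight ε) * H (b ℕ.+ dot ε a))

  altSum-suc : ∀ k a H b → altSum (suc k) a H b ≈ altSum k (a ∘ suc) H b - altSum k (a ∘ suc) H (b ℕ.+ a zero)
  altSum-suc k a H b = begin
    altSum (suc k) a H b                                 ≈⟨ sumBits-suc k _ ⟩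
    sumBits k (λ ε → T (false ∷ ε) + T (true ∷ ε))      ≈⟨ sumBits-cong k (λ ε → +-cong (T-false ε) (T-true ε)) ⟩
    sumBits k (λ ε → T′ b ε + - T′ (b ℕ.+ a zero) ε)       ≈⟨ sumBits-+ k _ _ ⟩
    altSum k a′ H b + sumBits k (λ ε → - T′ (b ℕ.+ a zero) ε) ≈⟨ +-congˡ (sumBits-‿ k _) ⟩
    altSum k a′ H b - altSum k a′ H (b ℕ.+ a zero)         ∎
    where
    open ≈-Reasoning
    a′ = a ∘ suc
    T : Vec Bool (suc k) → Carrier
    T ε = negOnePow (weight ε) * H (b ℕ.+ dot ε a)
    T′ : ℕ → Vec Bool k → Carrier
    T′ b′ ε = negOnePow (weight ε) * H (b′ ℕ.+ dot ε a′)
    T-false : ∀ ε → T (false ∷ ε) ≈ T′ b ε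
    T-false ε = reflexive (≡.cong₂ (λ w s → negOnePow w * H (b ℕ.+ s)) (weight-∷ false ε) (dot-∷ false ε a))
    T-true : ∀ ε → T (true ∷ ε) ≈ - T′ (b ℕ.+ a zero) ε
    T-true ε = trans (reflexive (≡.cong₂ (λ w s → negOnePow w * H s) (weight-∷ true ε) vertex≡))
                     (sym (-‿distribˡ-* _ _))
      where
      vertex≡ : b ℕ.+ dot (true ∷ ε) a ≡ b ℕ.+ a zero ℕ.+ dot ε a′
      vertex≡ = ≡.trans (≡.cong (b ℕ.+_) (≡.trans (dot-∷ true ε a) (≡.cong (ℕ._+ dot ε a′) (ℕ.+-identityʳ (a zero)))))
                        (≡.sym (ℕ.+-assoc b (a zero) (dot ε a′)))

  altSum-periodic : ∀ k (a : Fin k → ℕ) i H → (∀ x → H (x ℕ.+ a i) ≈ H x) → ∀ b → altSum k a H b ≈ 0#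
  altSum-periodic (suc k) a zero    H periodic b = begin
    altSum (suc k) a H b                                 ≈⟨ altSum-suc k a H b ⟩
    altSum k a′ H b - altSum k a′ H (b ℕ.+ a zero)         ≈⟨ +-congˡ (-‿cong (sumBits-cong k translate)) ⟩
    altSum k a′ H b - altSum k a′ H b                    ≈⟨ -‿inverseʳ _ ⟩
    0#                                                   ∎
    where
    open ≈-Reasoning
    a′ = a ∘ suc
    translate : ∀ ε → negOnePow (weight ε) * H (b ℕ.+ a zero ℕ.+ dot ε a′) ≈ negOnePow (weight ε) * H (b ℕ.+ dot ε a′)
    translate ε = *-congˡ (trans (reflexive (≡.cong H reorder)) (periodic _))
      where
      reorder : b ℕ.+ a zero ℕ.+ dot ε a′ ≡ b ℕ.+ dot ε a′ ℕ.+ a zero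
      reorder = ≡.trans (ℕ.+-assoc b _ _) (≡.trans (≡.cong (b ℕ.+_) (ℕ.+-comm (a zero) _)) (≡.sym (ℕ.+-assoc b _ _)))
  altSum-periodic (suc k) a (suc i) H periodic b = begin
    altSum (suc k) a H b                                 ≈⟨ altSum-suc k a H b ⟩
    altSum k (a ∘ suc) H b - altSum k (a ∘ suc) H (b ℕ.+ a zero)
      ≈⟨ +-cong (altSum-periodic k (a ∘ suc) i H periodic b) (-‿cong (altSum-periodic k (a ∘ suc) i H periodic _)) ⟩
    0# - 0#                                              ≈⟨ -‿inverseʳ 0# ⟩
    0#                                                   ∎
    where open ≈-Reasoning

  periodic-* : ∀ (H : Fn) a → (∀ x → H (x ℕ.+ a) ≈ H x) → ∀ t x → H (x ℕ.+ t ℕ.* a) ≈ H x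
  periodic-* H a periodic zero    x = reflexive (≡.cong H (ℕ.+-identityʳ x))
  periodic-* H a periodic (suc t) x =
    trans (reflexive (≡.cong H (≡.sym (ℕ.+-assoc x a (t ℕ.* a))))) (trans (periodic-* H a periodic t (x ℕ.+ a)) (periodic x))

  -- G is invisible to both sides of the theorem: Φ_M divides its mask and all its cuboid sums vanish.
  Negligible : Fn → Set (c ⊔ ℓ)
  Negligible G = Φ M ∣ₓ map G (upTo M) × (∀ (Δ : Cuboid K p M) → altSum K (cuboidStep Δ) G (toℕ (Cuboid.c Δ)) ≈ 0#)

  map-≋ : ∀ {G G′ : Fn} → (∀ x → G x ≈ G′ x) → ∀ L → map G L ≋ map G′ L
  map-≋ G≈G′ []      = ≋-refl
  map-≋ G≈G′ (x ∷ L) = ∷-cong (G≈G′ x) (map-≋ G≈G′ L)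

  map-+ : ∀ (G G′ : Fn) L → map (λ x → G x + G′ x) L ≋ (map G L +ₚ map G′ L)
  map-+ G G′ []      = ≋-refl
  map-+ G G′ (x ∷ L) = ∷-cong refl (map-+ G G′ L)

  Negligible-cong : ∀ {G G′} → (∀ x → G x ≈ G′ x) → Negligible G → Negligible G′
  Negligible-cong G≈G′ (Φ∣ , vanish) =
    ∣ₓ-cong (≋-refl {Φ M}) (map-≋ G≈G′ (upTo M)) Φ∣ ,
    λ Δ → trans (sym (sumBits-cong K (λ ε → *-congˡ (G≈G′ _)))) (vanish Δ)

  Negligible-+ : ∀ {G G′} → Negligible G → Negligible G′ → Negligible (λ x → G x + G′ x)
  Negligible-+ {G} {G′} (Φ∣ , vanish) (Φ∣′ , vanish′) =
    ∣ₓ-cong (≋-refl {Φ M}) (≋-sym (map-+ G G′ (upTo M))) (∣ₓ-+ₚ Φ∣ Φ∣′) ,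
    λ Δ → trans (sumBits-cong K (λ ε → distribˡ _ _ _))
                (trans (sumBits-+ K _ _) (trans (+-cong (vanish Δ) (vanish′ Δ)) (+-identityʳ 0#)))

  Negligible-0 : Negligible (λ _ → 0#)
  Negligible-0 = ∣ₓ-cong (≋-refl {Φ M}) (≋-sym (zeros (upTo M))) ∣ₓ-[] ,
                 λ Δ → trans (sumBits-cong K (λ ε → zeroʳ _)) (sumBits-0 K)
    where
    zeros : ∀ L → map (λ (_ : ℕ) → 0#) L ≋ []
    zeros []      = ≋-refl
    zeros (x ∷ L) = ≋-trans (∷-cong refl (zeros L)) const-0

  private
    applyUpTo-+ : ∀ (H : Fn) a b → applyUpTo H (a ℕ.+ b) ≡ applyUpTo H a ++ applyUpTo (λ i → H (a ℕ.+ i)) b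
    applyUpTo-+ H zero    b = ≡.refl
    applyUpTo-+ H (suc a) b = ≡.cong (H 0 ∷_) (applyUpTo-+ (H ∘ suc) a b)

    applyUpTo-≋ : ∀ {H H′ : Fn} → (∀ i → H i ≈ H′ i) → ∀ N → applyUpTo H N ≋ applyUpTo H′ N
    applyUpTo-≋ H≈H′ zero    = ≋-refl
    applyUpTo-≋ H≈H′ (suc N) = ∷-cong (H≈H′ 0) (applyUpTo-≋ (H≈H′ ∘ suc) N)

    ++-congˡ : ∀ P {Q Q′} → Q ≋ Q′ → (P ++ Q) ≋ (P ++ Q′)
    ++-congˡ P {Q} {Q′} Q≋Q′ = ≋-trans (++≋+ₚshift P Q) (≋-trans (+ₚ-congˡ P (≋-trans (shift≋X^*ₚ (length P) Q)
      (≋-trans (*ₚ-congˡ (X^ length P) Q≋Q′) (≋-sym (shift≋X^*ₚ (length P) Q′))))) (≋-sym (++≋+ₚshift P Q′)))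

  mask-periodic : ∀ (H : Fn) a → (∀ x → H (x ℕ.+ a) ≈ H x) →
                  ∀ t → applyUpTo H (a ℕ.* t) ≋ (geometric a t *ₚ applyUpTo H a)
  mask-periodic H a periodic zero    = ≋-reflexive (≡.cong (applyUpTo H) (ℕ.*-zeroʳ a))
  mask-periodic H a periodic (suc t) = begin
    applyUpTo H (a ℕ.* suc t)
      ≡⟨ ≡.trans (≡.cong (applyUpTo H) (ℕ.*-suc a t)) (applyUpTo-+ H a (a ℕ.* t)) ⟩
    L₀ ++ applyUpTo (λ i → H (a ℕ.+ i)) (a ℕ.* t)
      ≈⟨ ++-congˡ L₀ (≋-trans (applyUpTo-≋ (λ i → trans (reflexive (≡.cong H (ℕ.+-comm a i))) (periodic i)) (a ℕ.* t))
                               (mask-periodic H a periodic t)) ⟩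
    L₀ ++ (geometric a t *ₚ L₀)
      ≈⟨ ++≋+ₚshift L₀ _ ⟩
    L₀ +ₚ shift (length L₀) (geometric a t *ₚ L₀)
      ≈⟨ +ₚ-congˡ L₀ (≋-trans (≋-reflexive (≡.cong (λ z → shift z (geometric a t *ₚ L₀)) (List.length-applyUpTo H a)))
                               (shift≋X^*ₚ a _)) ⟩
    L₀ +ₚ (X^ a *ₚ (geometric a t *ₚ L₀))
      ≈⟨ +ₚ-congʳ (X^ a *ₚ (geometric a t *ₚ L₀)) (≋-sym (*ₚ-identityˡ L₀)) ⟩
    (const 1# *ₚ L₀) +ₚ (X^ a *ₚ (geometric a t *ₚ L₀))
      ≈⟨ PSolver.solve 4 (λ o l w g → o :* l :+ w :* (g :* l) := (o :+ w :* g) :* l) ≋-refl (const 1#) L₀ (X^ a) (geometric a t) ⟩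
    geometric a (suc t) *ₚ L₀ ∎
    where
    open ≋-Reasoning
    open PSolver using (_:+_; _:*_; _:=_)
    L₀ = applyUpTo H a

  Negligible-periodic : ∀ j H → (∀ x → H (x ℕ.+ h j) ≈ H x) → Negligible H
  Negligible-periodic j H periodic = Φ∣mask , λ Δ → altSum-periodic K (cuboidStep Δ) j H (periodic-* H (h j) periodic (Cuboid.ρ Δ j)) _
    where
    Φ∣mask : Φ M ∣ₓ map H (upTo M)
    Φ∣mask = ∣ₓ-cong (≋-refl {Φ M})
      (≋-sym (≋-trans (≋-reflexive (≡.trans (List.map-upTo H M) (≡.cong (applyUpTo H) (≡.sym (h*p≡M j)))))
                      (mask-periodic H (h j) periodic (p j))))
      (∣ₓ⇒∣ₓ*ₚ (applyUpTo H (h j)) (Φ∣ₓgeometric M (h j) (p j) (1≤h j) (h<M j) (≡.sym (h*p≡M j))))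

  iteratedDifference : ∀ k → (Fin k → Fin K) → Fn → Fn
  iteratedDifference zero    σ G = G
  iteratedDifference (suc k) σ G = differencePart (σ zero) (iteratedDifference k (σ ∘ suc) G)

  iteratedDifference-isStep : ∀ k σ G → IsStep G → IsStep (iteratedDifference k σ G)
  iteratedDifference-isStep zero    σ G step = step
  iteratedDifference-isStep (suc k) σ G step =
    differencePart-isStep (σ zero) (iteratedDifference k (σ ∘ suc) G) (iteratedDifference-isStep k (σ ∘ suc) G step)

  -- G = C₁ + D₁ G = C₁ + C₂ + D₂ D₁ G = ⋯, where each periodic part Cⱼ is negligible.
  negligible-remainder : ∀ k σ G → IsStep G → Negligible (λ x → G x - iteratedDifference k σ G x)
  negligible-remainder zero    σ G step = Negligible-cong (λ x → sym (-‿inverseʳ (G x))) Negligible-0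
  negligible-remainder (suc k) σ G step = Negligible-cong regroup
    (Negligible-+ (negligible-remainder k (σ ∘ suc) G step)
                  (Negligible-periodic j (periodicPart j D) (periodicPart-periodic j D (iteratedDifference-isStep k (σ ∘ suc) G step))))
    where
    j = σ zero
    D = iteratedDifference k (σ ∘ suc) G
    regroup : ∀ x → (G x - D x) + periodicPart j D x ≈ G x - differencePart j D x
    regroup x = begin
      (G x - D x) + periodicPart j D x
        ≈⟨ +-congˡ (RSolver.solve 2 (λ c d → c RSolver.:= (c RSolver.:+ d) RSolver.:- d) refl _ _) ⟩
      (G x - D x) + ((periodicPart j D x + differencePart j D x) - differencePart j D x)
        ≈⟨ +-congˡ (+-congʳ (sym (periodicPart+differencePart j D x))) ⟩
      (G x - D x) + (D x - differencePart j D x)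
        ≈⟨ RSolver.solve 3 (λ g f d → (g RSolver.:- f) RSolver.:+ (f RSolver.:- d) RSolver.:= g RSolver.:- d) refl
             (G x) (D x) (differencePart j D x) ⟩
      G x - differencePart j D x ∎
      where open ≈-Reasoning

  private
    injective-suc : ∀ {k} {σ : Fin (suc k) → Fin K} → (∀ i j → σ i ≡ σ j → i ≡ j) →
                    ∀ i j → σ (suc i) ≡ σ (suc j) → i ≡ j
    injective-suc injective i j e = Fin.suc-injective (injective (suc i) (suc j) e)

    q∣h-σ : ∀ {k} {σ : Fin (suc k) → Fin K} → (∀ i j → σ i ≡ σ j → i ≡ j) → ∀ i → q (σ (suc i)) ∣ h (σ zero)
    q∣h-σ injective i = q∣h _ _ (λ e → case injective (suc i) zero e of λ ())
      where open import Function.Base using (case_of_)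

  iteratedDifference-∣ : ∀ k σ → (∀ i j → σ i ≡ σ j → i ≡ j) → ∀ G x → (∀ i → q (σ i) ∣ x) →
                         iteratedDifference k σ G x ≈ altSum k (h ∘ σ) G x
  iteratedDifference-∣ zero    σ injective G x _ =
    sym (trans (+-identityʳ _) (trans (*-identityˡ _) (reflexive (≡.cong G (ℕ.+-identityʳ x)))))
  iteratedDifference-∣ (suc k) σ injective G x q∣x with q (σ zero) ∣? x
  ... | no  q∤x = ⊥-elim (q∤x (q∣x zero))
  ... | yes _   = trans
    (+-cong (iteratedDifference-∣ k (σ ∘ suc) (injective-suc injective) G x (q∣x ∘ suc))
            (-‿cong (iteratedDifference-∣ k (σ ∘ suc) (injective-suc injective) G (x ℕ.+ h (σ zero))
                      (λ i → ∣⇒∣+ x (q∣h-σ injective i) (q∣x (suc i))))))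
    (sym (altSum-suc k (h ∘ σ) G x))

  iteratedDifference-∤ : ∀ k σ → (∀ i j → σ i ≡ σ j → i ≡ j) → ∀ G x i → ¬ (q (σ i) ∣ x) →
                         iteratedDifference k σ G x ≈ 0#
  iteratedDifference-∤ (suc k) σ injective G x i q∤x with q (σ zero) ∣? x
  ... | no  _   = refl
  iteratedDifference-∤ (suc k) σ injective G x zero    q∤x | yes q∣x = ⊥-elim (q∤x q∣x)
  iteratedDifference-∤ (suc k) σ injective G x (suc i) q∤x | yes _   = trans
    (+-cong (iteratedDifference-∤ k (σ ∘ suc) (injective-suc injective) G x i q∤x)
            (-‿cong (iteratedDifference-∤ k (σ ∘ suc) (injective-suc injective) G (x ℕ.+ h (σ zero)) i
                      (λ q∣x+h → q∤x (∣+⇒∣ x (q∣h-σ injective i) q∣x+h)))))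
    (trans (+-congˡ -0#≈0#) (+-identityʳ 0#))

module MaskAndCuboids {c ℓ} (R : CommutativeRing c ℓ) (isField : Over.IsField R) (charZero : Over.CharZero R)
  (K : ℕ) (p n : Fin K → ℕ) (pr : ∀ i → Prime (p i)) (distinct : PrimePowerProducts.Distinct p)
  (1≤n : ∀ i → 1 ≤ n i) (f : Fin (modulusOf p n) → CommutativeRing.Carrier R) (step : Over.IsStepFunction R f) where
  open import Data.Nat as ℕ using (zero; suc; _<_; s≤s; NonZero)
  import Data.Nat.Properties as ℕ
  open import Data.Nat.Divisibility as ℕ∣ using (_∣_; _∣?_; divides)
  open import Data.Nat.DivMod using (_%_; m<n⇒m%n≡m)
  open import Data.Nat.GCD using (gcd; gcd[m,n]∣m; gcd[m,n]∣n; gcd-greatest)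
  open import Data.Fin as Fin using (Fin; toℕ)
  import Data.Fin.Properties as Fin
  open import Data.Bool using (Bool; if_then_else_)
  open import Data.Vec using (Vec)
  import Data.Integer as ℤ
  open import Data.List using (List; []; _∷_; map; upTo; applyUpTo; tabulate)
  import Data.List.Properties as List
  open import Data.Product using (∃; _,_; proj₁; proj₂; _×_)
  open import Data.Sum using (inj₁; inj₂)
  open import Data.Nat.Primality using (euclidsLemma)
  open import Function.Base using (_∘_; id)
  open import Function.Bundles using (_⇔_; mk⇔; Equivalence)
  open import Relation.Nullary using (¬_; no)
  open import Relation.Nullary.Decidable using (dec-true; dec-false)
  open import Relation.Binary.PropositionalEquality using (_≡_; _≢_)
  import Relation.Binary.PropositionalEquality as ≡

  open CommutativeRing R hiding (zero)
  open Over R using (negOnePow; cuboidEval; mask)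
  open Modulus K p n pr distinct 1≤n
  open PolynomialArithmetic R
  open Cyclotomic R isField charZero using (Φ)
  open BitVectors
  open SumOverBits R
  open StepDecomposition R isField charZero K p n pr distinct 1≤n
  open CoefficientsAtMultiples R M
  open ProductExpansion R

  instance
    M-nonZero : NonZero M
    M-nonZero = ℕ.>-nonZero 1≤M

  0ₘ : Fin M
  0ₘ = Fin.fromℕ< 1≤M

  reduce-irrelevant : ∀ m (z z′ : Fin m) x → reduce m z x ≡ reduce m z′ x
  reduce-irrelevant (suc m) z z′ x = ≡.refl

  toℕ-reduce : ∀ m ⦃ _ : NonZero m ⦄ (z : Fin m) x → toℕ (reduce m z x) ≡ x % m
  toℕ-reduce (suc m) z x = Fin.toℕ-fromℕ< _

  reduce-toℕ : ∀ m (z y : Fin m) → reduce m z (toℕ y) ≡ y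
  reduce-toℕ (suc m) z y = Fin.toℕ-injective (≡.trans (Fin.toℕ-fromℕ< _) (m<n⇒m%n≡m (Fin.toℕ<n y)))

  f̂ : Fn
  f̂ x = f (reduce M 0ₘ x)

  %~ : ∀ x → x % M ~ x
  %~ x d d∣M = ℕ∣.∣n∣m%n⇒∣m d∣M , λ d∣x → ℕ∣.%-presˡ-∣ d∣x d∣M

  ~⇒gcd≡ : ∀ {x y} → x ~ y → gcd x M ≡ gcd y M
  ~⇒gcd≡ {x} {y} x~y = ℕ∣.∣-antisym
    (gcd-greatest (proj₁ (x~y _ (gcd[m,n]∣n x M)) (gcd[m,n]∣m x M)) (gcd[m,n]∣n x M))
    (gcd-greatest (proj₂ (x~y _ (gcd[m,n]∣n y M)) (gcd[m,n]∣m y M)) (gcd[m,n]∣n y M))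

  f̂-isStep : IsStep f̂
  f̂-isStep x y x~y = step _ _ (≡.trans (≡.cong (λ z → gcd z M) (toℕ-reduce M 0ₘ x))
    (≡.trans (~⇒gcd≡ (~-trans (%~ x) (~-trans x~y (~-sym (%~ y))))) (≡.sym (≡.cong (λ z → gcd z M) (toℕ-reduce M 0ₘ y)))))

  λ₀ : Carrier
  λ₀ = altSum K h f̂ 0

  D : Fn
  D = iteratedDifference K id f̂

  D-multiple : ∀ x → M ∣ x → D x ≈ λ₀
  D-multiple x (divides t ≡.refl) = trans (iteratedDifference-∣ K id (λ _ _ e → e) f̂ (t ℕ.* M) q∣tM)
    (sumBits-cong K (λ ε → *-congˡ (f̂-isStep _ _ tM+~)))
    where
    q∣tM : ∀ j → q j ∣ t ℕ.* M
    q∣tM j = ℕ∣.∣n⇒∣m*n t (q∣M j)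
    tM+~ : ∀ {y} → t ℕ.* M ℕ.+ y ~ y
    tM+~ {y} = ≡.subst (_~ y) (ℕ.+-comm y (t ℕ.* M)) (+*M~ y t)

  D-non-multiple : ∀ x → ¬ (M ∣ x) → D x ≈ 0#
  D-non-multiple x M∤x with Fin.¬∀⟶∃¬ K (λ j → q j ∣ x) (λ j → q j ∣? x) (λ q∣x → M∤x (q∣⇒M∣ x q∣x))
  ... | j , q∤x = iteratedDifference-∤ K id (λ _ _ e → e) f̂ x j q∤x

  mask≡ : mask f ≡ map f̂ (upTo M)
  mask≡ = ≡.trans (List.map-tabulate id f)
    (≡.trans (tabulate≡applyUpTo M f f̂ (λ i → ≡.cong f (≡.sym (reduce-toℕ M 0ₘ i)))) (≡.sym (List.map-upTo f̂ M)))
    where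
    tabulate≡applyUpTo : ∀ m (g : Fin m → Carrier) (H : Fn) → (∀ i → g i ≡ H (toℕ i)) → tabulate g ≡ applyUpTo H m
    tabulate≡applyUpTo zero    g H g≡H = ≡.refl
    tabulate≡applyUpTo (suc m) g H g≡H =
      ≡.cong₂ _∷_ (g≡H Fin.zero) (tabulate≡applyUpTo m (g ∘ Fin.suc) (H ∘ suc) (g≡H ∘ Fin.suc))

  mask-indicator : ∀ m (G : Fn) a → (∀ x → m ∣ x → G x ≈ a) → (∀ x → ¬ (m ∣ x) → G x ≈ 0#) → 1 ≤ m →
                   map G (upTo m) ≋ const a
  mask-indicator (suc m) G a at-multiple elsewhere _ =
    ∷-cong (at-multiple 0 (suc m ℕ∣.∣0)) (vanish (applyUpTo suc m)
      (All.applyUpTo⁺₁ suc m (λ i<m m∣ → ℕ.<⇒≱ (s≤s i<m) (ℕ∣.∣⇒≤ m∣))))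
    where
    open import Data.List.Relation.Unary.All using (All; []; _∷_)
    import Data.List.Relation.Unary.All.Properties as All
    vanish : ∀ xs → All (λ x → ¬ (suc m ∣ x)) xs → map G xs ≋ []
    vanish []       []          = ≋-refl
    vanish (x ∷ xs) (m∤x ∷ m∤xs) = ≋-trans (∷-cong (elsewhere x m∤x) (vanish xs m∤xs)) const-0

  mask-D : map D (upTo M) ≋ const λ₀
  mask-D = mask-indicator M D λ₀ D-multiple D-non-multiple 1≤M

  private
    -+-cancel : ∀ a b → (a - b) + b ≈ a
    -+-cancel a b = trans (+-assoc _ _ _) (trans (+-congˡ (-‿inverseˡ b)) (+-identityʳ a))

  f̂-remainder-negligible : Negligible (λ x → f̂ x - D x)
  f̂-remainder-negligible = negligible-remainder K id f̂ f̂-isStep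

  mask-decomposition : ∃ λ G → mask f ≋ ((Φ M *ₚ G) +ₚ const λ₀)
  mask-decomposition = cofactor Φ∣ , (begin
    mask f                                                    ≡⟨ mask≡ ⟩
    map f̂ (upTo M)                                            ≈⟨ map-≋ (λ x → sym (-+-cancel (f̂ x) (D x))) (upTo M) ⟩
    map (λ x → (f̂ x - D x) + D x) (upTo M)                    ≈⟨ map-+ (λ x → f̂ x - D x) D (upTo M) ⟩
    map (λ x → f̂ x - D x) (upTo M) +ₚ map D (upTo M)          ≈⟨ +ₚ-cong (≋-sym (factorisation Φ∣)) mask-D ⟩
    (Φ M *ₚ cofactor Φ∣) +ₚ const λ₀                          ∎)
    where
    open ≋-Reasoning
    Φ∣ = proj₁ f̂-remainder-negligible

  q∤cuboidStep : ∀ (Δ : Cuboid K p M) i → ¬ (q i ∣ cuboidStep Δ i)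
  q∤cuboidStep Δ i q∣ρh with euclidsLemma ρ (M′ i) (pr i) p∣ρM′
    where
    ρ = Cuboid.ρ Δ i
    ρhp≡qρM′ : ρ ℕ.* h i ℕ.* p i ≡ q i ℕ.* (ρ ℕ.* M′ i)
    ρhp≡qρM′ = ≡.trans (ℕ.*-assoc ρ (h i) (p i)) (≡.trans (≡.cong (ρ ℕ.*_) (≡.trans (h*p≡M i) (M≡q*M′ i)))
      (≡.trans (≡.sym (ℕ.*-assoc ρ (q i) (M′ i)))
      (≡.trans (≡.cong (ℕ._* M′ i) (ℕ.*-comm ρ (q i))) (ℕ.*-assoc (q i) ρ (M′ i)))))
    p∣ρM′ : p i ∣ ρ ℕ.* M′ i
    p∣ρM′ = ℕ∣.*-cancelˡ-∣ (q i) (≡.subst (q i ℕ.* p i ∣_) ρhp≡qρM′ (ℕ∣.*-monoˡ-∣ (p i) q∣ρh))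
  ... | inj₁ p∣ρ  = ℕ.<⇒≱ (Cuboid.ρ-lt Δ i) (ℕ∣.∣⇒≤ ⦃ ℕ.>-nonZero (Cuboid.ρ-pos Δ i) ⦄ p∣ρ)
  ... | inj₂ p∣M′ = p∤M′ i p∣M′

  -- Only the vertex at 0 is a multiple of M, so F[Δ] = ±λ₀.
  cuboidEval≈±λ₀ : ∀ (Δ : Cuboid K p M) ε₀ → toℕ (vertex Δ ε₀) ≡ 0 → cuboidEval f Δ ≈ negOnePow (weight ε₀) * λ₀
  cuboidEval≈±λ₀ Δ ε₀ vertex≡0 = begin
    cuboidEval f Δ
      ≈⟨ sumBits-cong K (λ ε → *-congˡ (reflexive (≡.cong f (reduce-irrelevant M (Cuboid.c Δ) 0ₘ (vertexℕ Δ ε))))) ⟩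
    sumBits K (λ ε → s ε * f̂ (v ε))
      ≈⟨ sumBits-cong K (λ ε → trans (*-congˡ (sym (-+-cancel _ _))) (distribˡ _ _ _)) ⟩
    sumBits K (λ ε → s ε * (f̂ (v ε) - D (v ε)) + s ε * D (v ε))
      ≈⟨ sumBits-+ K _ _ ⟩
    altSum K (cuboidStep Δ) (λ x → f̂ x - D x) (toℕ (Cuboid.c Δ)) + sumBits K (λ ε → s ε * D (v ε))
      ≈⟨ +-congʳ (proj₂ f̂-remainder-negligible Δ) ⟩
    0# + sumBits K (λ ε → s ε * D (v ε))
      ≈⟨ +-identityˡ _ ⟩
    sumBits K (λ ε → s ε * D (v ε))
      ≈⟨ sumBits-single K _ ε₀ (λ ε ε≢ε₀ → trans (*-congˡ (D-non-multiple (v ε) (M∤ ε ε≢ε₀))) (zeroʳ _)) ⟩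
    s ε₀ * D (v ε₀)
      ≈⟨ *-congˡ (D-multiple (v ε₀) M∣v₀) ⟩
    s ε₀ * λ₀ ∎
    where
    open ≈-Reasoning
    s : Vec Bool K → Carrier
    s ε = negOnePow (weight ε)
    v : Vec Bool K → ℕ
    v = vertexℕ Δ
    M∣v₀ : M ∣ v ε₀
    M∣v₀ = ℕ∣.m%n≡0⇒n∣m (v ε₀) M (≡.trans (≡.sym (toℕ-reduce M (Cuboid.c Δ) (v ε₀))) vertex≡0)
    M∤ : ∀ ε → ε ≢ ε₀ → ¬ (M ∣ v ε)
    M∤ ε ε≢ε₀ M∣v = ε≢ε₀ (dot-injective M K (cuboidStep Δ) q q∣M (q∤cuboidStep Δ)
      (λ i j i≢j → ℕ∣.∣n⇒∣m*n (Cuboid.ρ Δ j) (q∣h i j i≢j)) (toℕ (Cuboid.c Δ)) ε ε₀ M∣v M∣v₀)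


  negOnePow-cancel : ∀ k {x} → negOnePow k * x ≈ 0# → x ≈ 0#
  negOnePow-cancel k {x} sx≈0 = begin
    x                                    ≈⟨ sym (*-identityˡ x) ⟩
    1# * x                               ≈⟨ *-congʳ (sym (negOnePow² k)) ⟩
    (negOnePow k * negOnePow k) * x      ≈⟨ *-assoc _ _ _ ⟩
    negOnePow k * (negOnePow k * x)      ≈⟨ *-congˡ sx≈0 ⟩
    negOnePow k * 0#                     ≈⟨ zeroʳ _ ⟩
    0#                                   ∎
    where
    open ≈-Reasoning
    negOnePow² : ∀ k → negOnePow k * negOnePow k ≈ 1#
    negOnePow² zero    = *-identityʳ 1#
    negOnePow² (suc k) =
      trans (RSolver.solve 1 (λ a → (RSolver.:- a) RSolver.:* (RSolver.:- a) RSolver.:= a RSolver.:* a) refl (negOnePow k))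
            (negOnePow² k)

  ∏Xʰ−1 ∏1−Xʰ : Poly
  ∏Xʰ−1 = prodFinₚ K (λ j → Xⁿ−1 (h j))
  ∏1−Xʰ = prodFinₚ K (λ j → const 1# −ₚ X^ h j)

  -- Every proper divisor d of M divides some h_j, so Φ_d ∣ X^{h_j} − 1.
  Xᴹ−1∣ₓ∏Xʰ−1*Φ : Xⁿ−1 M ∣ₓ (∏Xʰ−1 *ₚ Φ M)
  Xᴹ−1∣ₓ∏Xʰ−1*Φ = Cyclotomic.Xⁿ−1∣ₓ*ₚΦ R isField charZero M 1≤M ∏Xʰ−1 Φ∣
    where
    Φ∣ : ∀ d → 1 ≤ d → d < M → d ∣ M → Φ d ∣ₓ ∏Xʰ−1
    Φ∣ d 1≤d d<M d∣M with proper-divisor∣h d d∣M d<M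
    ... | j , d∣h = ∣ₓ-trans (Cyclotomic.Φ∣ₓXⁿ−1 R isField charZero d 1≤d (Cyclotomic.correct R isField charZero d 1≤d))
                      (∣ₓ-trans (PowersMinusOne.Xⁿ−1-∣ₓ R d (h j) d∣h) (factor∣ₓprodFinₚ K (λ j → Xⁿ−1 (h j)) j))

  ∏1−Xʰ≋ : ∏1−Xʰ ≋ (∏Xʰ−1 *ₚ prodFinₚ K (λ _ → -ₚ const 1#))
  ∏1−Xʰ≋ = ≋-trans (prodFinₚ-cong K (λ j → PSolver.solve 1 (λ x → one :- x := (x :- one) :* (:- one)) ≋-refl (X^ h j)))
                   (prodFinₚ-*ₚ K (λ j → Xⁿ−1 (h j)) (λ _ → -ₚ const 1#))
    where
    open PSolver using (_:-_; _:*_; :-_; _:=_; con)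
    one = con (ℤ.+ 1)

  -- Only ε = 0 contributes an exponent ε·h divisible by M.
  σ-∏1−Xʰ : σ 0 ∏1−Xʰ ≈ 1#
  σ-∏1−Xʰ = begin
    σ 0 ∏1−Xʰ
      ≈⟨ σ-cong 0 (prodFinₚ-expand K h) ⟩
    σ 0 (SumOverBits.sumBits R[X] K T)
      ≈⟨ sumBits-homomorphic R[X] R (σ 0) refl (σ-+ₚ 0) K T ⟩
    sumBits K (λ ε → σ 0 (T ε))
      ≈⟨ sumBits-cong K (λ ε → trans (σ-cong 0 (const-*ₚ _ (X^ dot ε h)))
                                     (trans (σ-⋆ 0 _ (X^ dot ε h)) (*-congˡ (σ-X^ (dot ε h))))) ⟩
    sumBits K (λ ε → negOnePow (weight ε) * atMultiple (dot ε h) 1#)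
      ≈⟨ sumBits-single K _ (𝟎 {K}) (λ ε ε≢𝟎 → trans (*-congˡ (not-multiple ε ε≢𝟎)) (zeroʳ _)) ⟩
    negOnePow (weight (𝟎 {K})) * atMultiple (dot (𝟎 {K}) h) 1#
      ≡⟨ ≡.cong₂ (λ w s → negOnePow w * atMultiple s 1#) (weight-𝟎 K) (dot-𝟎 K h) ⟩
    1# * atMultiple 0 1#
      ≈⟨ *-identityˡ _ ⟩
    atMultiple 0 1#
      ≡⟨ ≡.cong (λ b → if b then 1# else 0#) (dec-true (M ∣? 0) (M ℕ∣.∣0)) ⟩
    1# ∎
    where
    open ≈-Reasoning
    T : Vec Bool K → Poly
    T ε = const (negOnePow (weight ε)) *ₚ X^ dot ε h
    M∣𝟎 : M ∣ 0 ℕ.+ dot (𝟎 {K}) h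
    M∣𝟎 = ≡.subst (M ∣_) (≡.sym (dot-𝟎 K h)) (M ℕ∣.∣0)
    not-multiple : ∀ ε → ε ≢ (𝟎 {K}) → atMultiple (dot ε h) 1# ≈ 0#
    not-multiple ε ε≢𝟎 = reflexive (≡.cong (λ b → if b then 1# else 0#) (dec-false (M ∣? dot ε h)
      (λ M∣ → ε≢𝟎 (dot-injective M K h q q∣M q∤h q∣h 0 ε (𝟎 {K}) M∣ M∣𝟎))))

  Φ∣mask⇒λ₀≈0 : Φ M ∣ₓ mask f → λ₀ ≈ 0#
  Φ∣mask⇒λ₀≈0 (divₓ G ΦG≋F) = begin
    λ₀                           ≈⟨ sym (*-identityʳ λ₀) ⟩
    λ₀ * 1#                      ≈⟨ *-congˡ (sym σ-∏1−Xʰ) ⟩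
    λ₀ * σ 0 ∏1−Xʰ               ≈⟨ sym (σ-⋆ 0 λ₀ ∏1−Xʰ) ⟩
    σ 0 (λ₀ ⋆ ∏1−Xʰ)             ≈⟨ σ-cong 0 (≋-sym (const-*ₚ λ₀ ∏1−Xʰ)) ⟩
    σ 0 (const λ₀ *ₚ ∏1−Xʰ)
      ≈⟨ σ-∣ₓ (∣ₓ-cong (≋-refl {Xⁿ−1 M}) (≋-sym λ₀∏≋) (∣ₓ⇒∣ₓ*ₚ _ Xᴹ−1∣ₓ∏Xʰ−1*Φ)) ⟩
    0#                           ∎
    where
    open ≈-Reasoning
    open PSolver using (_:+_; _:-_; _:*_; _:=_)
    G₁ = proj₁ mask-decomposition
    λ₀≋ΦG : const λ₀ ≋ (Φ M *ₚ (G −ₚ G₁))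
    λ₀≋ΦG = ≋-Reasoning.begin
      const λ₀
        ≋-Reasoning.≈⟨ PSolver.solve 2 (λ l x → l := (x :+ l) :- x) ≋-refl (const λ₀) (Φ M *ₚ G₁) ⟩
      ((Φ M *ₚ G₁) +ₚ const λ₀) −ₚ (Φ M *ₚ G₁)
        ≋-Reasoning.≈⟨ +ₚ-congʳ (-ₚ (Φ M *ₚ G₁)) (≋-sym (≋-trans ΦG≋F (proj₂ mask-decomposition))) ⟩
      (Φ M *ₚ G) −ₚ (Φ M *ₚ G₁)
        ≋-Reasoning.≈⟨ PSolver.solve 3 (λ φ g g₁ → φ :* g :- φ :* g₁ := φ :* (g :- g₁)) ≋-refl (Φ M) G G₁ ⟩
      Φ M *ₚ (G −ₚ G₁) ≋-Reasoning.∎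
    λ₀∏≋ : (const λ₀ *ₚ ∏1−Xʰ) ≋ ((∏Xʰ−1 *ₚ Φ M) *ₚ ((G −ₚ G₁) *ₚ prodFinₚ K (λ _ → -ₚ const 1#)))
    λ₀∏≋ = ≋-trans (*ₚ-cong λ₀≋ΦG ∏1−Xʰ≋)
      (PSolver.solve 4 (λ φ g a b → (φ :* g) :* (a :* b) := (a :* φ) :* (g :* b)) ≋-refl
        (Φ M) (G −ₚ G₁) ∏Xʰ−1 (prodFinₚ K (λ _ → -ₚ const 1#)))

  λ₀≈0⇒Φ∣mask : λ₀ ≈ 0# → Φ M ∣ₓ mask f
  λ₀≈0⇒Φ∣mask λ₀≈0 = divₓ G (≋-sym (≋-trans F≋ΦG+λ₀
    (≋-trans (+ₚ-congˡ (Φ M *ₚ G) (≋-trans (const-cong λ₀≈0) const-0)) (+ₚ-identityʳ _))))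
    where
    G = proj₁ mask-decomposition
    F≋ΦG+λ₀ = proj₂ mask-decomposition

  standardCuboid : Cuboid K p M
  standardCuboid = record
    { c = 0ₘ ; ρ = λ _ → 1 ; ρ-pos = λ _ → ℕ.≤-refl ; ρ-lt = λ j → PrimePowerProducts.prime⇒1<p (pr j) }

  standardCuboid-vertex0 : HasVertexAtZero standardCuboid
  standardCuboid-vertex0 = (𝟎 {K}) , (begin
    toℕ (vertex standardCuboid (𝟎 {K}))                 ≡⟨ toℕ-reduce M 0ₘ _ ⟩
    (toℕ 0ₘ ℕ.+ dot (𝟎 {K}) (cuboidStep standardCuboid)) % M
      ≡⟨ ≡.cong (_% M) (≡.cong₂ ℕ._+_ (Fin.toℕ-fromℕ< 1≤M) (dot-𝟎 K (cuboidStep standardCuboid))) ⟩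
    0 % M                                                           ≡⟨ ℕ∣.n∣m⇒m%n≡0 0 M (M ℕ∣.∣0) ⟩
    0                                                               ∎)
    where open ≡.≡-Reasoning

  Φ∣mask⇔λ₀≈0 : Over._∣ₚ_ R (Φ M) (mask f) ⇔ (λ₀ ≈ 0#)
  Φ∣mask⇔λ₀≈0 = mk⇔ (λ (G , ΦG≈F) → Φ∣mask⇒λ₀≈0 (divₓ G (mk≋ ΦG≈F)))
                    (λ λ₀≈0 → let divₓ G ΦG≋F = λ₀≈0⇒Φ∣mask λ₀≈0 in G , at ΦG≋F)

  cuboidEval≈0⇔λ₀≈0 : ∀ Δ → HasVertexAtZero Δ → (cuboidEval f Δ ≈ 0#) ⇔ (λ₀ ≈ 0#)
  cuboidEval≈0⇔λ₀≈0 Δ (ε₀ , vertex≡0) = mk⇔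
    (λ F≈0 → negOnePow-cancel (weight ε₀) (trans (sym (cuboidEval≈±λ₀ Δ ε₀ vertex≡0)) F≈0))
    (λ λ₀≈0 → trans (cuboidEval≈±λ₀ Δ ε₀ vertex≡0) (trans (*-congˡ λ₀≈0) (zeroʳ _)))

  all-cuboidEvals≈0⇔λ₀≈0 : ((Δ : Cuboid K p M) → HasVertexAtZero Δ → cuboidEval f Δ ≈ 0#) ⇔ (λ₀ ≈ 0#)
  all-cuboidEvals≈0⇔λ₀≈0 = mk⇔
    (λ F≈0 → Equivalence.to (cuboidEval≈0⇔λ₀≈0 standardCuboid standardCuboid-vertex0)
                            (F≈0 standardCuboid standardCuboid-vertex0))
    (λ λ₀≈0 Δ v → Equivalence.from (cuboidEval≈0⇔λ₀≈0 Δ v) λ₀≈0)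

  some-cuboidEval≈0⇔λ₀≈0 : (∃ λ (Δ : Cuboid K p M) → HasVertexAtZero Δ × cuboidEval f Δ ≈ 0#) ⇔ (λ₀ ≈ 0#)
  some-cuboidEval≈0⇔λ₀≈0 = mk⇔
    (λ (Δ , v , F≈0) → Equivalence.to (cuboidEval≈0⇔λ₀≈0 Δ v) F≈0)
    (λ λ₀≈0 → standardCuboid , standardCuboid-vertex0 ,
              Equivalence.from (cuboidEval≈0⇔λ₀≈0 standardCuboid standardCuboid-vertex0) λ₀≈0)

open CommutativeRing using (Carrier; _≈_; 0#)

proposition3p5 :
    ∀ {c ℓ} (R : CommutativeRing c ℓ) → Over.IsField R → Over.CharZero R →
    (K : ℕ) (p n : Fin K → ℕ) →
    (∀ i → Prime (p i)) → (∀ i j → p i ≡ p j → i ≡ j) → (∀ i → 1 ≤ n i) →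
    (f : Fin (modulusOf p n) → Carrier R) → Over.IsStepFunction R f →
    let M   = modulusOf p n
        I   = Over._∣ₚ_ R (Over.Φ R M) (Over.mask R f)
        II  = (Δ : Cuboid K p M) → HasVertexAtZero Δ → _≈_ R (Over.cuboidEval R f Δ) (0# R)
        III = ∃ λ (Δ : Cuboid K p M) → HasVertexAtZero Δ × _≈_ R (Over.cuboidEval R f Δ) (0# R)
    in (I ⇔ II) × (I ⇔ III)
proposition3p5 R isField charZero K p n pr distinct 1≤n f step =
  ⇔-sym all-cuboidEvals≈0⇔λ₀≈0 ⇔-∘ Φ∣mask⇔λ₀≈0 , ⇔-sym some-cuboidEval≈0⇔λ₀≈0 ⇔-∘ Φ∣mask⇔λ₀≈0
  where
  open import Data.Product using (_,_)
  open import Function.Construct.Symmetry using (⇔-sym)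
  open import Function.Construct.Composition using (_⇔-∘_)
  open MaskAndCuboids R isField charZero K p n pr distinct 1≤n f step
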